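{- For all positive integers $n$, $k$, and $l$ with $k>l$, \[ \mu(\mathbb{Z}_n,\{k,l\}) \;=\; \max_{d\mid n}\left\{ \left\lceil \frac{d-(\delta-r)}{k+l}\right\rceil \cdot \frac{n}{d}\right\}, \] where, for each divisor $d$ of $n$, $\delta=\gcd(d,k-l)$ and $r$ is the remainder of $l\left\lceil (d-\delta)/(k+l)\right\rceil$ modulo $\delta$.
   Context: For a subset $A$ of an abelian group $G$ and a positive integer $h$, $hA$ denotes the $h$-fold sumset $\{a_1+\cdots+a_h : a_1,\dots,a_h\in A\}$ (elements not necessarily distinct). For positive integers $k>l$, a subset $A\subseteq G$ is called $(k,l)$-sum-free if $kA\cap lA=\emptyset$, equivalently $0\notin kA-lA$. $\mu(G,\{k,l\})$ denotes the maximum size of a $(k,l)$-sum-free subset of $G$ (the empty set counts, so the maximum is at least $0$). $\mathbb{Z}_n=\mathbb{Z}/n\mathbb{Z}$. -}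

module Defs where

open import Data.Nat using (ℕ; zero; suc; _+_; _*_; _∸_; _≤_; _<_; _⊔_; NonZero)
open import Data.Nat.DivMod using (_/_; _%_)
open import Data.Nat.GCD using (gcd)
open import Data.Nat.Divisibility using (_∣?_)
open import Data.Fin using (Fin; toℕ)
open import Data.Fin.Subset using (Subset; _∈_; ∣_∣)
open import Data.List using (List; foldr; upTo)
open import Data.Product using (Σ; _×_; ∃)
open import Relation.Binary.PropositionalEquality using (_≡_)
open import Relation.Nullary using (¬_; yes; no)

sumF : ∀ {k} → (Fin k → ℕ) → ℕ
sumF {zero} f = 0
sumF {suc k} f = f Fin.zero + sumF (λ i → f (Fin.suc i))
  where import Data.Fin as Fin

SumFree : (n k l : ℕ) .{{_ : NonZero n}} → Subset n → Set
SumFree n k l A =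
  ¬ (Σ (Fin k → Fin n) λ a → Σ (Fin l → Fin n) λ b →
       (∀ i → a i ∈ A) × (∀ j → b j ∈ A) ×
       (sumF (λ i → toℕ (a i)) % n ≡ sumF (λ j → toℕ (b j)) % n))

IsMu : (n k l : ℕ) .{{_ : NonZero n}} → ℕ → Set
IsMu n k l m =
  (Σ (Subset n) λ A → SumFree n k l A × ∣ A ∣ ≡ m) ×
  (∀ (A : Subset n) → SumFree n k l A → ∣ A ∣ ≤ m)

-- ceiling division ⌈a/b⌉ for b > 0 (value at b = 0 is irrelevant)
ceilDiv : ℕ → ℕ → ℕ
ceilDiv a zero = 0
ceilDiv a (suc b) = (a + b) / suc b

-- remainder a mod b for b > 0 (value at b = 0 is irrelevant)
modN : ℕ → ℕ → ℕ
modN a zero = a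
modN a (suc b) = a % suc b

term : (n k l d : ℕ) → ℕ
term n k l d = ceilDiv (d ∸ (δ ∸ r)) (k + l) * ceilDiv n d
  where
    δ = gcd d (k ∸ l)
    r = modN (l * ceilDiv (d ∸ δ) (k + l)) δ

-- max over divisors d of n (d ranging over 0..n; d = 0 never divides n > 0)
maxOverDivisors : ℕ → (ℕ → ℕ) → ℕ
maxOverDivisors n f = foldr step 0 (upTo (suc n))
  where
    step : ℕ → ℕ → ℕ
    step d acc with d ∣? n
    ... | yes _ = f d ⊔ acc
    ... | no _ = acc

rhs : (n k l : ℕ) → ℕ
rhs n k l = maxOverDivisors n (term n k l)

-- Put 0 ∉ T = kA − lA in ℤ_d with |A| = m + 1.  If T + ⟨x⟩ still misses 0 for some x ≠ 0, pass to the quotient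
-- ℤ_gcd(x,d); so suppose this never happens.  Then A − A has no period, and by the isoperimetric method (an atom of
-- a set with small boundary is a subgroup, since its translates are disjoint or equal) each summand ±A in T adds at
-- least m elements inside the subgroup U generated by A − A, so (k + l) m + 2 ≤ |U|.  When U is proper this is more
-- than enough.  When U = ℤ_d and (k + l) m + gcd(d, k − l) ≥ d, too little room is left for every step
-- jA − lA ⊂ (j + 1)A − lA to add m + 1 elements, and a step adding only m yields a 2-atom: a subgroup (which would
-- give A − A a period), a two-element set (so A is an arithmetic progression), or a set whose translates meet in at
-- most one point, which is excluded by induction on |A|.  For a progression with difference 1 and first element a,
-- T is an interval around (k − l)a, and (k − l)a ranges over the multiples of gcd(d, k − l); counting the lengths for
-- which such an interval can avoid 0 gives the formula.
{-# OPTIONS --safe #-}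
module Submission where

open import Defs

open import Algebra.Core using (Op₁; Op₂)
open import Algebra.Structures using (IsAbelianGroup)
open import Data.Bool.Base using (Bool; true; false; T; _∧_; _∨_; not)
import Data.Bool.Properties as Bool
open import Data.Empty using (⊥; ⊥-elim)
open import Data.Fin.Base using (Fin; zero; suc; toℕ)
open import Data.Fin.Permutation using (Permutation′; permutation; _⟨$⟩ʳ_)
open import Data.Fin.Properties using (all?; any?; toℕ<n; toℕ-fromℕ<; toℕ-injective) renaming (_≟_ to _≟ᶠ_; suc-injective to sucᶠ-injective)
open import Data.Fin.Subset using (Subset; ∣_∣) renaming (_∈_ to _∈ˢ_)
open import Data.List.Base using (List; []; _∷_; applyUpTo; foldr)
open import Data.List.Membership.Propositional using () renaming (_∈_ to _∈ᴸ_)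
open import Data.List.Membership.Propositional.Properties using (∈-applyUpTo⁺)
open import Data.List.Relation.Unary.Any using (here; there)
open import Data.Nat using (ℕ; zero; suc; _+_; _*_; _∸_; _⊔_; _≤_; _<_; _≤ᵇ_; _≤?_; _<?_; z≤n; s≤s; NonZero; ≢-nonZero; ≢-nonZero⁻¹; >-nonZero)
open import Data.Nat.DivMod
open import Data.Nat.Divisibility
open import Data.Nat.GCD using (gcd; gcd[m,n]∣m; gcd[m,n]∣n; gcd-GCD; gcd[m,n]≡0⇒n≡0; gcd-comm; module Bézout)
open import Data.Nat.Properties
open import Algebra.Properties.CommutativeMonoid.Sum +-0-commutativeMonoid using (sum; sum-cong-≗; ∑-distrib-+; sum-permute)
open import Data.Nat.Tactic.RingSolver using (solve-∀)
open import Data.Product using (Σ; ∃; ∃₂; _×_; _,_; proj₁; proj₂)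
open import Data.Sum using (_⊎_; inj₁; inj₂; [_,_]′)
open import Data.Vec.Base as Vec using (Vec; []; _∷_; allFin; lookup; replicate; tabulate; zipWith; _[_]≔_)
open import Data.Vec.N-ary using (N-ary; _$ⁿ_)
open import Data.Vec.Properties using ([]=⇒lookup; lookup⇒[]=; lookup∘tabulate)
open import Function.Base using (_∘_; case_of_)
open import Relation.Binary.PropositionalEquality hiding ([_])
open import Relation.Nullary using (¬_; Dec; yes; no; does)
open import Relation.Nullary.Decidable using (_×-dec_; ¬?; dec-true)

-- Linear arithmetic over ℕ

-- With δ = gcd(d, k - l), what a non-progression has to satisfy is (k + l)m + δ < d. Since δ ≤ k,
-- one additional element in k - 1 of the k + l steps is enough, so only the steps from -lA towards
-- kA - lA are sharpened, and not the last one, after which a single point is known to be missed. If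
-- U is proper, |U| ≤ d/2, while δ ≤ d/2 because δ = d would give ka = la. Reduction needs only a
-- period x of A - A, not of A: as k, l ≥ 1, a multiple of x can be absorbed by exchanging one
-- summand on each side. The delicate case is a 2-atom M whose translates meet in at most one point.
-- If M is smaller than the set B, the two exchange roles, and the induction yields a subgroup H for
-- which H + M has few holes; it says nothing about B yet. Carrying it over to B is a separate
-- descent through subgroups having a coset that contains M. Neither reducibility nor the subgroup
-- generated by A - a is ever decided. Both occur only in refutations, which suffices because the
-- final claim is a decidable inequality.

infixl 6 _:+_
infix  5.5 _:≤_

data LinExpr (n : ℕ) : Set where
  var  : Fin n → LinExpr n
  con  : ℕ → LinExpr n
  _:+_ : LinExpr n → LinExpr n → LinExpr n

record Ineq (n : ℕ) : Set where
  constructor _:≤_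
  field smaller larger : LinExpr n
open Ineq

⟦_⟧ : ∀ {n} → LinExpr n → Vec ℕ n → ℕ
⟦ var i ⟧ ρ  = lookup ρ i
⟦ con c ⟧ ρ  = c
⟦ e :+ f ⟧ ρ = ⟦ e ⟧ ρ + ⟦ f ⟧ ρ

Holds : ∀ {n} → Ineq n → Vec ℕ n → Set
Holds (e :≤ f) ρ = ⟦ e ⟧ ρ ≤ ⟦ f ⟧ ρ

Implies : ∀ {n} → List (Ineq n) → Ineq n → Vec ℕ n → Set
Implies []       g ρ = Holds g ρ
Implies (h ∷ hs) g ρ = Holds h ρ → Implies hs g ρ

dot : ∀ {n} → Vec ℕ n → Vec ℕ n → ℕ
dot []       []      = 0
dot (c ∷ cs) (x ∷ ρ) = c * x + dot cs ρ

dot-+ : ∀ {n} (c d ρ : Vec ℕ n) → dot (zipWith _+_ c d) ρ ≡ dot c ρ + dot d ρ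
dot-+ []       []       []      = refl
dot-+ (c ∷ cs) (d ∷ ds) (x ∷ ρ) rewrite dot-+ cs ds ρ = lemma c d x (dot cs ρ) (dot ds ρ)
  where
  lemma : ∀ c d x p q → (c + d) * x + (p + q) ≡ c * x + p + (d * x + q)
  lemma = solve-∀

dot-0 : ∀ {n} (ρ : Vec ℕ n) → dot (replicate n 0) ρ ≡ 0
dot-0 []      = refl
dot-0 (x ∷ ρ) = dot-0 ρ

dot-unit : ∀ {n} (i : Fin n) (ρ : Vec ℕ n) → dot (replicate n 0 [ i ]≔ 1) ρ ≡ lookup ρ i
dot-unit zero    (x ∷ ρ) rewrite dot-0 ρ = trans (+-identityʳ (1 * x)) (*-identityˡ x)
dot-unit (suc i) (x ∷ ρ) = dot-unit i ρ

Affine : ℕ → Set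
Affine n = Vec ℕ (suc n)

norm : ∀ {n} → LinExpr n → Affine n
norm {n} (var i)  = 0 ∷ (replicate n 0 [ i ]≔ 1)
norm {n} (con c)  = c ∷ replicate n 0
norm (e :+ f)     = zipWith _+_ (norm e) (norm f)

norm-sound : ∀ {n} (e : LinExpr n) ρ → dot (norm e) (1 ∷ ρ) ≡ ⟦ e ⟧ ρ
norm-sound (var i)  ρ = dot-unit i ρ
norm-sound (con c)  ρ rewrite dot-0 ρ = trans (+-identityʳ (c * 1)) (*-identityʳ c)
norm-sound (e :+ f) ρ =
  trans (dot-+ (norm e) (norm f) (1 ∷ ρ)) (cong₂ _+_ (norm-sound e ρ) (norm-sound f ρ))

_≤ᵛ_ : ∀ {n} → Vec ℕ n → Vec ℕ n → Bool
[]       ≤ᵛ []       = true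
(c ∷ cs) ≤ᵛ (d ∷ ds) = (c ≤ᵇ d) ∧ (cs ≤ᵛ ds)

T-∧ : ∀ a {b} → T (a ∧ b) → T a × T b
T-∧ true p = _ , p

≤ᵛ-sound : ∀ {n} (c d ρ : Vec ℕ n) → T (c ≤ᵛ d) → dot c ρ ≤ dot d ρ
≤ᵛ-sound []       []       []      _ = z≤n
≤ᵛ-sound (c ∷ cs) (d ∷ ds) (x ∷ ρ) p =
  +-mono-≤ (*-monoˡ-≤ x (≤ᵇ⇒≤ c d (proj₁ (T-∧ (c ≤ᵇ d) p))))
           (≤ᵛ-sound cs ds ρ (proj₂ (T-∧ (c ≤ᵇ d) p)))

-- The hypotheses eᵢ ≤ fᵢ are added up, each with multiplicity one: it suffices that l + Σ fᵢ ≤ r + Σ eᵢ holds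
-- coefficientwise.
follows : ∀ {n} → List (Ineq n) → (l r : LinExpr n) → Bool
follows []             l r = norm l ≤ᵛ norm r
follows ((e :≤ f) ∷ hs) l r = follows hs (l :+ f) (r :+ e)

-- Moving a hypothesis e ≤ f into the goal is sound because l + e ≤ l + f ≤ r + e, after which e
-- cancels.
linarith′ : ∀ {n} (hs : List (Ineq n)) (g : Ineq n) (l r : LinExpr n) ρ →
  T (follows hs l r) → (⟦ l ⟧ ρ ≤ ⟦ r ⟧ ρ → Holds g ρ) → Implies hs g ρ
linarith′ [] g l r ρ p k =
  k (subst₂ _≤_ (norm-sound l ρ) (norm-sound r ρ) (≤ᵛ-sound (norm l) (norm r) (1 ∷ ρ) p))
linarith′ ((e :≤ f) ∷ hs) g l r ρ p k e≤f =
  linarith′ hs g (l :+ f) (r :+ e) ρ p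
    λ q → k (+-cancelʳ-≤ (⟦ e ⟧ ρ) _ _ (≤-trans (+-monoʳ-≤ (⟦ l ⟧ ρ) e≤f) q))

-- The implicit argument fills itself in: for concrete coefficients the check computes to the unit
-- type. A hypothesis that is needed twice has to be listed twice.
linarith : ∀ {n} (ρ : Vec ℕ n) (f : N-ary n (LinExpr n) (List (Ineq n) × Ineq n)) →
  let hs , g = f $ⁿ Vec.map var (allFin n) in
  {_ : T (follows hs (smaller g) (larger g))} → Implies hs g ρ
linarith {n} ρ f {p} =
  let hs , g = f $ⁿ Vec.map var (allFin n) in linarith′ hs g (smaller g) (larger g) ρ p (λ q → q)

-- Finite sets

infix 4 _∈_ _∈?_ _∉_ _⊆_ _≐_
infixr 6 _∪_
infixr 7 _∩_ _∖_

FSet : ℕ → Set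
FSet n = Fin n → Bool

private
  variable
    n : ℕ

-- A record rather than the bare equation, so that `i` and `X` can be inferred from a membership
-- proof.
record _∈_ (i : Fin n) (X : FSet n) : Set where
  constructor mem
  field holds : X i ≡ true
open _∈_

_∉_ : Fin n → FSet n → Set
i ∉ X = ¬ i ∈ X

_⊆_ _≐_ : FSet n → FSet n → Set
X ⊆ Y = ∀ i → i ∈ X → i ∈ Y
X ≐ Y = ∀ i → X i ≡ Y i

opaque
  _∪_ _∩_ _∖_ : FSet n → FSet n → FSet n
  (X ∪ Y) i = X i ∨ Y i
  (X ∩ Y) i = X i ∧ Y i
  (X ∖ Y) i = X i ∧ not (Y i)

  full : FSet n
  full _ = true

  ⁅_⁆ : Fin n → FSet n
  ⁅ a ⁆ i = does (i ≟ᶠ a)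

  ⟪_⟫ : {P : Fin n → Set} → (∀ i → Dec (P i)) → FSet n
  ⟪ P? ⟫ i = does (P? i)

  _∈?_ : (i : Fin n) (X : FSet n) → Dec (i ∈ X)
  i ∈? X with X i in e
  ... | true  = yes (mem e)
  ... | false = no λ (mem p) → case trans (sym e) p of λ ()

  ∉⇒false : ∀ {i : Fin n} {X} → i ∉ X → X i ≡ false
  ∉⇒false p = Bool.¬-not (p ∘ mem)

  does⁻ : {A : Set} (a? : Dec A) → does a? ≡ true → A
  does⁻ (yes a) _ = a

  ∈⟪⟫⁻ : {P : Fin n → Set} {P? : ∀ i → Dec (P i)} → ∀ {i} → i ∈ ⟪ P? ⟫ → P i
  ∈⟪⟫⁻ {P? = P?} {i} (mem p) = does⁻ (P? i) p

  ∈⟪⟫⁺ : {P : Fin n → Set} {P? : ∀ i → Dec (P i)} → ∀ {i} → P i → i ∈ ⟪ P? ⟫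
  ∈⟪⟫⁺ {P? = P?} {i} p = mem (dec-true (P? i) p)

  ∈full : ∀ {i : Fin n} → i ∈ full
  ∈full = mem refl

  ⊆-antisym : {X Y : FSet n} → X ⊆ Y → Y ⊆ X → X ≐ Y
  ⊆-antisym {X = X} {Y} p q i with X i in eX | Y i in eY
  ... | true  | true  = refl
  ... | false | false = refl
  ... | true  | false = case trans (sym (holds (p i (mem eX)))) eY of λ ()
  ... | false | true  = case trans (sym (holds (q i (mem eY)))) eX of λ ()

  ∈∪⁺ˡ : ∀ {X Y : FSet n} {i} → i ∈ X → i ∈ X ∪ Y
  ∈∪⁺ˡ {X = X} {Y} {i} (mem p) = mem (cong (_∨ Y i) p)

  ∈∪⁺ʳ : ∀ {X Y : FSet n} {i} → i ∈ Y → i ∈ X ∪ Y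
  ∈∪⁺ʳ {X = X} {i = i} (mem p) = mem (trans (cong (X i ∨_) p) (Bool.∨-zeroʳ (X i)))

  ∈∪⁻ : ∀ {X Y : FSet n} {i} → i ∈ X ∪ Y → i ∈ X ⊎ i ∈ Y
  ∈∪⁻ {X = X} {i = i} (mem p) with X i in e
  ... | true  = inj₁ (mem e)
  ... | false = inj₂ (mem p)

  ∈∩⁺ : ∀ {X Y : FSet n} {i} → i ∈ X → i ∈ Y → i ∈ X ∩ Y
  ∈∩⁺ (mem p) (mem q) = mem (cong₂ _∧_ p q)

  ∈∩⁻ : ∀ {X Y : FSet n} {i} → i ∈ X ∩ Y → i ∈ X × i ∈ Y
  ∈∩⁻ {X = X} {i = i} (mem p) with X i in e
  ... | true = mem e , mem p

  ∈∖⁺ : ∀ {X Y : FSet n} {i} → i ∈ X → i ∉ Y → i ∈ X ∖ Y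
  ∈∖⁺ {Y = Y} (mem p) q = mem (cong₂ (λ x y → x ∧ not y) p (∉⇒false {X = Y} q))

  ∈∖⁻ : ∀ {X Y : FSet n} {i} → i ∈ X ∖ Y → i ∈ X × i ∉ Y
  ∈∖⁻ {X = X} {Y} {i} (mem p) with X i in e | Y i in f
  ... | true | false = mem e , λ (mem q) → case trans (sym f) q of λ ()

  ∈⁅⁆⁻ : ∀ {a i : Fin n} → i ∈ ⁅ a ⁆ → i ≡ a
  ∈⁅⁆⁻ {a = a} {i} (mem p) = does⁻ (i ≟ᶠ a) p

  ∈⁅⁆⁺ : ∀ {a i : Fin n} → i ≡ a → i ∈ ⁅ a ⁆
  ∈⁅⁆⁺ {a = a} {i} p = mem (dec-true (i ≟ᶠ a) p)

  ind : Bool → ℕ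
  ind true  = 1
  ind false = 0

  card : FSet n → ℕ
  card X = sum (ind ∘ X)

  card-cong : {X Y : FSet n} → X ≐ Y → card X ≡ card Y
  card-cong e = sum-cong-≗ (cong ind ∘ e)

  card-mono : {X Y : FSet n} → X ⊆ Y → card X ≤ card Y
  card-mono {zero}            _ = z≤n
  card-mono {suc n} {X} {Y} p =
    +-mono-≤ (ind-mono (X zero) (Y zero) (holds ∘ p zero ∘ mem)) (card-mono λ i (mem q) → mem (holds (p (suc i) (mem q))))
    where
    ind-mono : ∀ x y → (x ≡ true → y ≡ true) → ind x ≤ ind y
    ind-mono false y     _ = z≤n
    ind-mono true  true  _ = ≤-refl
    ind-mono true  false q = case q refl of λ ()

  card-∪-∩ : (X Y : FSet n) → card (X ∪ Y) + card (X ∩ Y) ≡ card X + card Y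
  card-∪-∩ X Y = begin
    card (X ∪ Y) + card (X ∩ Y)                       ≡⟨ ∑-distrib-+ (ind ∘ (X ∪ Y)) (ind ∘ (X ∩ Y)) ⟨
    sum (λ i → ind (X i ∨ Y i) + ind (X i ∧ Y i))     ≡⟨ sum-cong-≗ (λ i → pointwise (X i) (Y i)) ⟩
    sum (λ i → ind (X i) + ind (Y i))                 ≡⟨ ∑-distrib-+ (ind ∘ X) (ind ∘ Y) ⟩
    card X + card Y                                   ∎
    where
    open ≡-Reasoning
    pointwise : ∀ x y → ind (x ∨ y) + ind (x ∧ y) ≡ ind x + ind y
    pointwise true  y     = refl
    pointwise false y     = +-identityʳ (ind y)

  card-∩-∖ : (X Y : FSet n) → card (X ∩ Y) + card (X ∖ Y) ≡ card X
  card-∩-∖ X Y = begin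
    card (X ∩ Y) + card (X ∖ Y)                         ≡⟨ ∑-distrib-+ (ind ∘ (X ∩ Y)) (ind ∘ (X ∖ Y)) ⟨
    sum (λ i → ind (X i ∧ Y i) + ind (X i ∧ not (Y i))) ≡⟨ sum-cong-≗ (λ i → pointwise (X i) (Y i)) ⟩
    card X                                              ∎
    where
    open ≡-Reasoning
    pointwise : ∀ x y → ind (x ∧ y) + ind (x ∧ not y) ≡ ind x
    pointwise true  true  = refl
    pointwise true  false = refl
    pointwise false y     = refl

  card-full : ∀ n → card {n} full ≡ n
  card-full zero    = refl
  card-full (suc n) = cong suc (card-full n)

  card≤ : (X : FSet n) → card X ≤ n
  card≤ {n} X = subst (card X ≤_) (card-full n) (card-mono {n} {X = X} {Y = full} (λ _ _ → ∈full))

  card-∅ : (X : FSet n) → (∀ i → i ∉ X) → card X ≡ 0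
  card-∅ {zero}  X p = refl
  card-∅ {suc n} X p rewrite ∉⇒false {X = X} (p zero) =
    card-∅ (X ∘ suc) λ i (mem q) → p (suc i) (mem q)

  card-⁅⁆ : (a : Fin n) → card ⁅ a ⁆ ≡ 1
  card-⁅⁆ {suc n} zero    = cong suc (card-∅ {n} (⁅ zero ⁆ ∘ suc) λ i (mem p) → case ∈⁅⁆⁻ {a = zero} {suc i} (mem p) of λ ())
  card-⁅⁆ {suc n} (suc a) = trans (card-cong {n} shift) (card-⁅⁆ a)
    where
    shift : ⁅ suc a ⁆ ∘ suc ≐ ⁅ a ⁆
    shift = ⊆-antisym {X = ⁅ suc a ⁆ ∘ suc}
      (λ i (mem p) → ∈⁅⁆⁺ (sucᶠ-injective (∈⁅⁆⁻ {a = suc a} (mem p))))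
      (λ i p → mem (holds (∈⁅⁆⁺ {a = suc a} (cong suc (∈⁅⁆⁻ p)))))

  card-permute : (X : FSet n) (π : Permutation′ n) → card (X ∘ (π ⟨$⟩ʳ_)) ≡ card X
  card-permute X π = sym (sum-permute (ind ∘ X) π)

card-disjoint : {X Y Z : FSet n} → X ⊆ Z → Y ⊆ Z → (∀ i → i ∈ X → i ∉ Y) →
  card X + card Y ≤ card Z
card-disjoint {X = X} {Y} {Z} X⊆Z Y⊆Z dis = begin
  card X + card Y             ≡⟨ card-∪-∩ X Y ⟨
  card (X ∪ Y) + card (X ∩ Y) ≡⟨ cong (card (X ∪ Y) +_)
                                   (card-∅ (X ∩ Y) λ i p → let x , y = ∈∩⁻ p in dis i x y) ⟩
  card (X ∪ Y) + 0            ≡⟨ +-identityʳ _ ⟩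
  card (X ∪ Y)                ≤⟨ card-mono (λ i p → case ∈∪⁻ p of λ where
                                   (inj₁ x) → X⊆Z i x
                                   (inj₂ y) → Y⊆Z i y) ⟩
  card Z                      ∎
  where open ≤-Reasoning

card-⊆-∪ : {X Y Z : FSet n} → Z ⊆ X ∪ Y → card Z ≤ card X + card Y
card-⊆-∪ {X = X} {Y} {Z} p = begin
  card Z                      ≤⟨ card-mono p ⟩
  card (X ∪ Y)                ≤⟨ m≤m+n _ _ ⟩
  card (X ∪ Y) + card (X ∩ Y) ≡⟨ card-∪-∩ X Y ⟩
  card X + card Y             ∎
  where open ≤-Reasoning

card-⊂ : {X Y : FSet n} → X ⊆ Y → ∀ {i} → i ∈ Y → i ∉ X → card X < card Y
card-⊂ {X = X} {Y} X⊆Y {i} i∈Y i∉X =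
  subst (_≤ card Y) (trans (cong (card X +_) (card-⁅⁆ i)) (+-comm (card X) 1))
    (card-disjoint X⊆Y (λ j p → subst (_∈ Y) (sym (∈⁅⁆⁻ p)) i∈Y)
      (λ j p q → i∉X (subst (_∈ X) (∈⁅⁆⁻ q) p)))

∈⇒0<card : {X : FSet n} → ∀ {i} → i ∈ X → 0 < card X
∈⇒0<card {n} {X} {i} p = subst (_≤ card X) (card-⁅⁆ i) (card-mono λ j q → subst (_∈ X) (sym (∈⁅⁆⁻ q)) p)

⊆-card⇒⊇ : {X Y : FSet n} → X ⊆ Y → card Y ≤ card X → Y ⊆ X
⊆-card⇒⊇ {X = X} X⊆Y le i i∈Y with i ∈? X
... | yes p = p
... | no ¬p = ⊥-elim (<⇒≱ (card-⊂ X⊆Y i∈Y ¬p) le)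

card<⇒∃ : {X Y : FSet n} → card X < card Y → ∃ λ i → i ∈ Y × i ∉ X
card<⇒∃ {X = X} {Y} lt with any? (λ i → i ∈? (Y ∖ X))
... | yes (i , p) = i , ∈∖⁻ p
... | no ¬p       = ⊥-elim (<⇒≱ lt (card-mono sub))
  where
  sub : Y ⊆ X
  sub i i∈Y with i ∈? X
  ... | yes q = q
  ... | no ¬q = ⊥-elim (¬p (i , ∈∖⁺ i∈Y ¬q))

0<card⇒∃ : {X : FSet n} → 0 < card X → ∃ λ i → i ∈ X
0<card⇒∃ {X = X} lt with any? (_∈? X)
... | yes p = p
... | no ¬p = ⊥-elim (<⇒≢ lt (sym (card-∅ X λ i q → ¬p (i , q))))

card-meet : {X Y Z : FSet n} → X ⊆ Z → Y ⊆ Z → card Z < card X + card Y →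
  ∃ λ i → i ∈ X × i ∈ Y
card-meet {X = X} {Y} X⊆Z Y⊆Z lt with any? (λ i → i ∈? (X ∩ Y))
... | yes (i , p) = i , ∈∩⁻ p
... | no ¬p       = ⊥-elim (<⇒≱ lt (card-disjoint X⊆Z Y⊆Z λ i x y → ¬p (i , ∈∩⁺ x y)))

1<card⇒∃≢ : {X : FSet n} → 1 < card X → ∀ a → ∃ λ i → i ∈ X × i ≢ a
1<card⇒∃≢ {X = X} lt a
  with i , p , q ← card<⇒∃ {X = ⁅ a ⁆} {X} (subst (_< card X) (sym (card-⁅⁆ a)) lt) =
    i , p , q ∘ ∈⁅⁆⁺

2<card⇒∃≢≢ : {X : FSet n} → 2 < card X → ∀ a b → ∃ λ i → i ∈ X × i ≢ a × i ≢ b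
2<card⇒∃≢≢ {X = X} lt a b
  with i , p , q ← card<⇒∃ {X = ⁅ a ⁆ ∪ ⁅ b ⁆} {X}
    (≤-<-trans (subst₂ (λ u v → card (⁅ a ⁆ ∪ ⁅ b ⁆) ≤ u + v) (card-⁅⁆ a) (card-⁅⁆ b) (card-⊆-∪ (λ _ p → p))) lt) =
    i , p , (q ∘ ∈∪⁺ˡ ∘ ∈⁅⁆⁺) , (q ∘ ∈∪⁺ʳ ∘ ∈⁅⁆⁺)

∃≢⇒1<card : {X : FSet n} → ∀ {i j} → i ∈ X → j ∈ X → i ≢ j → 1 < card X
∃≢⇒1<card {X = X} {i} {j} p q i≢j =
  subst (_< card X) (card-⁅⁆ i)
    (card-⊂ (λ a e → subst (_∈ X) (sym (∈⁅⁆⁻ e)) p) q (λ e → i≢j (sym (∈⁅⁆⁻ e))))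

-- Sumsets in a finite abelian group

infixl 6 _:⊕_
infix  8 :⊝_
infix  4 _:≈_

data GroupExpr (n : ℕ) : Set where
  gvar : Fin n → GroupExpr n
  :𝟘   : GroupExpr n
  _:⊕_ : GroupExpr n → GroupExpr n → GroupExpr n
  :⊝_  : GroupExpr n → GroupExpr n

infixl 6 _:⊖_
_:⊖_ : ∀ {n} → GroupExpr n → GroupExpr n → GroupExpr n
e :⊖ f = e :⊕ :⊝ f

record GroupEq (n : ℕ) : Set where
  constructor _:≈_
  field lhsᵍ rhsᵍ : GroupExpr n
open GroupEq

positive negative : ∀ {n} → GroupExpr n → Vec ℕ n
positive {n} (gvar i) = replicate n 0 [ i ]≔ 1
positive {n} :𝟘       = replicate n 0
positive (e :⊕ f)     = zipWith _+_ (positive e) (positive f)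
positive (:⊝ e)       = negative e
negative {n} (gvar i) = replicate n 0
negative {n} :𝟘       = replicate n 0
negative (e :⊕ f)     = zipWith _+_ (negative e) (negative f)
negative (:⊝ e)       = positive e

module Additive {N : ℕ} {_⊕_ : Op₂ (Fin N)} {𝟘 : Fin N} {⊝_ : Op₁ (Fin N)}
  (isAbelianGroup : IsAbelianGroup _≡_ _⊕_ 𝟘 ⊝_) where

  open IsAbelianGroup isAbelianGroup using () renaming
    (assoc to ⊕-assoc; comm to ⊕-comm; identityˡ to ⊕-identityˡ; identityʳ to ⊕-identityʳ
    ; inverseˡ to ⊝-inverseˡ; inverseʳ to ⊝-inverseʳ)

  infixl 6 _⊖_
  infixr 8 _×ᵍ_
  infixl 6 _⊞_
  infixr 7 _▹_

  _⊖_ : Fin N → Fin N → Fin N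
  x ⊖ y = x ⊕ (⊝ y)

  _×ᵍ_ : ℕ → Fin N → Fin N
  zero  ×ᵍ x = 𝟘
  suc k ×ᵍ x = x ⊕ (k ×ᵍ x)

  ×ᵍ-+ : ∀ j k x → (j + k) ×ᵍ x ≡ (j ×ᵍ x) ⊕ (k ×ᵍ x)
  ×ᵍ-+ zero    k x = sym (⊕-identityˡ _)
  ×ᵍ-+ (suc j) k x = trans (cong (x ⊕_) (×ᵍ-+ j k x)) (sym (⊕-assoc x _ _))

  ⊕-interchange : ∀ a b c d → (a ⊕ b) ⊕ (c ⊕ d) ≡ (a ⊕ c) ⊕ (b ⊕ d)
  ⊕-interchange a b c d = begin
    (a ⊕ b) ⊕ (c ⊕ d) ≡⟨ ⊕-assoc a b _ ⟩
    a ⊕ (b ⊕ (c ⊕ d)) ≡⟨ cong (a ⊕_) (⊕-assoc b c d) ⟨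
    a ⊕ ((b ⊕ c) ⊕ d) ≡⟨ cong (λ u → a ⊕ (u ⊕ d)) (⊕-comm b c) ⟩
    a ⊕ ((c ⊕ b) ⊕ d) ≡⟨ cong (a ⊕_) (⊕-assoc c b d) ⟩
    a ⊕ (c ⊕ (b ⊕ d)) ≡⟨ ⊕-assoc a c _ ⟨
    (a ⊕ c) ⊕ (b ⊕ d) ∎
    where open ≡-Reasoning

  ⟦_⟧ᵍ : ∀ {n} → GroupExpr n → Vec (Fin N) n → Fin N
  ⟦ gvar i ⟧ᵍ ρ = lookup ρ i
  ⟦ :𝟘 ⟧ᵍ ρ     = 𝟘
  ⟦ e :⊕ f ⟧ᵍ ρ = ⟦ e ⟧ᵍ ρ ⊕ ⟦ f ⟧ᵍ ρ
  ⟦ :⊝ e ⟧ᵍ ρ   = ⊝ ⟦ e ⟧ᵍ ρ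

  combine : ∀ {n} → Vec ℕ n → Vec (Fin N) n → Fin N
  combine []       []      = 𝟘
  combine (c ∷ cs) (x ∷ ρ) = (c ×ᵍ x) ⊕ combine cs ρ

  combine-+ : ∀ {n} (c d : Vec ℕ n) ρ → combine (zipWith _+_ c d) ρ ≡ combine c ρ ⊕ combine d ρ
  combine-+ []       []       []      = sym (⊕-identityˡ 𝟘)
  combine-+ (c ∷ cs) (d ∷ ds) (x ∷ ρ) =
    trans (cong₂ _⊕_ (×ᵍ-+ c d x) (combine-+ cs ds ρ)) (⊕-interchange _ _ _ _)

  combine-0 : ∀ {n} (ρ : Vec (Fin N) n) → combine (replicate n 0) ρ ≡ 𝟘
  combine-0 []      = refl
  combine-0 (x ∷ ρ) = trans (⊕-identityˡ _) (combine-0 ρ)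

  combine-unit : ∀ {n} (i : Fin n) (ρ : Vec (Fin N) n) →
    combine (replicate n 0 [ i ]≔ 1) ρ ≡ lookup ρ i
  combine-unit zero    (x ∷ ρ) =
    trans (cong₂ _⊕_ (⊕-identityʳ x) (combine-0 ρ)) (⊕-identityʳ x)
  combine-unit (suc i) (x ∷ ρ) = trans (⊕-identityˡ _) (combine-unit i ρ)

  combine-sound : ∀ {n} (e : GroupExpr n) ρ →
    ⟦ e ⟧ᵍ ρ ⊕ combine (negative e) ρ ≡ combine (positive e) ρ
  combine-sound (gvar i) ρ =
    trans (cong (lookup ρ i ⊕_) (combine-0 ρ)) (trans (⊕-identityʳ _) (sym (combine-unit i ρ)))
  combine-sound :𝟘 ρ = ⊕-identityˡ _
  combine-sound (e :⊕ f) ρ = begin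
    (⟦ e ⟧ᵍ ρ ⊕ ⟦ f ⟧ᵍ ρ) ⊕ combine (negative (e :⊕ f)) ρ
      ≡⟨ cong ((⟦ e ⟧ᵍ ρ ⊕ ⟦ f ⟧ᵍ ρ) ⊕_) (combine-+ (negative e) (negative f) ρ) ⟩
    (⟦ e ⟧ᵍ ρ ⊕ ⟦ f ⟧ᵍ ρ) ⊕ (combine (negative e) ρ ⊕ combine (negative f) ρ)
      ≡⟨ ⊕-interchange _ _ _ _ ⟩
    (⟦ e ⟧ᵍ ρ ⊕ combine (negative e) ρ) ⊕ (⟦ f ⟧ᵍ ρ ⊕ combine (negative f) ρ)
      ≡⟨ cong₂ _⊕_ (combine-sound e ρ) (combine-sound f ρ) ⟩
    combine (positive e) ρ ⊕ combine (positive f) ρ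
      ≡⟨ combine-+ (positive e) (positive f) ρ ⟨
    combine (positive (e :⊕ f)) ρ ∎
    where open ≡-Reasoning
  combine-sound (:⊝ e) ρ = begin
    (⊝ ⟦ e ⟧ᵍ ρ) ⊕ combine (positive e) ρ
      ≡⟨ cong ((⊝ ⟦ e ⟧ᵍ ρ) ⊕_) (combine-sound e ρ) ⟨
    (⊝ ⟦ e ⟧ᵍ ρ) ⊕ (⟦ e ⟧ᵍ ρ ⊕ combine (negative e) ρ)
      ≡⟨ ⊕-assoc _ _ _ ⟨
    ((⊝ ⟦ e ⟧ᵍ ρ) ⊕ ⟦ e ⟧ᵍ ρ) ⊕ combine (negative e) ρ
      ≡⟨ cong (_⊕ combine (negative e) ρ) (⊝-inverseˡ _) ⟩
    𝟘 ⊕ combine (negative e) ρ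
      ≡⟨ ⊕-identityˡ _ ⟩
    combine (negative e) ρ ∎
    where open ≡-Reasoning

  ⊕-cancelʳ : ∀ z {x y} → x ⊕ z ≡ y ⊕ z → x ≡ y
  ⊕-cancelʳ z {x} {y} e = trans (sym (undo x)) (trans (cong (_⊖ z) e) (undo y))
    where
    undo : ∀ u → (u ⊕ z) ⊖ z ≡ u
    undo u = trans (⊕-assoc u z _) (trans (cong (u ⊕_) (⊝-inverseʳ z)) (⊕-identityʳ u))

  -- An integer coefficient is kept as a difference of two naturals, so equality of coefficients
  -- becomes equality of cross sums, which `refl` settles for concrete expressions.
  group : ∀ {n} (ρ : Vec (Fin N) n) (f : N-ary n (GroupExpr n) (GroupEq n)) →
    let e :≈ e′ = f $ⁿ Vec.map gvar (allFin n) in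
    zipWith _+_ (positive e) (negative e′) ≡ zipWith _+_ (positive e′) (negative e) →
    ⟦ e ⟧ᵍ ρ ≡ ⟦ e′ ⟧ᵍ ρ
  group {n} ρ f p = ⊕-cancelʳ (combine (negative e) ρ ⊕ combine (negative e′) ρ) (begin
    ⟦ e ⟧ᵍ ρ ⊕ (combine (negative e) ρ ⊕ combine (negative e′) ρ)
      ≡⟨ ⊕-assoc _ _ _ ⟨
    (⟦ e ⟧ᵍ ρ ⊕ combine (negative e) ρ) ⊕ combine (negative e′) ρ
      ≡⟨ cong (_⊕ combine (negative e′) ρ) (combine-sound e ρ) ⟩
    combine (positive e) ρ ⊕ combine (negative e′) ρ
      ≡⟨ combine-+ (positive e) (negative e′) ρ ⟨
    combine (zipWith _+_ (positive e) (negative e′)) ρ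
      ≡⟨ cong (λ c → combine c ρ) p ⟩
    combine (zipWith _+_ (positive e′) (negative e)) ρ
      ≡⟨ combine-+ (positive e′) (negative e) ρ ⟩
    combine (positive e′) ρ ⊕ combine (negative e) ρ
      ≡⟨ cong (_⊕ combine (negative e) ρ) (combine-sound e′ ρ) ⟨
    (⟦ e′ ⟧ᵍ ρ ⊕ combine (negative e′) ρ) ⊕ combine (negative e) ρ
      ≡⟨ ⊕-assoc _ _ _ ⟩
    ⟦ e′ ⟧ᵍ ρ ⊕ (combine (negative e′) ρ ⊕ combine (negative e) ρ)
      ≡⟨ cong (⟦ e′ ⟧ᵍ ρ ⊕_) (⊕-comm _ _) ⟩
    ⟦ e′ ⟧ᵍ ρ ⊕ (combine (negative e) ρ ⊕ combine (negative e′) ρ) ∎)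
    where
    open ≡-Reasoning
    e  = lhsᵍ (f $ⁿ Vec.map gvar (allFin n))
    e′ = rhsᵍ (f $ⁿ Vec.map gvar (allFin n))

  opaque
    _▹_ : Fin N → FSet N → FSet N
    (g ▹ X) z = X (z ⊖ g)

    ⊟_ : FSet N → FSet N
    (⊟ X) z = X (⊝ z)

    _⊞_ : FSet N → FSet N → FSet N
    (S ⊞ B) z = does (any? λ s → (s ∈? S) ×-dec (z ⊖ s ∈? B))

    ∈▹⁻ : ∀ {g X z} → z ∈ g ▹ X → z ⊖ g ∈ X
    ∈▹⁻ (mem p) = mem p

    ∈▹⁺ : ∀ {g X z} → z ⊖ g ∈ X → z ∈ g ▹ X
    ∈▹⁺ (mem p) = mem p

    ∈⊟⁻ : ∀ {X z} → z ∈ ⊟ X → ⊝ z ∈ X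
    ∈⊟⁻ (mem p) = mem p

    ∈⊟⁺ : ∀ {X z} → ⊝ z ∈ X → z ∈ ⊟ X
    ∈⊟⁺ (mem p) = mem p

    card-▹ : ∀ g X → card (g ▹ X) ≡ card X
    card-▹ g X = card-permute X (permutation (_⊖ g) (_⊕ g)
      (λ x → group (x ∷ g ∷ []) (λ x g → (x :⊕ g) :⊖ g :≈ x) refl)
      (λ x → group (x ∷ g ∷ []) (λ x g → (x :⊖ g) :⊕ g :≈ x) refl))

    card-⊟ : ∀ X → card (⊟ X) ≡ card X
    card-⊟ X = card-permute X (permutation ⊝_ ⊝_ inv inv)
      where
      inv : ∀ x → ⊝ (⊝ x) ≡ x
      inv x = group (x ∷ []) (λ x → :⊝ (:⊝ x) :≈ x) refl

    ∈⊞⁺ : ∀ {S B s b} → s ∈ S → b ∈ B → s ⊕ b ∈ S ⊞ B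
    ∈⊞⁺ {S} {B} {s} {b} p q = mem (dec-true (any? λ t → (t ∈? S) ×-dec ((s ⊕ b) ⊖ t ∈? B))
      (s , p , subst (_∈ B) (group (s ∷ b ∷ []) (λ s b → b :≈ (s :⊕ b) :⊖ s) refl) q))

    ∈⊞⁻ : ∀ {S B z} → z ∈ S ⊞ B → ∃₂ λ s b → s ∈ S × b ∈ B × z ≡ s ⊕ b
    ∈⊞⁻ {S} {B} {z} (mem p)
      with s , q , r ← does⁻ (any? λ s → (s ∈? S) ×-dec (z ⊖ s ∈? B)) p =
      s , z ⊖ s , q , r , group (z ∷ s ∷ []) (λ z s → z :≈ s :⊕ (z :⊖ s)) refl

  ∈▹⁺⊕ : ∀ {g X x} → x ∈ X → x ⊕ g ∈ g ▹ X
  ∈▹⁺⊕ {g} {X} {x} p =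
    ∈▹⁺ (subst (_∈ X) (group (x ∷ g ∷ []) (λ x g → x :≈ (x :⊕ g) :⊖ g) refl) p)

  ⊞-mono : ∀ {S S′ B B′} → S ⊆ S′ → B ⊆ B′ → S ⊞ B ⊆ S′ ⊞ B′
  ⊞-mono p q z r with s , b , x , y , refl ← ∈⊞⁻ r = ∈⊞⁺ (p s x) (q b y)

  ⊞-comm : ∀ S B → S ⊞ B ⊆ B ⊞ S
  ⊞-comm S B z r with s , b , x , y , refl ← ∈⊞⁻ r =
    subst (_∈ B ⊞ S) (⊕-comm b s) (∈⊞⁺ y x)

  ▹-⊞ : ∀ g S B → (g ▹ S) ⊞ B ⊆ g ▹ (S ⊞ B)
  ▹-⊞ g S B z r with s , b , x , y , refl ← ∈⊞⁻ r =
    ∈▹⁺ (subst (_∈ S ⊞ B) (group (s ∷ g ∷ b ∷ []) (λ s g b → (s :⊖ g) :⊕ b :≈ (s :⊕ b) :⊖ g) refl)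
      (∈⊞⁺ (∈▹⁻ x) y))

  card≤card-⊞ˡ : ∀ {S B b} → b ∈ B → card S ≤ card (S ⊞ B)
  card≤card-⊞ˡ {S} {B} {b} p = subst (_≤ card (S ⊞ B)) (card-▹ b S) (card-mono λ z q →
    subst (_∈ S ⊞ B) (group (z ∷ b ∷ []) (λ z b → (z :⊖ b) :⊕ b :≈ z) refl) (∈⊞⁺ (∈▹⁻ q) p))

  card-⊞-comm : ∀ S B → card (S ⊞ B) ≡ card (B ⊞ S)
  card-⊞-comm S B = ≤-antisym (card-mono (⊞-comm S B)) (card-mono (⊞-comm B S))

  card≤card-⊞ʳ : ∀ {S B s} → s ∈ S → card B ≤ card (S ⊞ B)
  card≤card-⊞ʳ {S} {B} p = subst (card B ≤_) (card-⊞-comm B S) (card≤card-⊞ˡ p)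

  record Subgroup (H : FSet N) : Set where
    field
      has-𝟘    : 𝟘 ∈ H
      ⊖-closed : ∀ {x y} → x ∈ H → y ∈ H → x ⊖ y ∈ H

    ⊝-closed : ∀ {x} → x ∈ H → ⊝ x ∈ H
    ⊝-closed {x} p = subst (_∈ H) (⊕-identityˡ _) (⊖-closed has-𝟘 p)

    ⊕-closed : ∀ {x y} → x ∈ H → y ∈ H → x ⊕ y ∈ H
    ⊕-closed {x} {y} p q = subst (_∈ H) (group (x ∷ y ∷ []) (λ x y → x :⊖ :⊝ y :≈ x :⊕ y) refl)
      (⊖-closed p (⊝-closed q))

  open Subgroup public

  -- Atoms and critical pairs

  -- A t-fragment of B in Hamidoune's isoperimetric sense, inside the subgroup U and with
  -- boundary at most κ.
  record Fragment (t : ℕ) (U B : FSet N) (κ : ℕ) (M : FSet N) : Set where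
    constructor fragment
    field
      inside   : M ⊆ U
      large    : t ≤ card M
      cosmall  : t + card (M ⊞ B) ≤ card U
      boundary : card (M ⊞ B) ≤ card M + κ
  open Fragment public

  -- The intersection property of atoms; containment is equality here, the cardinalities being the
  -- same. For t = 1 translates are disjoint or equal, for t = 2 distinct ones share at most one
  -- point.
  Rigid : ℕ → FSet N → FSet N → Set
  Rigid t U M = ∀ g → g ∈ U → t ≤ card (M ∩ (g ▹ M)) → M ⊆ g ▹ M

  module _ {t : ℕ} {U B : FSet N} (U≤ : Subgroup U) (B⊆U : B ⊆ U) {b₀ : Fin N} (b₀∈B : b₀ ∈ B) where

    ⊞-⊆ : ∀ {M} → M ⊆ U → M ⊞ B ⊆ U
    ⊞-⊆ M⊆U z p with s , b , x , y , refl ← ∈⊞⁻ p = ⊕-closed U≤ (M⊆U s x) (B⊆U b y)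

    ▹-⊆ : ∀ {M g} → g ∈ U → M ⊆ U → g ▹ M ⊆ U
    ▹-⊆ {g = g} g∈U M⊆U z p = subst (_∈ U) (group (z ∷ g ∷ []) (λ z g → (z :⊖ g) :⊕ g :≈ z) refl)
      (⊕-closed U≤ (M⊆U _ (∈▹⁻ p)) g∈U)

    -- Negating the complement makes it again a set to be added to `B`, not to -B: if -s lies
    -- outside M + B, then -(s + b) is never in M. This is why the boundary does not grow.
    dual : FSet N → FSet N
    dual M = ⊟ (U ∖ (M ⊞ B))

    card-dual : ∀ {M} → M ⊆ U → card (M ⊞ B) + card (dual M) ≡ card U
    card-dual {M} M⊆U = begin
      card (M ⊞ B) + card (dual M)              ≡⟨ cong₂ _+_ (card-cong (⊆-antisym
                                                     (λ i p → ∈∩⁺ (⊞-⊆ M⊆U i p) p)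
                                                     (λ i p → proj₂ (∈∩⁻ p)))) (card-⊟ _) ⟩
      card (U ∩ (M ⊞ B)) + card (U ∖ (M ⊞ B)) ≡⟨ card-∩-∖ U (M ⊞ B) ⟩
      card U                                    ∎
      where open ≡-Reasoning

    dual-⊞ : ∀ {M} → M ⊆ U → card (dual M ⊞ B) + card M ≤ card U
    dual-⊞ {M} M⊆U = subst (λ c → c + card M ≤ card U) (card-⊟ (dual M ⊞ B))
      (card-disjoint left M⊆U λ i p q → apart i (∈⊟⁻ p) q)
      where
      dual⊆U : dual M ⊆ U
      dual⊆U i p = subst (_∈ U) (group (i ∷ []) (λ i → :⊝ (:⊝ i) :≈ i) refl)
        (⊝-closed U≤ (proj₁ (∈∖⁻ (∈⊟⁻ p))))
      left : ⊟ (dual M ⊞ B) ⊆ U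
      left i p = subst (_∈ U) (group (i ∷ []) (λ i → :⊝ (:⊝ i) :≈ i) refl)
        (⊝-closed U≤ (⊞-⊆ dual⊆U _ (∈⊟⁻ p)))
      apart : ∀ i → ⊝ i ∈ dual M ⊞ B → i ∉ M
      apart i p q with s , b , x , y , e ← ∈⊞⁻ p =
        proj₂ (∈∖⁻ (∈⊟⁻ x)) (subst (_∈ M ⊞ B)
          (trans (cong (i ⊕_) (trans (group (b ∷ s ∷ []) (λ b s → b :≈ (s :⊕ b) :⊖ s) refl) (cong (_⊖ s) (sym e))))
            (group (i ∷ s ∷ []) (λ i s → i :⊕ (:⊝ i :⊖ s) :≈ :⊝ s) refl))
          (∈⊞⁺ q y))

    dual-fragment : ∀ {κ M} → Fragment t U B κ M → Fragment t U B κ (dual M)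
    dual-fragment {κ} {M} F = record
      { inside   = λ i p → subst (_∈ U) (group (i ∷ []) (λ i → :⊝ (:⊝ i) :≈ i) refl)
                     (⊝-closed U≤ (proj₁ (∈∖⁻ (∈⊟⁻ p))))
      ; large    = linarith (t ∷ card (M ⊞ B) ∷ card (dual M) ∷ card U ∷ [])
                     (λ t mb d u → t :+ mb :≤ u ∷ u :≤ mb :+ d ∷ [] , t :≤ d)
                     (cosmall F) (≤-reflexive (sym (card-dual (inside F))))
      ; cosmall  = linarith (t ∷ card M ∷ card (dual M ⊞ B) ∷ card U ∷ [])
                     (λ t m db u → t :≤ m ∷ db :+ m :≤ u ∷ [] , t :+ db :≤ u)
                     (large F) (dual-⊞ (inside F))
      ; boundary = linarith (card (M ⊞ B) ∷ card (dual M) ∷ card M ∷ card (dual M ⊞ B) ∷ card U ∷ κ ∷ [])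
                     (λ mb d m db u κ → mb :≤ m :+ κ ∷ db :+ m :≤ u ∷ u :≤ mb :+ d ∷ [] , db :≤ d :+ κ)
                     (boundary F) (dual-⊞ (inside F)) (≤-reflexive (sym (card-dual (inside F))))
      }

    -- No minimal κ is chosen. The descent is lexicographic in κ and the bound `f` on |M|: a smaller
    -- dual or intersection keeps κ, and when the intersection has boundary above κ, submodularity
    -- gives the union a boundary below κ.
    atom : ∀ κ f {M} → Fragment t U B κ M → card M ≤ f → ∃ λ M′ → Fragment t U B κ M′ × Rigid t U M′
    atom κ f {M} F M≤f with card (dual M) <? card M
    atom κ zero {M} F M≤f | yes small = ⊥-elim (<⇒≱ small (≤-trans M≤f z≤n))
    atom κ (suc f) {M} F M≤f | yes small =
      atom κ f (dual-fragment F) (≤-pred (≤-trans small M≤f))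
    ... | no big with any? (λ g → (g ∈? U) ×-dec (t ≤? card (M ∩ (g ▹ M))) ×-dec (card (M ∩ (g ▹ M)) <? card M))
    ... | no none = M , F , λ g g∈U t≤ i i∈M → proj₂ (∈∩⁻ (⊆-card⇒⊇ (λ j p → proj₁ (∈∩⁻ p))
                      (≮⇒≥ (λ lt → none (g , g∈U , t≤ , lt))) i i∈M))
    ... | yes (g , g∈U , t≤I , I<M) = cross κ f F M≤f (card (I ⊞ B) ≤? card I + κ)
      where
      I K : FSet N
      I = M ∩ (g ▹ M)
      K = M ∪ (g ▹ M)
      I⊆M : I ⊆ M
      I⊆M i p = proj₁ (∈∩⁻ p)
      card-I+K : card K + card I ≡ card M + card M
      card-I+K = trans (card-∪-∩ M (g ▹ M)) (cong (card M +_) (card-▹ g M))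
      submodular : card (K ⊞ B) + card (I ⊞ B) ≤ card (M ⊞ B) + card (M ⊞ B)
      submodular = begin
        card (K ⊞ B) + card (I ⊞ B)
          ≤⟨ +-mono-≤ (card-mono K⊞B) (card-mono I⊞B) ⟩
        card ((M ⊞ B) ∪ (g ▹ (M ⊞ B))) + card ((M ⊞ B) ∩ (g ▹ (M ⊞ B)))
          ≡⟨ card-∪-∩ (M ⊞ B) (g ▹ (M ⊞ B)) ⟩
        card (M ⊞ B) + card (g ▹ (M ⊞ B))
          ≡⟨ cong (card (M ⊞ B) +_) (card-▹ g (M ⊞ B)) ⟩
        card (M ⊞ B) + card (M ⊞ B) ∎
        where
        open ≤-Reasoning
        K⊞B : K ⊞ B ⊆ (M ⊞ B) ∪ (g ▹ (M ⊞ B))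
        K⊞B i p with s , b , x , y , refl ← ∈⊞⁻ p with ∈∪⁻ x
        ... | inj₁ q = ∈∪⁺ˡ (∈⊞⁺ q y)
        ... | inj₂ q = ∈∪⁺ʳ (▹-⊞ g M B _ (∈⊞⁺ q y))
        I⊞B : I ⊞ B ⊆ (M ⊞ B) ∩ (g ▹ (M ⊞ B))
        I⊞B i p with s , b , x , y , refl ← ∈⊞⁻ p =
          ∈∩⁺ (∈⊞⁺ (I⊆M s x) y) (▹-⊞ g M B _ (∈⊞⁺ (proj₂ (∈∩⁻ x)) y))
      cross : ∀ κ f → Fragment t U B κ M → card M ≤ f →
        Dec (card (I ⊞ B) ≤ card I + κ) → ∃ λ M′ → Fragment t U B κ M′ × Rigid t U M′
      cross κ zero F M≤f (yes small) = ⊥-elim (<⇒≱ I<M (≤-trans M≤f z≤n))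
      cross κ (suc f) F M≤f (yes small) = atom κ f
        (fragment (λ i p → inside F i (I⊆M i p)) t≤I
          (≤-trans (+-monoʳ-≤ t (card-mono (⊞-mono I⊆M λ _ p → p))) (cosmall F)) small)
        (≤-pred (≤-trans I<M M≤f))
      -- With κ = 0 the union would satisfy |K + B| < |K|.
      cross zero f F M≤f (no ¬small) = ⊥-elim (<⇒≱ {card K} {card K}
        (linarith (card K ∷ card (K ⊞ B) ∷ card I ∷ card (I ⊞ B) ∷ card M ∷ card (M ⊞ B) ∷ [])
          (λ j jb i ib m mb → jb :+ ib :≤ mb :+ mb ∷ m :+ m :≤ j :+ i ∷ mb :≤ m :+ con 0 ∷ mb :≤ m :+ con 0 ∷
            con 1 :+ (i :+ con 0) :≤ ib ∷ j :≤ jb ∷ [] , con 1 :+ j :≤ j)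
          submodular (≤-reflexive (sym card-I+K)) (boundary F) (boundary F) (≰⇒> ¬small) (card≤card-⊞ˡ b₀∈B)) ≤-refl)
      cross (suc κ) f F M≤f (no ¬small) =
        let M′ , F′ , R = atom κ (card K) (fragment
              (λ i p → [ inside F i , ▹-⊆ g∈U (inside F) i ]′ (∈∪⁻ p))
              (≤-trans (large F) (card-mono λ i → ∈∪⁺ˡ))
              -- Here |M| ≤ |dual M| enters: |K + B| ≤ |M + B| + |M| - |I| ≤ |U| - t.
              (linarith (card K ∷ card (K ⊞ B) ∷ card I ∷ card (I ⊞ B) ∷ card M ∷ card (M ⊞ B) ∷ κ ∷ t ∷ card U ∷ card (dual M) ∷ [])
                (λ j jb i ib m mb κ t u d → jb :+ ib :≤ mb :+ mb ∷ mb :≤ m :+ (con 1 :+ κ) ∷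
                  con 1 :+ (i :+ (con 1 :+ κ)) :≤ ib ∷ m :≤ d ∷ mb :+ d :≤ u ∷ t :≤ i ∷ [] , t :+ jb :≤ u)
                submodular (boundary F) (≰⇒> ¬small) (≮⇒≥ big) (≤-reflexive (card-dual (inside F))) t≤I)
              (linarith (card K ∷ card (K ⊞ B) ∷ card I ∷ card (I ⊞ B) ∷ card M ∷ card (M ⊞ B) ∷ κ ∷ [])
                (λ j jb i ib m mb κ → jb :+ ib :≤ mb :+ mb ∷ mb :≤ m :+ (con 1 :+ κ) ∷ mb :≤ m :+ (con 1 :+ κ) ∷
                  con 1 :+ (i :+ (con 1 :+ κ)) :≤ ib ∷ m :+ m :≤ j :+ i ∷ [] , jb :≤ j :+ κ)
                submodular (boundary F) (boundary F) (≰⇒> ¬small) (≤-reflexive (sym card-I+K))))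
              ≤-refl
        in M′ , fragment (inside F′) (large F′) (cosmall F′) (≤-trans (boundary F′) (+-monoʳ-≤ (card M′) (n≤1+n κ))) , R

  ⊖⊕ : ∀ x y → (x ⊖ y) ⊕ y ≡ x
  ⊖⊕ x y = group (x ∷ y ∷ []) (λ x y → (x :⊖ y) :⊕ y :≈ x) refl

  ⊖≡𝟘⇒≡ : ∀ {x y} → x ⊖ y ≡ 𝟘 → x ≡ y
  ⊖≡𝟘⇒≡ {x} {y} e = trans (sym (⊖⊕ x y)) (trans (cong (_⊕ y) e) (group (y ∷ []) (λ y → :𝟘 :⊕ y :≈ y) refl))

  -- For y in M - m₀ stability says M - y ⊆ M, which is closure of M - m₀ under subtraction of y.
  translate-subgroup : ∀ {U M m₀} → Subgroup U → M ⊆ U → m₀ ∈ M →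
    (∀ x → x ∈ U → x ⊕ m₀ ∈ M → M ⊆ x ▹ M) → Subgroup ((⊝ m₀) ▹ M)
  translate-subgroup {U} {M} {m₀} U≤ M⊆U m₀∈M stable = record
    { has-𝟘    = ∈▹⁺ (subst (_∈ M) (group (m₀ ∷ []) (λ m → m :≈ :𝟘 :⊖ :⊝ m) refl) m₀∈M)
    ; ⊖-closed = λ {x} {y} p q → ∈▹⁺ (subst (_∈ M)
        (group (x ∷ y ∷ m₀ ∷ []) (λ x y m → (x :⊖ :⊝ m) :⊖ y :≈ (x :⊖ y) :⊖ :⊝ m) refl)
        (∈▹⁻ (stable y
          (subst (_∈ U) (group (y ∷ m₀ ∷ []) (λ y m → (y :⊖ :⊝ m) :⊖ m :≈ y) refl)
            (⊖-closed U≤ (M⊆U _ (∈▹⁻ q)) (M⊆U _ m₀∈M)))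
          (subst (_∈ M) (group (y ∷ m₀ ∷ []) (λ y m → y :⊖ :⊝ m :≈ y :⊕ m) refl) (∈▹⁻ q))
          _ (∈▹⁻ p))))
    }

  translate-fragment : ∀ {t U B κ M g} → Subgroup U → g ∈ U →
    Fragment t U B κ M → Fragment t U B κ (g ▹ M)
  translate-fragment {t} {U} {B} {κ} {M} {g} U≤ g∈U F = record
    { inside   = λ z p → subst (_∈ U) (⊖⊕ z g) (⊕-closed U≤ (inside F _ (∈▹⁻ p)) g∈U)
    ; large    = ≤-trans (large F) (≤-reflexive (sym (card-▹ g M)))
    ; cosmall  = ≤-trans (+-monoʳ-≤ t moved) (cosmall F)
    ; boundary = ≤-trans moved (≤-trans (boundary F) (≤-reflexive (cong (_+ κ) (sym (card-▹ g M)))))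
    }
    where
    moved : card ((g ▹ M) ⊞ B) ≤ card (M ⊞ B)
    moved = ≤-trans (card-mono (▹-⊞ g M B)) (≤-reflexive (card-▹ g (M ⊞ B)))

  -- If x + a is in A, it is a common point of A and x + A, so for t = 1 rigidity applies to x and A
  -- - a is a subgroup. With κ = |B| - 2 this is Mann's theorem.
  atom₁ : ∀ {U B b₀ κ M} → Subgroup U → B ⊆ U → b₀ ∈ B → Fragment 1 U B κ M →
    ∃ λ H → Subgroup H × Fragment 1 U B κ H
  atom₁ {U} {B} {b₀} {κ} {M} U≤ B⊆U b₀∈B F
    with A , F′ , rigid ← atom U≤ B⊆U b₀∈B κ (card M) F ≤-refl
    with a , a∈A ← 0<card⇒∃ (large F′) =
    (⊝ a) ▹ A ,
    translate-subgroup U≤ (inside F′) a∈A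
      (λ x x∈U p → rigid x x∈U (∈⇒0<card (∈∩⁺ p
        (∈▹⁺ (subst (_∈ A) (group (x ∷ a ∷ []) (λ x a → a :≈ (x :⊕ a) :⊖ x) refl) a∈A))))) ,
    translate-fragment U≤ (⊝-closed U≤ (inside F′ a a∈A)) F′

  Sidon : FSet N → FSet N → Set
  Sidon U M = ∀ g → g ∈ U → g ≢ 𝟘 → card (M ∩ (g ▹ M)) < 2

  data Atom₂ (U B : FSet N) (κ : ℕ) : Set where
    pair     : ∀ {M} → Fragment 2 U B κ M → card M ≤ 2 → Atom₂ U B κ
    subgroup : ∀ {H} → Fragment 2 U B κ H → Subgroup H → Atom₂ U B κ
    sidon    : ∀ {M} → Fragment 2 U B κ M → 2 < card M → Sidon U M → Atom₂ U B κ

  -- Suppose some g ≠ 0 gives an overlap of two points. Rigidity makes A invariant under subtraction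
  -- of g, so whenever x + a is in A, both x + a and x + a - g are common to A and x + A. Rigidity
  -- then applies to all such x, and A is a translate of a subgroup.
  atom₂ : ∀ {U B b₀ κ M} → Subgroup U → B ⊆ U → b₀ ∈ B → Fragment 2 U B κ M → Atom₂ U B κ
  atom₂ {U} {B} {b₀} {κ} {M} U≤ B⊆U b₀∈B F
    with A , F′ , rigid ← atom U≤ B⊆U b₀∈B κ (card M) F ≤-refl
    with card A ≤? 2
  ... | yes small = pair F′ small
  ... | no ¬small
    with any? (λ g → (g ∈? U) ×-dec ¬? (g ≟ᶠ 𝟘) ×-dec (2 ≤? card (A ∩ (g ▹ A))))
  ... | no none = sidon F′ (≰⇒> ¬small) λ g g∈U g≢𝟘 → ≰⇒> λ le → none (g , g∈U , g≢𝟘 , le)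
  ... | yes (g , g∈U , g≢𝟘 , le)
    with a , a∈A ← 0<card⇒∃ (≤-trans (s≤s z≤n) (large F′)) =
    subgroup (translate-fragment U≤ (⊝-closed U≤ (inside F′ a a∈A)) F′)
      (translate-subgroup U≤ (inside F′) a∈A λ x x∈U p → rigid x x∈U
        (∃≢⇒1<card
          (∈∩⁺ p (∈▹⁺ (subst (_∈ A) (group (x ∷ a ∷ []) (λ x a → a :≈ (x :⊕ a) :⊖ x) refl) a∈A)))
          (∈∩⁺ (periodic p) (∈▹⁺ (subst (_∈ A) (group (x ∷ a ∷ g ∷ []) (λ x a g → a :⊖ g :≈ ((x :⊕ a) :⊖ g) :⊖ x) refl) (periodic a∈A))))
          λ e → g≢𝟘 (trans (group (x ∷ a ∷ g ∷ []) (λ x a g → g :≈ (x :⊕ a) :⊖ ((x :⊕ a) :⊖ g)) refl)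
                      (trans (cong (_⊖ ((x ⊕ a) ⊖ g)) e) (group (((x ⊕ a) ⊖ g) ∷ []) (λ u → u :⊖ u :≈ :𝟘) refl)))))
    where
    periodic : ∀ {y} → y ∈ A → y ⊖ g ∈ A
    periodic p = ∈▹⁻ (rigid g g∈U le _ p)

  -- Subgroups H for which H + B has few holes

  module _ {H : FSet N} (H≤ : Subgroup H) where

    coset-refl : ∀ {x} → x ∈ x ▹ H
    coset-refl {x} = ∈▹⁺ (subst (_∈ H) (group (x ∷ []) (λ x → :𝟘 :≈ x :⊖ x) refl) (has-𝟘 H≤))

    coset-disjoint : ∀ {x y z} → y ⊖ x ∉ H → z ∈ x ▹ H → z ∉ y ▹ H
    coset-disjoint {x} {y} {z} apart p q = apart (subst (_∈ H)
      (group (x ∷ y ∷ z ∷ []) (λ x y z → (z :⊖ x) :⊖ (z :⊖ y) :≈ y :⊖ x) refl)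
      (⊖-closed H≤ (∈▹⁻ p) (∈▹⁻ q)))

    coset-⊆ : ∀ {B b} → b ∈ B → b ▹ H ⊆ H ⊞ B
    coset-⊆ {B} {b} b∈B z p = subst (_∈ H ⊞ B) (⊖⊕ z b) (∈⊞⁺ (∈▹⁻ p) b∈B)

    ⊆-⊞ : ∀ {B} → B ⊆ H ⊞ B
    ⊆-⊞ {B} z p = subst (_∈ H ⊞ B) (group (z ∷ []) (λ z → :𝟘 :⊕ z :≈ z) refl) (∈⊞⁺ (has-𝟘 H≤) p)

    -- Both cosets lie in H + B, which has fewer than |H| elements outside B. So B misses fewer than
    -- |H| of the 2|H| elements of the two cosets.
    two-cosets : ∀ {B b₀ b₁} → card (H ⊞ B) < card H + card B → b₀ ∈ B → b₁ ∈ B → b₁ ⊖ b₀ ∉ H →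
      card H < card (B ∩ (b₀ ▹ H)) + card (B ∩ (b₁ ▹ H))
    two-cosets {B} {b₀} {b₁} dense p₀ p₁ apart =
      linarith (card (H ⊞ B) ∷ card H ∷ card B ∷ card (B ∩ X) ∷ card (B ∩ Y) ∷ card R ∷ card (B ∖ X)
               ∷ card ((B ∖ X) ∩ Y) ∷ card (X ∪ Y) ∷ [])
        (λ hb h b bx by r b∖x bxy xy → con 1 :+ hb :≤ h :+ b ∷ b :≤ bx :+ b∖x ∷ b∖x :≤ bxy :+ r ∷ bxy :≤ by ∷
          xy :+ r :≤ hb ∷ h :+ h :≤ xy ∷ [] , con 1 :+ h :≤ bx :+ by)
        dense (≤-reflexive (sym (card-∩-∖ B X))) (≤-reflexive (sym (card-∩-∖ (B ∖ X) Y)))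
        (card-mono λ i p → let q , r = ∈∩⁻ p in ∈∩⁺ (proj₁ (∈∖⁻ q)) r)
        (card-disjoint {Z = H ⊞ B} (λ i p → [ coset-⊆ p₀ i , coset-⊆ p₁ i ]′ (∈∪⁻ p))
          (λ i p → ⊆-⊞ i (proj₁ (∈∖⁻ (proj₁ (∈∖⁻ p)))))
          (λ i p q → [ proj₂ (∈∖⁻ (proj₁ (∈∖⁻ q))) , proj₂ (∈∖⁻ q) ]′ (∈∪⁻ p)))
        (subst₂ (λ u v → u + v ≤ card (X ∪ Y)) (card-▹ b₀ H) (card-▹ b₁ H)
          (card-disjoint (λ i → ∈∪⁺ˡ) (λ i → ∈∪⁺ʳ) λ i → coset-disjoint apart))
      where
      X Y R : FSet N
      X = b₀ ▹ H
      Y = b₁ ▹ H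
      R = (B ∖ X) ∖ Y

    coset-▹ : ∀ {B y x} → x ∈ H → B ⊆ y ▹ H → x ▹ B ⊆ y ▹ H
    coset-▹ {B} {y} {x} x∈H B⊆ z p = ∈▹⁺ (subst (_∈ H)
      (group (x ∷ y ∷ z ∷ []) (λ x y z → ((z :⊖ x) :⊖ y) :⊕ x :≈ z :⊖ y) refl)
      (⊕-closed H≤ (∈▹⁻ (B⊆ _ (∈▹⁻ p))) x∈H))

    self-overlap : ∀ {B y x} → x ∈ H → B ⊆ y ▹ H → card B + card B ≤ card (B ∩ (x ▹ B)) + card H
    self-overlap {B} {y} {x} x∈H B⊆ =
      linarith (card B ∷ card (x ▹ B) ∷ card (B ∪ (x ▹ B)) ∷ card (B ∩ (x ▹ B)) ∷ card H ∷ [])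
        (λ b xb u i h → b :≤ xb ∷ b :+ xb :≤ u :+ i ∷ u :≤ h ∷ [] , b :+ b :≤ i :+ h)
        (≤-reflexive (sym (card-▹ x B))) (≤-reflexive (sym (card-∪-∩ B (x ▹ B))))
        (≤-trans (card-mono λ i p → [ B⊆ i , coset-▹ x∈H B⊆ i ]′ (∈∪⁻ p)) (≤-reflexive (card-▹ y H)))

    -- If M met two cosets of H, in M₀ and M₁, then |M₀| + |M₁| > |H|. For a nonzero x in H the
    -- overlaps of these parts with their x-translates have at least 2|M₀| - |H| and 2|M₁| - |H|
    -- elements, together at least 2.
    sidon-coset : ∀ {U M m₀} → H ⊆ U → 1 < card H → Sidon U M → card (H ⊞ M) < card H + card M →
      m₀ ∈ M → M ⊆ m₀ ▹ H
    sidon-coset {U} {M} {m₀} H⊆U 1<H sid dense m₀∈M m₁ m₁∈M with (m₁ ⊖ m₀) ∈? H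
    ... | yes p = ∈▹⁺ p
    ... | no apart with x , x∈H , x≢𝟘 ← 1<card⇒∃≢ 1<H 𝟘 = ⊥-elim (<⇒≱ (sid x (H⊆U x x∈H) x≢𝟘)
        (linarith (card H ∷ card M₀ ∷ card M₁ ∷ card (M₀ ∩ (x ▹ M₀)) ∷ card (M₁ ∩ (x ▹ M₁)) ∷ card (M ∩ (x ▹ M)) ∷ [])
          (λ h m₀ m₁ i₀ i₁ i → con 1 :+ h :≤ m₀ :+ m₁ ∷ con 1 :+ h :≤ m₀ :+ m₁ ∷ m₀ :+ m₀ :≤ i₀ :+ h ∷
            m₁ :+ m₁ :≤ i₁ :+ h ∷ i₀ :+ i₁ :≤ i ∷ [] , con 2 :≤ i)
          (two-cosets dense m₀∈M m₁∈M apart) (two-cosets dense m₀∈M m₁∈M apart)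
          (self-overlap x∈H λ _ p → proj₂ (∈∩⁻ p)) (self-overlap x∈H λ _ p → proj₂ (∈∩⁻ p))
          (card-disjoint
            (λ i p → let q , r = ∈∩⁻ p in ∈∩⁺ (proj₁ (∈∩⁻ q)) (∈▹⁺ (proj₁ (∈∩⁻ (∈▹⁻ r)))))
            (λ i p → let q , r = ∈∩⁻ p in ∈∩⁺ (proj₁ (∈∩⁻ q)) (∈▹⁺ (proj₁ (∈∩⁻ (∈▹⁻ r)))))
            λ i p q → coset-disjoint apart (proj₂ (∈∩⁻ (proj₁ (∈∩⁻ p)))) (proj₂ (∈∩⁻ (proj₁ (∈∩⁻ q)))))))
      where
      M₀ M₁ : FSet N
      M₀ = M ∩ (m₀ ▹ H)
      M₁ = M ∩ (m₁ ▹ H)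

  record Dense (U B H : FSet N) : Set where
    constructor dense
    field
      isSubgroup : Subgroup H
      H⊆U        : H ⊆ U
      nontrivial : 1 < card H
      proper     : card H < card U
      few-holes  : card (H ⊞ B) < card H + card B

  Stabilizer : FSet N → FSet N
  Stabilizer X = ⟪ (λ x → all? λ y → X (y ⊖ x) Bool.≟ X y) ⟫

  stabilizer-intersection : ∀ {H} X → Subgroup H → Subgroup (H ∩ Stabilizer X)
  stabilizer-intersection {H} X H≤ = record
    { has-𝟘    = ∈∩⁺ (has-𝟘 H≤) (∈⟪⟫⁺ λ y → cong X (group (y ∷ []) (λ y → y :⊖ :𝟘 :≈ y) refl))
    ; ⊖-closed = λ {x} {x′} p q → let h , s = ∈∩⁻ p ; h′ , s′ = ∈∩⁻ q in
        ∈∩⁺ (⊖-closed H≤ h h′) (∈⟪⟫⁺ λ y → begin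
          X (y ⊖ (x ⊖ x′))   ≡⟨ cong X (group (x ∷ x′ ∷ y ∷ []) (λ x x′ y → y :⊖ (x :⊖ x′) :≈ (y :⊕ x′) :⊖ x) refl) ⟩
          X ((y ⊕ x′) ⊖ x)   ≡⟨ ∈⟪⟫⁻ s (y ⊕ x′) ⟩
          X (y ⊕ x′)         ≡⟨ ∈⟪⟫⁻ s′ (y ⊕ x′) ⟨
          X ((y ⊕ x′) ⊖ x′)  ≡⟨ cong X (group (x′ ∷ y ∷ []) (λ x′ y → (y :⊕ x′) :⊖ x′ :≈ y) refl) ⟩
          X y                ∎)
    }
    where open ≡-Reasoning

  -- A sumset no larger than B equals each translate a + B with a in M, so all these translates
  -- coincide.
  ⊞-stable : ∀ {M B m m₀} → card (M ⊞ B) ≤ card B → m ∈ M → m₀ ∈ M → m ⊖ m₀ ∈ Stabilizer B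
  ⊞-stable {M} {B} {m} {m₀} le m∈M m₀∈M = ∈⟪⟫⁺ λ y →
    ⊆-antisym {X = λ z → B (z ⊖ (m ⊖ m₀))} {Y = B}
      (λ { z (mem p) → subst (_∈ B) (group (z ∷ m₀ ∷ []) (λ z a → (z :⊕ a) :⊖ a :≈ z) refl)
             (∈▹⁻ (into m₀∈M _ (subst (_∈ M ⊞ B)
                (group (z ∷ m ∷ m₀ ∷ []) (λ z m a → m :⊕ (z :⊖ (m :⊖ a)) :≈ z :⊕ a) refl) (∈⊞⁺ m∈M (mem p))))) })
      (λ z p → mem (holds (subst (_∈ B) (group (z ∷ m ∷ m₀ ∷ []) (λ z m a → (a :⊕ z) :⊖ m :≈ z :⊖ (m :⊖ a)) refl)
             (∈▹⁻ (into m∈M _ (∈⊞⁺ m₀∈M p))))))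
      y
    where
    into : ∀ {a} → a ∈ M → M ⊞ B ⊆ a ▹ B
    into {a} a∈M = ⊆-card⇒⊇
      (λ z p → subst (_∈ M ⊞ B) (group (z ∷ a ∷ []) (λ z a → a :⊕ (z :⊖ a) :≈ z) refl) (∈⊞⁺ a∈M (∈▹⁻ p)))
      (≤-trans le (≤-reflexive (sym (card-▹ a B))))

  -- Descent on a subgroup H with a coset containing M. If M + B is a union of cosets of H, then |H
  -- + B| ≤ |M + B| and H itself serves. Otherwise M + B covers some coset only partly; B is split
  -- into the part B₁ in the corresponding coset b + H and the rest B₂, and M + B₁ and M + B₂ are
  -- disjoint. The size of M + B₁ decides how to go on.
  sidon-in-coset : ∀ {U B M b₀ m₀} → Sidon U M → 2 < card M → b₀ ∈ B → m₀ ∈ M →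
    card (M ⊞ B) < card M + card B →
    ∀ f H → Subgroup H → H ⊆ U → card H ≤ f → card H < card U → M ⊆ m₀ ▹ H → ∃ (Dense U B)
  sidon-in-coset {U} {B} {M} {b₀} {m₀} sid 2<M b₀∈B m₀∈M tight = go
    where
    1<H : ∀ {H} → M ⊆ m₀ ▹ H → 1 < card H
    1<H {H} M⊆ = ≤-trans (≤-trans (n≤1+n 2) 2<M) (≤-trans (card-mono M⊆) (≤-reflexive (card-▹ m₀ H)))

    go : ∀ f H → Subgroup H → H ⊆ U → card H ≤ f → card H < card U → M ⊆ m₀ ▹ H → ∃ (Dense U B)
    go zero H H≤ _ H≤0 = ⊥-elim (<⇒≱ (∈⇒0<card (has-𝟘 H≤)) H≤0)
    go (suc f) H H≤ H⊆U H≤f H<U M⊆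
      with any? (λ z → (z ∈? M ⊞ B) ×-dec any? (λ h → (h ∈? H) ×-dec ¬? (z ⊕ h ∈? M ⊞ B)))
    ... | no periodic = H , dense H≤ H⊆U (1<H M⊆) H<U
      (linarith (card (H ⊞ B) ∷ card (M ⊞ B) ∷ card M ∷ card B ∷ card H ∷ [])
        (λ hb mb m b h → hb :≤ mb ∷ con 1 :+ mb :≤ m :+ b ∷ m :≤ h ∷ [] , con 1 :+ hb :≤ h :+ b)
        (≤-trans (≤-reflexive (sym (card-▹ m₀ (H ⊞ B)))) (card-mono moved)) tight
        (≤-trans (card-mono M⊆) (≤-reflexive (card-▹ m₀ H))))
      where
      moved : m₀ ▹ (H ⊞ B) ⊆ M ⊞ B
      moved z p with h , b , h∈H , b∈B , e ← ∈⊞⁻ (∈▹⁻ p) with (m₀ ⊕ b) ⊕ h ∈? M ⊞ B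
      ... | no ¬q = ⊥-elim (periodic (m₀ ⊕ b , ∈⊞⁺ m₀∈M b∈B , h , h∈H , ¬q))
      ... | yes q = subst (_∈ M ⊞ B) (begin
          (m₀ ⊕ b) ⊕ h    ≡⟨ group (m₀ ∷ b ∷ h ∷ []) (λ m b h → (m :⊕ b) :⊕ h :≈ (h :⊕ b) :⊕ m) refl ⟩
          (h ⊕ b) ⊕ m₀    ≡⟨ cong (_⊕ m₀) e ⟨
          (z ⊖ m₀) ⊕ m₀   ≡⟨ ⊖⊕ z m₀ ⟩
          z               ∎) q
        where open ≡-Reasoning
    ... | yes (z , z∈ , h , h∈H , escape)
      with m , b , m∈M , b∈B , refl ← ∈⊞⁻ z∈ = split (card M + card B₁ ≤? suc (card (M ⊞ B₁)))
      where
      B₁ B₂ : FSet N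
      B₁ = B ∩ (b ▹ H)
      B₂ = B ∖ (b ▹ H)

      M-diff : ∀ {x y} → x ∈ M → y ∈ M → x ⊖ y ∈ H
      M-diff {x} {y} p q = subst (_∈ H) (group (x ∷ y ∷ m₀ ∷ []) (λ x y a → (x :⊖ a) :⊖ (y :⊖ a) :≈ x :⊖ y) refl)
        (⊖-closed H≤ (∈▹⁻ (M⊆ x p)) (∈▹⁻ (M⊆ y q)))

      card-B : card B₁ + card B₂ ≡ card B
      card-B = card-∩-∖ B (b ▹ H)

      parts : card (M ⊞ B₁) + card (M ⊞ B₂) ≤ card (M ⊞ B)
      parts = card-disjoint (⊞-mono (λ _ p → p) λ i p → proj₁ (∈∩⁻ p)) (⊞-mono (λ _ p → p) λ i p → proj₁ (∈∖⁻ p)) apart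
        where
        apart : ∀ i → i ∈ M ⊞ B₁ → i ∉ M ⊞ B₂
        apart i p q with x , c , x∈ , c∈ , refl ← ∈⊞⁻ p with y , d , y∈ , d∈ , e ← ∈⊞⁻ q =
          proj₂ (∈∖⁻ d∈) (∈▹⁺ (subst (_∈ H) (begin
            (c ⊖ b) ⊕ (x ⊖ y)  ≡⟨ group (c ∷ b ∷ x ∷ y ∷ []) (λ c b x y → (c :⊖ b) :⊕ (x :⊖ y) :≈ ((x :⊕ c) :⊖ y) :⊖ b) refl ⟩
            ((x ⊕ c) ⊖ y) ⊖ b  ≡⟨ cong (λ u → (u ⊖ y) ⊖ b) e ⟩
            ((y ⊕ d) ⊖ y) ⊖ b  ≡⟨ group (y ∷ d ∷ b ∷ []) (λ y d b → ((y :⊕ d) :⊖ y) :⊖ b :≈ d :⊖ b) refl ⟩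
            d ⊖ b              ∎)
            (⊕-closed H≤ (∈▹⁻ (proj₂ (∈∩⁻ c∈))) (M-diff x∈ y∈))))
          where open ≡-Reasoning

      split : Dec (card M + card B₁ ≤ suc (card (M ⊞ B₁))) → ∃ (Dense U B)
      -- Here |M + B₂| ≤ |B₂|, so M - M stabilizes B₂ and a coset of H ∩ Stabilizer B₂ contains M.
      -- If this is all of H, then H + B lies in (b + H) ∪ B₂.
      split (yes le) with card (H ∩ Stabilizer B₂) <? card H
      ... | yes lt = go f (H ∩ Stabilizer B₂) (stabilizer-intersection B₂ H≤) (λ i p → H⊆U i (proj₁ (∈∩⁻ p)))
              (≤-pred (≤-trans lt H≤f)) (<-trans lt H<U)
              (λ x x∈M → ∈▹⁺ (∈∩⁺ (∈▹⁻ (M⊆ x x∈M)) (⊞-stable B₂-stable x∈M m₀∈M)))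
        where
        B₂-stable : card (M ⊞ B₂) ≤ card B₂
        B₂-stable = linarith (card M ∷ card B ∷ card B₁ ∷ card B₂ ∷ card (M ⊞ B) ∷ card (M ⊞ B₁) ∷ card (M ⊞ B₂) ∷ [])
          (λ m b b₁ b₂ mb mb₁ mb₂ → con 1 :+ mb :≤ m :+ b ∷ b :≤ b₁ :+ b₂ ∷ mb₁ :+ mb₂ :≤ mb ∷
            m :+ b₁ :≤ con 1 :+ mb₁ ∷ [] , mb₂ :≤ b₂) tight (≤-reflexive (sym card-B)) parts le
      ... | no ≮ = H , dense H≤ H⊆U (1<H M⊆) H<U
          (linarith (card (H ⊞ B) ∷ card H ∷ card B ∷ card B₁ ∷ card B₂ ∷ [])
            (λ hb h b b₁ b₂ → hb :≤ h :+ b₂ ∷ b₁ :+ b₂ :≤ b ∷ con 1 :≤ b₁ ∷ [] , con 1 :+ hb :≤ h :+ b)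
            (subst (λ c → card (H ⊞ B) ≤ c + card B₂) (card-▹ b H) (card-⊆-∪ cover)) (≤-reflexive card-B)
            (∈⇒0<card (∈∩⁺ b∈B (coset-refl H≤))))
        where
        H-stable : H ⊆ H ∩ Stabilizer B₂
        H-stable = ⊆-card⇒⊇ (λ i p → proj₁ (∈∩⁻ p)) (≮⇒≥ ≮)
        cover : H ⊞ B ⊆ (b ▹ H) ∪ B₂
        cover i p with x , c , x∈ , c∈ , refl ← ∈⊞⁻ p with c ∈? b ▹ H
        ... | yes q = ∈∪⁺ˡ (∈▹⁺ (subst (_∈ H) (group (x ∷ c ∷ b ∷ []) (λ x c b → x :⊕ (c :⊖ b) :≈ (x :⊕ c) :⊖ b) refl)
                        (⊕-closed H≤ x∈ (∈▹⁻ q))))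
        ... | no ¬q = ∈∪⁺ʳ (mem (trans (sym (∈⟪⟫⁻ (proj₂ (∈∩⁻ (H-stable x x∈))) (x ⊕ c)))
                        (trans (cong B₂ (group (x ∷ c ∷ []) (λ x c → (x :⊕ c) :⊖ x :≈ c) refl)) (holds (∈∖⁺ c∈ ¬q)))))
      -- The roles are exchanged: B₁ - b is a 1-fragment for M - m₀ in H with boundary at most |M| -
      -- 2, its sumset being proper thanks to the uncovered element. The resulting subgroup Q is
      -- smaller than H, and a coset of it contains M because M is Sidon.
      split (no ≰) = let Q , Q≤ , F = atom₁ H≤ M°⊆H (∈▹⁺ (subst (_∈ M) (group (m₀ ∷ []) (λ a → a :≈ :𝟘 :⊖ :⊝ a) refl) m₀∈M)) F₀ in
          go f Q Q≤ (λ i p → H⊆U i (inside F i p)) (≤-pred (≤-trans (Q<H F) H≤f)) (<-trans (Q<H F) H<U)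
            (sidon-coset Q≤ (λ i p → H⊆U i (inside F i p)) (1<Q F Q≤) sid (Q-dense F) m₀∈M)
        where
        κ : ℕ
        κ = card M ∸ 2
        κ+2 : κ + 2 ≡ card M
        κ+2 = m∸n+n≡m (≤-trans (n≤1+n 2) 2<M)
        M° B₁° : FSet N
        M°  = (⊝ m₀) ▹ M
        B₁° = (⊝ b) ▹ B₁
        M°⊆H : M° ⊆ H
        M°⊆H i p = subst (_∈ H) (group (i ∷ m₀ ∷ []) (λ i a → (i :⊖ :⊝ a) :⊖ a :≈ i) refl) (∈▹⁻ (M⊆ _ (∈▹⁻ p)))
        B₁°⊆H : B₁° ⊆ H
        B₁°⊆H i p = subst (_∈ H) (group (i ∷ b ∷ []) (λ i a → (i :⊖ :⊝ a) :⊖ a :≈ i) refl) (∈▹⁻ (proj₂ (∈∩⁻ (∈▹⁻ p))))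
        shifted : ∀ i → i ∈ B₁° ⊞ M° → (i ⊕ m₀) ⊕ b ∈ M ⊞ B₁
        shifted i p with s , t , s∈ , t∈ , refl ← ∈⊞⁻ p = subst (_∈ M ⊞ B₁)
          (group (s ∷ t ∷ m₀ ∷ b ∷ []) (λ s t a b → (t :⊖ :⊝ a) :⊕ (s :⊖ :⊝ b) :≈ ((s :⊕ t) :⊕ a) :⊕ b) refl)
          (∈⊞⁺ (∈▹⁻ t∈) (∈▹⁻ s∈))
        sum≤ : card (B₁° ⊞ M°) ≤ card (M ⊞ B₁)
        sum≤ = ≤-trans (card-mono λ i p → ∈▹⁺ {g = (⊝ m₀) ⊖ b} (subst (_∈ M ⊞ B₁)
            (group (i ∷ m₀ ∷ b ∷ []) (λ i a b → (i :⊕ a) :⊕ b :≈ i :⊖ (:⊝ a :⊖ b)) refl) (shifted i p)))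
          (≤-reflexive (card-▹ ((⊝ m₀) ⊖ b) (M ⊞ B₁)))
        F₀ : Fragment 1 H M° κ B₁°
        F₀ = fragment B₁°⊆H
          (∈⇒0<card (∈▹⁺ (subst (_∈ B₁) (group (b ∷ []) (λ a → a :≈ :𝟘 :⊖ :⊝ a) refl) (∈∩⁺ b∈B (coset-refl H≤)))))
          (card-⊂ (⊞-⊆ {t = 1} H≤ M°⊆H (∈▹⁺ (subst (_∈ M) (group (m₀ ∷ []) (λ a → a :≈ :𝟘 :⊖ :⊝ a) refl) m₀∈M)) B₁°⊆H)
            {(m ⊖ m₀) ⊕ h} (⊕-closed H≤ (∈▹⁻ (M⊆ m m∈M)) h∈H)
            λ p → escape (subst (_∈ M ⊞ B)
              (group (m ∷ m₀ ∷ h ∷ b ∷ []) (λ m a h b → (((m :⊖ a) :⊕ h) :⊕ a) :⊕ b :≈ (m :⊕ b) :⊕ h) refl)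
              (⊞-mono (λ _ p → p) (λ _ p → proj₁ (∈∩⁻ p)) _ (shifted _ p))))
          (linarith (card (B₁° ⊞ M°) ∷ card (M ⊞ B₁) ∷ card M ∷ card B₁ ∷ card B₁° ∷ κ ∷ [])
            (λ s mb₁ m b₁ b₁° κ → s :≤ mb₁ ∷ con 2 :+ mb₁ :≤ m :+ b₁ ∷ b₁ :≤ b₁° ∷ m :≤ κ :+ con 2 ∷ [] , s :≤ b₁° :+ κ)
            sum≤ (≰⇒> ≰) (≤-reflexive (sym (card-▹ (⊝ b) B₁))) (≤-reflexive (sym κ+2)))
        module _ {Q : FSet N} (F : Fragment 1 H M° κ Q) where
          Q⊞M≤ : card (Q ⊞ M) ≤ card (Q ⊞ M°)
          Q⊞M≤ = ≤-trans (card-mono λ i p → let s , t , s∈ , t∈ , e = ∈⊞⁻ p in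
              ∈▹⁺ {g = m₀} (subst (_∈ Q ⊞ M°) (trans (group (s ∷ t ∷ m₀ ∷ []) (λ s t a → s :⊕ (t :⊖ a) :≈ (s :⊕ t) :⊖ a) refl) (cong (_⊖ m₀) (sym e)))
                (∈⊞⁺ s∈ (∈▹⁺ (subst (_∈ M) (group (t ∷ m₀ ∷ []) (λ t a → t :≈ (t :⊖ a) :⊖ :⊝ a) refl) t∈)))))
            (≤-reflexive (card-▹ m₀ (Q ⊞ M°)))
          Q-dense : card (Q ⊞ M) < card Q + card M
          Q-dense = linarith (card (Q ⊞ M) ∷ card (Q ⊞ M°) ∷ card Q ∷ card M ∷ κ ∷ [])
            (λ qm qm° q m κ → qm :≤ qm° ∷ qm° :≤ q :+ κ ∷ κ :+ con 2 :≤ m ∷ [] , con 1 :+ qm :≤ q :+ m)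
            Q⊞M≤ (boundary F) (≤-reflexive κ+2)
          Q<H : card Q < card H
          Q<H = ≤-trans (s≤s (card≤card-⊞ˡ (∈▹⁺ (subst (_∈ M) (group (m₀ ∷ []) (λ a → a :≈ :𝟘 :⊖ :⊝ a) refl) m₀∈M)))) (cosmall F)
          1<Q : Subgroup Q → 1 < card Q
          1<Q Q≤ = linarith (card (Q ⊞ M) ∷ card (Q ⊞ M°) ∷ card Q ∷ card M ∷ κ ∷ [])
            (λ qm qm° q m κ → m :≤ qm ∷ qm :≤ qm° ∷ qm° :≤ q :+ κ ∷ κ :+ con 2 :≤ m ∷ [] , con 2 :≤ q)
            (card≤card-⊞ʳ (has-𝟘 Q≤)) Q⊞M≤ (boundary F) (≤-reflexive κ+2)

  -- Sets with small 2-fragments: a dichotomy of Vosper type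

  NearlyPeriodic : FSet N → FSet N → Set
  NearlyPeriodic U B = ∃ λ x → x ∈ U × x ≢ 𝟘 × card (B ∪ (x ▹ B)) ≤ suc (card B)

  ⊞-translate : ∀ {M B b} → b ∈ B → b ▹ M ⊆ M ⊞ B
  ⊞-translate {M} {B} {b} b∈B z p = subst (_∈ M ⊞ B) (⊖⊕ z b) (∈⊞⁺ (∈▹⁻ p) b∈B)

  -- Three translates of M by elements of B meet pairwise in at most one point, so their union has
  -- at least 3|M| - 3 elements.
  sidon-≤ : ∀ {U M B b₀} → Subgroup U → B ⊆ U → Sidon U M → b₀ ∈ B → 2 < card B →
    card M + card M + card M ≤ card (M ⊞ B) + 3
  sidon-≤ {U} {M} {B} {b₀} U≤ B⊆U sid b₀∈B 2<B
    with b₁ , b₁∈B , b₁≢b₀ ← 1<card⇒∃≢ (≤-trans (n≤1+n 2) 2<B) b₀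
    with b₂ , b₂∈B , b₂≢b₀ , b₂≢b₁ ← 2<card⇒∃≢≢ 2<B b₀ b₁ =
    linarith (card X₀ ∷ card X₁ ∷ card X₂ ∷ card (X₀ ∪ X₁) ∷ card (X₀ ∩ X₁) ∷ card ((X₀ ∪ X₁) ∪ X₂) ∷
              card ((X₀ ∪ X₁) ∩ X₂) ∷ card (X₀ ∩ X₂) ∷ card (X₁ ∩ X₂) ∷ card (M ⊞ B) ∷ card M ∷ [])
      (λ x₀ x₁ x₂ u i v j k l s m → m :≤ x₀ ∷ m :≤ x₁ ∷ m :≤ x₂ ∷ x₀ :+ x₁ :≤ u :+ i ∷ u :+ x₂ :≤ v :+ j ∷
        j :≤ k :+ l ∷ con 1 :+ i :≤ con 2 ∷ con 1 :+ k :≤ con 2 ∷ con 1 :+ l :≤ con 2 ∷ v :≤ s ∷ [] , m :+ m :+ m :≤ s :+ con 3)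
      (translated b₀) (translated b₁) (translated b₂)
      (≤-reflexive (sym (card-∪-∩ X₀ X₁))) (≤-reflexive (sym (card-∪-∩ (X₀ ∪ X₁) X₂)))
      (card-⊆-∪ λ i p → let q , r = ∈∩⁻ p in
        [ (λ x → ∈∪⁺ˡ (∈∩⁺ x r)) , (λ x → ∈∪⁺ʳ (∈∩⁺ x r)) ]′ (∈∪⁻ q))
      (meet b₀∈B b₁∈B b₁≢b₀) (meet b₀∈B b₂∈B b₂≢b₀) (meet b₁∈B b₂∈B b₂≢b₁)
      (card-mono λ i p → [ (λ q → [ ⊞-translate b₀∈B i , ⊞-translate b₁∈B i ]′ (∈∪⁻ q)) , ⊞-translate b₂∈B i ]′ (∈∪⁻ p))
    where
    X₀ X₁ X₂ : FSet N
    X₀ = b₀ ▹ M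
    X₁ = b₁ ▹ M
    X₂ = b₂ ▹ M
    translated : ∀ b → card M ≤ card (b ▹ M)
    translated b = ≤-reflexive (sym (card-▹ b M))
    meet : ∀ {a b} → a ∈ B → b ∈ B → b ≢ a → card ((a ▹ M) ∩ (b ▹ M)) < 2
    meet {a} {b} a∈B b∈B b≢a = ≤-<-trans
      (≤-trans (card-mono λ i p → let q , r = ∈∩⁻ p in ∈▹⁺ {g = a} (∈∩⁺ (∈▹⁻ q) (∈▹⁺ (subst (_∈ M)
          (group (i ∷ a ∷ b ∷ []) (λ i a b → i :⊖ b :≈ (i :⊖ a) :⊖ (b :⊖ a)) refl) (∈▹⁻ r)))))
        (≤-reflexive (card-▹ a (M ∩ ((b ⊖ a) ▹ M)))))
      (sid (b ⊖ a) (⊖-closed U≤ (B⊆U b b∈B) (B⊆U a a∈B)) (b≢a ∘ ⊖≡𝟘⇒≡))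

  small-pair : ∀ {U B b₀ κ M} → Subgroup U → b₀ ∈ B → suc κ ≡ card B → Fragment 2 U B κ M →
    card M ≤ 2 → NearlyPeriodic U B
  small-pair {U} {B} {b₀} {κ} {M} U≤ b₀∈B κ+1 F M≤2
    with m₀ , m₀∈M ← 0<card⇒∃ (≤-trans (s≤s z≤n) (large F))
    with m₁ , m₁∈M , m₁≢m₀ ← 1<card⇒∃≢ (large F) m₀ =
    m₁ ⊖ m₀ , ⊖-closed U≤ (inside F m₁ m₁∈M) (inside F m₀ m₀∈M) , m₁≢m₀ ∘ ⊖≡𝟘⇒≡ ,
    linarith (card (B ∪ ((m₁ ⊖ m₀) ▹ B)) ∷ card (M ⊞ B) ∷ card M ∷ card B ∷ κ ∷ [])
      (λ u mb m b κ → u :≤ mb ∷ mb :≤ m :+ κ ∷ m :≤ con 2 ∷ con 1 :+ κ :≤ b ∷ [] , u :≤ con 1 :+ b)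
      (≤-trans (≤-reflexive (sym (card-▹ m₀ _))) (card-mono covered)) (boundary F) M≤2 (≤-reflexive κ+1)
    where
    covered : m₀ ▹ (B ∪ ((m₁ ⊖ m₀) ▹ B)) ⊆ M ⊞ B
    covered z p with ∈∪⁻ (∈▹⁻ p)
    ... | inj₁ q = subst (_∈ M ⊞ B) (group (m₀ ∷ z ∷ []) (λ m z → m :⊕ (z :⊖ m) :≈ z) refl) (∈⊞⁺ m₀∈M q)
    ... | inj₂ q = subst (_∈ M ⊞ B) (group (m₀ ∷ m₁ ∷ z ∷ []) (λ a b z → b :⊕ ((z :⊖ a) :⊖ (b :⊖ a)) :≈ z) refl) (∈⊞⁺ m₁∈M (∈▹⁻ q))

  two-element : ∀ {U B b₀} → Subgroup U → B ⊆ U → b₀ ∈ B → card B ≡ 2 → NearlyPeriodic U B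
  two-element {U} {B} {b₀} U≤ B⊆U b₀∈B B≡2
    with b₁ , b₁∈B , b₁≢b₀ ← 1<card⇒∃≢ (≤-reflexive (sym B≡2)) b₀ =
    b₁ ⊖ b₀ , ⊖-closed U≤ (B⊆U b₁ b₁∈B) (B⊆U b₀ b₀∈B) , b₁≢b₀ ∘ ⊖≡𝟘⇒≡ ,
    linarith (card (B ∪ X) ∷ card (B ∩ X) ∷ card B ∷ card X ∷ [])
      (λ u i b x → u :+ i :≤ b :+ x ∷ con 1 :≤ i ∷ x :≤ b ∷ b :≤ con 2 ∷ [] , u :≤ con 1 :+ b)
      (≤-reflexive (card-∪-∩ B X)) (∈⇒0<card (∈∩⁺ b₁∈B (∈▹⁺ (subst (_∈ B)
        (group (b₀ ∷ b₁ ∷ []) (λ a b → a :≈ b :⊖ (b :⊖ a)) refl) b₀∈B))))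
      (≤-reflexive (card-▹ (b₁ ⊖ b₀) B)) (≤-reflexive B≡2)
    where
    X : FSet N
    X = (b₁ ⊖ b₀) ▹ B

  -- Induction on |B|, needed for a Sidon atom M. If 2 < |B| ≤ |M|, then 3|M| - 3 ≤ |M + B| ≤ |M| +
  -- |B| - 1 forces |M| ≤ 2. If |B| > |M|, then B is a 2-fragment for the smaller set M. There M
  -- cannot be nearly periodic, since it would share |M| - 1 ≥ 2 points with a translate, and a
  -- dense subgroup for M leads to one for B by `sidon-in-coset`.
  critical-pair : ∀ f {U B b₀ κ S} → Subgroup U → B ⊆ U → b₀ ∈ B → 1 < card B → card B ≤ f →
    suc κ ≡ card B → Fragment 2 U B κ S → NearlyPeriodic U B ⊎ ∃ (Dense U B)
  critical-pair f U≤ B⊆U b₀∈B 1<B B≤f κ+1 F₀ with atom₂ U≤ B⊆U b₀∈B F₀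
  ... | pair F M≤2 = inj₁ (small-pair U≤ b₀∈B κ+1 F M≤2)
  critical-pair f {U} {B} {b₀} {κ} U≤ B⊆U b₀∈B 1<B B≤f κ+1 F₀ | subgroup {H} F H≤ = inj₂ (H , dense H≤ (inside F) (large F)
    (linarith (card H ∷ card (H ⊞ B) ∷ card U ∷ []) (λ h hb u → h :≤ hb ∷ con 2 :+ hb :≤ u ∷ [] , con 1 :+ h :≤ u)
      (card≤card-⊞ˡ b₀∈B) (cosmall F))
    (linarith (card H ∷ card (H ⊞ B) ∷ card B ∷ κ ∷ [])
      (λ h hb b κ → hb :≤ h :+ κ ∷ con 1 :+ κ :≤ b ∷ [] , con 1 :+ hb :≤ h :+ b)
      (boundary F) (≤-reflexive κ+1)))
  critical-pair f {U} {B} {b₀} {κ} U≤ B⊆U b₀∈B 1<B B≤f κ+1 F₀ | sidon {M} F 2<M sid with card B ≤? card M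
  ... | yes B≤M with card B ≤? 2
  ...   | yes B≤2 = inj₁ (two-element U≤ B⊆U b₀∈B (≤-antisym B≤2 1<B))
  ...   | no 2<B = ⊥-elim (<⇒≱ 2<M
          (linarith (card M ∷ card (M ⊞ B) ∷ card B ∷ κ ∷ [])
            (λ m mb b κ → m :+ m :+ m :≤ mb :+ con 3 ∷ mb :≤ m :+ κ ∷ con 1 :+ κ :≤ b ∷ b :≤ m ∷ [] , m :≤ con 2)
            (sidon-≤ U≤ B⊆U sid b₀∈B (≰⇒> 2<B)) (boundary F) (≤-reflexive κ+1) B≤M))
  critical-pair zero {B = B} U≤ B⊆U b₀∈B 1<B B≤f κ+1 F₀ | sidon F 2<M sid | no B≰M = ⊥-elim (<⇒≱ 1<B (≤-trans B≤f z≤n))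
  critical-pair (suc f) {U} {B} {b₀} {κ} U≤ B⊆U b₀∈B 1<B B≤f κ+1 F₀ | sidon {M} F 2<M sid | no B≰M
    with m₀ , m₀∈M ← 0<card⇒∃ (≤-trans (s≤s z≤n) 2<M)
    with critical-pair f U≤ (inside F) m₀∈M (≤-trans (n≤1+n 2) 2<M) (≤-pred (≤-trans (≰⇒> B≰M) B≤f))
           (m+[n∸m]≡n (≤-trans (s≤s z≤n) 2<M)) B-fragment
    where
    B⊞M≤ : card (B ⊞ M) ≤ card (M ⊞ B)
    B⊞M≤ = ≤-reflexive (card-⊞-comm B M)
    B-fragment : Fragment 2 U M (card M ∸ 1) B
    B-fragment = fragment B⊆U 1<B (≤-trans (+-monoʳ-≤ 2 B⊞M≤) (cosmall F))
      (linarith (card (B ⊞ M) ∷ card (M ⊞ B) ∷ card M ∷ κ ∷ card B ∷ card M ∸ 1 ∷ [])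
        (λ bm mb m κ b λ′ → bm :≤ mb ∷ mb :≤ m :+ κ ∷ con 1 :+ κ :≤ b ∷ m :≤ con 1 :+ λ′ ∷ [] , bm :≤ b :+ λ′)
        B⊞M≤ (boundary F) (≤-reflexive κ+1) (≤-reflexive (sym (m+[n∸m]≡n (≤-trans (s≤s z≤n) 2<M)))))
  ... | inj₁ (x , x∈U , x≢𝟘 , le) = ⊥-elim (<⇒≱ (sid x x∈U x≢𝟘)
        (linarith (card (M ∪ (x ▹ M)) ∷ card (M ∩ (x ▹ M)) ∷ card M ∷ card (x ▹ M) ∷ [])
          (λ u i m xm → u :≤ con 1 :+ m ∷ m :+ xm :≤ u :+ i ∷ m :≤ xm ∷ con 3 :≤ m ∷ [] , con 2 :≤ i)
          le (≤-reflexive (sym (card-∪-∩ M (x ▹ M)))) (≤-reflexive (sym (card-▹ x M))) 2<M))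
  ... | inj₂ (H , dense H≤ H⊆U 1<H H<U few) = inj₂ (sidon-in-coset sid 2<M b₀∈B m₀∈M
        (linarith (card (M ⊞ B) ∷ card M ∷ κ ∷ card B ∷ [])
          (λ mb m κ b → mb :≤ m :+ κ ∷ con 1 :+ κ :≤ b ∷ [] , con 1 :+ mb :≤ m :+ b) (boundary F) (≤-reflexive κ+1))
        (card H) H H≤ H⊆U ≤-refl H<U (sidon-coset H≤ H⊆U 1<H sid few m₀∈M))

  DifferencesPeriodic : FSet N → Fin N → Set
  DifferencesPeriodic B x = ∀ {b c} → b ∈ B → c ∈ B → ∃₂ λ u v → u ∈ B × v ∈ B × u ⊖ v ≡ (b ⊖ c) ⊕ x

  -- Pigeonhole inside a coset. If b and c lie in different cosets, the two parts of B have more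
  -- than |H| elements together, so the part at b meets the part at c shifted by b - c + x. If they
  -- lie in the same coset, b - c + x is in H, and one of any two cosets meeting B is more than half
  -- full, so that its part meets its own shift.
  dense⇒periodic : ∀ {B H b₀ b₁} → Subgroup H → card (H ⊞ B) < card H + card B →
    b₀ ∈ B → b₁ ∈ B → b₁ ⊖ b₀ ∉ H → ∀ {x} → x ∈ H → DifferencesPeriodic B x
  dense⇒periodic {B} {H} {b₀} {b₁} H≤ few b₀∈B b₁∈B apart {x} x∈H {b} {c} b∈B c∈B = go ((b ⊖ c) ∈? H)
    where
    y : Fin N
    y = (b ⊖ c) ⊕ x

    collide : ∀ {X Y a} → X ⊆ B → Y ⊆ B → X ⊆ a ▹ H → y ▹ Y ⊆ a ▹ H → card H < card X + card Y →
      ∃₂ λ u v → u ∈ B × v ∈ B × u ⊖ v ≡ y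
    collide {X} {Y} {a} X⊆B Y⊆B X⊆ Y⊆ lt
      with i , i∈X , i∈Y ← card-meet X⊆ Y⊆ (subst₂ _<_ (sym (card-▹ a H)) (cong (card X +_) (sym (card-▹ y Y))) lt) =
      i , i ⊖ y , X⊆B i i∈X , Y⊆B _ (∈▹⁻ i∈Y) , group (i ∷ y ∷ []) (λ i y → i :⊖ (i :⊖ y) :≈ y) refl

    part : ∀ a → B ∩ (a ▹ H) ⊆ B
    part a i p = proj₁ (∈∩⁻ p)
    part′ : ∀ a → B ∩ (a ▹ H) ⊆ a ▹ H
    part′ a i p = proj₂ (∈∩⁻ p)

    elsewhere : ∃ λ a → a ∈ B × a ⊖ b ∉ H
    elsewhere with (b₀ ⊖ b) ∈? H | (b₁ ⊖ b) ∈? H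
    ... | no ¬p | _     = b₀ , b₀∈B , ¬p
    ... | yes _ | no ¬p = b₁ , b₁∈B , ¬p
    ... | yes p | yes q = ⊥-elim (apart (subst (_∈ H)
          (group (b₀ ∷ b₁ ∷ b ∷ []) (λ a c b → (c :⊖ b) :⊖ (a :⊖ b) :≈ c :⊖ a) refl) (⊖-closed H≤ q p)))

    go : Dec (b ⊖ c ∈ H) → ∃₂ λ u v → u ∈ B × v ∈ B × u ⊖ v ≡ y
    go (no b≁c) = collide (part b) (part c) (part′ b)
      (λ i p → ∈▹⁺ (subst (_∈ H)
        (group (i ∷ b ∷ c ∷ x ∷ []) (λ i b c x → ((i :⊖ (b :⊖ c :⊕ x)) :⊖ c) :⊕ x :≈ i :⊖ b) refl)
        (⊕-closed H≤ (∈▹⁻ (part′ c _ (∈▹⁻ p))) x∈H)))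
      (subst (card H <_) (+-comm (card (B ∩ (c ▹ H))) (card (B ∩ (b ▹ H)))) (two-cosets H≤ few c∈B b∈B b≁c))
    go (yes b~c) with a , a∈B , a≁b ← elsewhere with card H <? card (B ∩ (b ▹ H)) + card (B ∩ (b ▹ H))
    ... | yes lt = collide (part b) (part b) (part′ b) (coset-▹ H≤ (⊕-closed H≤ b~c x∈H) (part′ b)) lt
    ... | no ≮ = collide (part a) (part a) (part′ a) (coset-▹ H≤ (⊕-closed H≤ b~c x∈H) (part′ a))
          (linarith (card H ∷ card (B ∩ (b ▹ H)) ∷ card (B ∩ (a ▹ H)) ∷ [])
            (λ h p q → con 1 :+ h :≤ p :+ q ∷ con 1 :+ h :≤ p :+ q ∷ p :+ p :≤ h ∷ [] , con 1 :+ h :≤ q :+ q)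
            (two-cosets H≤ few b∈B a∈B a≁b) (two-cosets H≤ few b∈B a∈B a≁b) (≮⇒≥ ≮))

  -- Iterated sumsets and sum-free sets

  iter : ℕ → FSet N → FSet N
  iter zero    B = ⁅ 𝟘 ⁆
  iter (suc j) B = iter j B ⊞ B

  -- The set jB - lB, built from -lB one summand at a time so that its growth can be followed.
  chain : ℕ → FSet N → ℕ → FSet N
  chain l B zero    = ⊟ iter l B
  chain l B (suc j) = chain l B j ⊞ B

  Aperiodic : FSet N → Set
  Aperiodic B = ∀ x → x ≢ 𝟘 → ¬ DifferencesPeriodic B x

  Generates : FSet N → FSet N → Set
  Generates B U = ∀ H → Subgroup H → B ⊆ H → H ⊆ U → ¬ card H < card U

  Cyclic : Fin N → FSet N → Set
  Cyclic x Q = (∀ j → j ×ᵍ x ∈ Q) × (∀ z → z ∈ Q → ∃ λ j → z ≡ j ×ᵍ x)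

  -- Existence of a smaller subgroup containing B is not decided, so the minimal one is only handed
  -- to a proof of ⊥.
  generated-subgroup : ∀ f U {B} → Subgroup U → B ⊆ U → card U ≤ f →
    (∀ V → Subgroup V → B ⊆ V → Generates B V → ⊥) → ⊥
  generated-subgroup zero    U U≤ B⊆U U≤0 k = <⇒≱ (∈⇒0<card (has-𝟘 U≤)) U≤0
  generated-subgroup (suc f) U U≤ B⊆U U≤f k = k U U≤ B⊆U λ H H≤ B⊆H H⊆U lt →
    generated-subgroup f H H≤ B⊆H (≤-pred (≤-trans lt U≤f)) k

  module _ {B : FSet N} (𝟘∈B : 𝟘 ∈ B) {m : ℕ} (card-B : card B ≡ suc m) (1≤m : 1 ≤ m)
    (aperiodic : Aperiodic B) where

    1<B : 1 < card B
    1<B = subst (1 <_) (sym card-B) (s≤s 1≤m)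

    ⊆-⊞B : ∀ S → S ⊆ S ⊞ B
    ⊆-⊞B S z p = subst (_∈ S ⊞ B) (group (z ∷ []) (λ z → z :⊕ :𝟘 :≈ z) refl) (∈⊞⁺ p 𝟘∈B)

    dense-⊇ : ∀ {H} → Subgroup H → 1 < card H → card (H ⊞ B) < card H + card B → B ⊆ H
    dense-⊇ {H} H≤ 1<H few b b∈B with b ∈? H
    ... | yes p = p
    ... | no ¬p with x , x∈H , x≢𝟘 ← 1<card⇒∃≢ 1<H 𝟘 = ⊥-elim (aperiodic x x≢𝟘
          (dense⇒periodic H≤ few 𝟘∈B b∈B
            (¬p ∘ subst (_∈ H) (group (b ∷ []) (λ b → b :⊖ :𝟘 :≈ b) refl)) x∈H))

    module _ {U : FSet N} (U≤ : Subgroup U) (B⊆U : B ⊆ U) (generates : Generates B U) where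

      -- A violation makes S a 1-fragment with boundary at most m - 1 and so yields a subgroup H
      -- with |H + B| < |H| + |B|. Aperiodicity puts B inside H, against the assumption that B
      -- generates U.
      kneser-step : ∀ {S s} → S ⊆ U → s ∈ S → card (S ⊞ B) < card U → card S + m ≤ card (S ⊞ B)
      kneser-step {S} {s} S⊆U s∈S proper with card S + m ≤? card (S ⊞ B)
      ... | yes le = le
      ... | no ≰ = ⊥-elim (contra (atom₁ U≤ B⊆U 𝟘∈B (fragment S⊆U (∈⇒0<card s∈S) proper
            (linarith (card (S ⊞ B) ∷ card S ∷ m ∷ m ∸ 1 ∷ [])
              (λ sb s m m′ → con 1 :+ sb :≤ s :+ m ∷ m :≤ con 1 :+ m′ ∷ [] , sb :≤ s :+ m′)
              (≰⇒> ≰) (≤-reflexive (sym m-1))))))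
        where
        m-1 : 1 + (m ∸ 1) ≡ m
        m-1 = m+[n∸m]≡n 1≤m
        contra : (∃ λ H → Subgroup H × Fragment 1 U B (m ∸ 1) H) → ⊥
        contra (H , H≤ , F) = generates H H≤
          (dense-⊇ H≤
            (linarith (card (H ⊞ B) ∷ card B ∷ card H ∷ m ∷ m ∸ 1 ∷ [])
              (λ hb b h m m′ → b :≤ hb ∷ hb :≤ h :+ m′ ∷ con 1 :+ m′ :≤ m ∷ con 1 :+ m :≤ b ∷ [] , con 2 :≤ h)
              (card≤card-⊞ʳ (has-𝟘 H≤)) (boundary F) (≤-reflexive m-1) (≤-reflexive (sym card-B)))
            (linarith (card (H ⊞ B) ∷ card B ∷ card H ∷ m ∷ m ∸ 1 ∷ [])
              (λ hb b h m m′ → hb :≤ h :+ m′ ∷ con 1 :+ m′ :≤ m ∷ con 1 :+ m :≤ b ∷ [] , con 1 :+ hb :≤ h :+ b)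
              (boundary F) (≤-reflexive m-1) (≤-reflexive (sym card-B))))
          (inside F) (≤-trans (s≤s (card≤card-⊞ˡ 𝟘∈B)) (cosmall F))

      iter-⊆ : ∀ j → iter j B ⊆ U
      iter-⊆ zero    z p = subst (_∈ U) (sym (∈⁅⁆⁻ p)) (has-𝟘 U≤)
      iter-⊆ (suc j) = ⊞-⊆ {t = 1} U≤ B⊆U 𝟘∈B (iter-⊆ j)

      𝟘∈iter : ∀ j → 𝟘 ∈ iter j B
      𝟘∈iter zero    = ∈⁅⁆⁺ refl
      𝟘∈iter (suc j) = ⊆-⊞B (iter j B) 𝟘 (𝟘∈iter j)

      module _ (k l : ℕ) {c : Fin N} (c∈U : c ∈ U) (c∉chain : c ∉ chain l B k) (1≤l : 1 ≤ l) where

        chain-⊆ : ∀ j → chain l B j ⊆ U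
        chain-⊆ zero    z p = subst (_∈ U) (group (z ∷ []) (λ z → :⊝ (:⊝ z) :≈ z) refl)
          (⊝-closed U≤ (iter-⊆ l _ (∈⊟⁻ p)))
        chain-⊆ (suc j) = ⊞-⊆ {t = 1} U≤ B⊆U 𝟘∈B (chain-⊆ j)

        𝟘∈chain : ∀ j → 𝟘 ∈ chain l B j
        𝟘∈chain zero    = ∈⊟⁺ (subst (_∈ iter l B) (group [] (:𝟘 :≈ :⊝ :𝟘) refl) (𝟘∈iter l))
        𝟘∈chain (suc j) = ⊆-⊞B (chain l B j) 𝟘 (𝟘∈chain j)

        chain-mono : ∀ i j → chain l B j ⊆ chain l B (i + j)
        chain-mono zero    j z p = p
        chain-mono (suc i) j z p = ⊆-⊞B (chain l B (i + j)) z (chain-mono i j z p)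

        iter-mono : ∀ i j → iter j B ⊆ iter (i + j) B
        iter-mono zero    j z p = p
        iter-mono (suc i) j z p = ⊆-⊞B (iter (i + j) B) z (iter-mono i j z p)

        -- The chain increases because 0 is in B, so the point `c` missed at stage k is missed at
        -- every earlier stage.
        chain<U : ∀ {j} → j ≤ k → card (chain l B j) < card U
        chain<U {j} j≤k = card-⊂ (chain-⊆ j) c∈U
          (c∉chain ∘ λ p → subst (λ i → c ∈ chain l B i) (m∸n+n≡m j≤k) (chain-mono (k ∸ j) j c p))

        iter<U : ∀ {j} → j ≤ l → card (iter j B) < card U
        iter<U {j} j≤l = ≤-<-trans
          (≤-trans (card-mono λ z p → subst (λ i → z ∈ iter i B) (m∸n+n≡m j≤l) (iter-mono (l ∸ j) j z p))
            (≤-reflexive (sym (card-⊟ (iter l B)))))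
          (chain<U z≤n)

        iter-growth : ∀ j → j ≤ l → j * m + 1 ≤ card (iter j B)
        iter-growth zero    _   = ≤-reflexive (sym (card-⁅⁆ 𝟘))
        iter-growth (suc j) j<l =
          linarith (m ∷ j * m ∷ card (iter j B) ∷ card (iter (suc j) B) ∷ [])
            (λ m jm i i′ → jm :+ con 1 :≤ i ∷ i :+ m :≤ i′ ∷ [] , m :+ jm :+ con 1 :≤ i′)
            (iter-growth j (<⇒≤ j<l)) (kneser-step (iter-⊆ j) (𝟘∈iter j) (iter<U j<l))

        chain-growth : ∀ j → j ≤ k → j * m + (l * m + 1) ≤ card (chain l B j)
        chain-growth zero    _   = ≤-trans (iter-growth l ≤-refl) (≤-reflexive (sym (card-⊟ (iter l B))))
        chain-growth (suc j) j<k =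
          linarith (m ∷ j * m ∷ l * m ∷ card (chain l B j) ∷ card (chain l B (suc j)) ∷ [])
            (λ m jm lm i i′ → jm :+ (lm :+ con 1) :≤ i ∷ i :+ m :≤ i′ ∷ [] , m :+ jm :+ (lm :+ con 1) :≤ i′)
            (chain-growth j (<⇒≤ j<k)) (kneser-step (chain-⊆ j) (𝟘∈chain j) (chain<U j<k))

        kneser-bound : k * m + l * m + 2 ≤ card U
        kneser-bound = linarith (k * m ∷ l * m ∷ card (chain l B k) ∷ card U ∷ [])
          (λ km lm c u → km :+ (lm :+ con 1) :≤ c ∷ con 1 :+ c :≤ u ∷ [] , km :+ lm :+ con 2 :≤ u)
          (chain-growth k ≤-refl) (chain<U ≤-refl)

        -- A step that adds at most m makes jB - lB a 2-fragment with boundary m = |B| - 1. It is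
        -- co-small because a further step, adding at least m ≥ 1 elements, still misses `c`; hence
        -- the restriction to j < k.
        chain-strict-growth : ∀ j → j < k →
          j * suc m + (l * m + 1) ≤ card (chain l B j) ⊎ ∃ (Fragment 2 U B m)
        chain-strict-growth zero    j<k = inj₁ (chain-growth zero z≤n)
        chain-strict-growth (suc j) j+1<k with chain-strict-growth j (<⇒≤ j+1<k)
        ... | inj₂ F = inj₂ F
        ... | inj₁ le with card (chain l B j) + suc m ≤? card (chain l B (suc j))
        ...   | yes grows = inj₁ (linarith (m ∷ j * suc m ∷ l * m ∷ card (chain l B j) ∷ card (chain l B (suc j)) ∷ [])
            (λ m jm lm i i′ → jm :+ (lm :+ con 1) :≤ i ∷ i :+ (con 1 :+ m) :≤ i′ ∷ [] , con 1 :+ m :+ jm :+ (lm :+ con 1) :≤ i′)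
            le grows)
        ...   | no stalls = inj₂ (chain l B j , fragment (chain-⊆ j)
            (linarith (card (chain l B j) ∷ j * m ∷ l * m ∷ [])
              (λ c jm lm → jm :+ (lm :+ con 1) :≤ c ∷ con 1 :≤ lm ∷ [] , con 2 :≤ c)
              (chain-growth j (<⇒≤ (<⇒≤ j+1<k))) (*-mono-≤ 1≤l 1≤m))
            (linarith (card (chain l B (suc j)) ∷ card (chain l B (suc (suc j))) ∷ m ∷ card U ∷ [])
              (λ c c′ m u → c :+ m :≤ c′ ∷ con 1 :+ c′ :≤ u ∷ con 1 :≤ m ∷ [] , con 2 :+ c :≤ u)
              (kneser-step (chain-⊆ (suc j)) (𝟘∈chain (suc j)) (chain<U j+1<k)) (chain<U j+1<k) 1≤m)
            (linarith (card (chain l B (suc j)) ∷ card (chain l B j) ∷ m ∷ [])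
              (λ c′ c m → con 1 :+ c′ :≤ c :+ (con 1 :+ m) ∷ [] , c′ :≤ c :+ m) (≰⇒> stalls)))

        -- The count is lm + 1 for -lB, m + 1 for each of k - 1 steps, m for the last one, and 1 for
        -- the missed point `c`.
        strict-bound : 1 ≤ k → k * m + l * m + suc k ≤ card U ⊎ NearlyPeriodic U B
        strict-bound (s≤s {n = k′} z≤n) with chain-strict-growth k′ ≤-refl
        ... | inj₁ le = inj₁ (linarith (k′ ∷ m ∷ k′ * suc m ∷ k′ * m ∷ l * m ∷ card (chain l B k′) ∷ card (chain l B (suc k′)) ∷ card U ∷ [])
            (λ k m ksm km lm c c′ u → ksm :+ (lm :+ con 1) :≤ c ∷ c :+ m :≤ c′ ∷ con 1 :+ c′ :≤ u ∷ k :+ km :≤ ksm ∷ [] ,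
              m :+ km :+ lm :+ (con 2 :+ k) :≤ u)
            le (kneser-step (chain-⊆ k′) (𝟘∈chain k′) (chain<U ≤-refl)) (chain<U ≤-refl) (≤-reflexive (sym (*-suc k′ m))))
        ... | inj₂ (S , F) with critical-pair (card B) U≤ B⊆U 𝟘∈B 1<B ≤-refl (sym card-B) F
        ...   | inj₁ near = inj₂ near
        ...   | inj₂ (H , dense H≤ H⊆U 1<H H<U few) = ⊥-elim (generates H H≤ (dense-⊇ H≤ 1<H few) H⊆U H<U)

      -- `E` holds the elements from which adding x leaves B. It is a single point y, since an empty
      -- `E` would make x a period of B - B. Elements of B outside y + Q therefore fill whole cosets
      -- of Q, so Q + B has few holes and B ⊆ Q. Every element of B then reaches y by steps of x
      -- inside B.
      progression : ∀ {Q} → (near : NearlyPeriodic U B) → Subgroup Q → Cyclic (proj₁ near) Q →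
        U ⊆ Q × ∃ λ y → ∀ i → i ≤ m → y ⊖ (i ×ᵍ proj₁ near) ∈ B
      progression {Q} (x , x∈U , x≢𝟘 , near) Q≤ (multiple , multiple⁻) = U⊆Q , y , segment
        where
        E : FSet N
        E = B ∖ ((⊝ x) ▹ B)
        ∈E⁺ : ∀ {z} → z ∈ B → z ⊕ x ∉ B → z ∈ E
        ∈E⁺ {z} p q = ∈∖⁺ p λ r → q (subst (_∈ B) (group (z ∷ x ∷ []) (λ z x → z :⊖ :⊝ x :≈ z :⊕ x) refl) (∈▹⁻ r))
        ∈E⁻ : ∀ {z} → z ∈ E → z ∈ B × z ⊕ x ∉ B
        ∈E⁻ {z} p = let q , r = ∈∖⁻ p in q , λ s → r (∈▹⁺ (subst (_∈ B) (group (z ∷ x ∷ []) (λ z x → z :⊕ x :≈ z :⊖ :⊝ x) refl) s))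
        E≤1 : card E ≤ 1
        E≤1 = linarith (card B ∷ card (x ▹ E) ∷ card E ∷ card (B ∪ (x ▹ B)) ∷ [])
          (λ b xe e u → b :+ xe :≤ u ∷ u :≤ con 1 :+ b ∷ e :≤ xe ∷ [] , e :≤ con 1)
          (card-disjoint (λ i → ∈∪⁺ˡ) (λ i p → ∈∪⁺ʳ (∈▹⁺ (proj₁ (∈E⁻ (∈▹⁻ p)))))
            λ i p q → proj₂ (∈E⁻ (∈▹⁻ q)) (subst (_∈ B) (sym (⊖⊕ i x)) p))
          near (≤-reflexive (sym (card-▹ x E)))

        -- The only place where B can be left when stepping by x.
        exit : ∃ λ y → y ∈ E
        exit with any? (_∈? E)
        ... | yes p = p
        ... | no none = ⊥-elim (aperiodic x x≢𝟘 λ {b} {c} b∈B c∈B →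
            b ⊕ x , c , stays b∈B , c∈B , group (b ∷ c ∷ x ∷ []) (λ b c x → (b :⊕ x) :⊖ c :≈ (b :⊖ c) :⊕ x) refl)
          where
          stays : ∀ {b} → b ∈ B → b ⊕ x ∈ B
          stays {b} p with b ⊕ x ∈? B
          ... | yes q = q
          ... | no ¬q = ⊥-elim (none (b , ∈E⁺ p ¬q))

        y : Fin N
        y = proj₁ exit

        stays : ∀ {b} → b ∈ B → b ≢ y → b ⊕ x ∈ B
        stays {b} p b≢y with b ⊕ x ∈? B
        ... | yes q = q
        ... | no ¬q = ⊥-elim (<⇒≱ (∃≢⇒1<card (∈E⁺ p ¬q) (proj₂ exit) b≢y) E≤1)

        forever : ∀ {b} → b ∈ B → b ∉ y ▹ Q → ∀ j → b ⊕ (j ×ᵍ x) ∈ B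
        forever {b} p out zero = subst (_∈ B) (group (b ∷ []) (λ b → b :≈ b :⊕ :𝟘) refl) p
        forever {b} p out (suc j) = subst (_∈ B)
          (group (b ∷ x ∷ j ×ᵍ x ∷ []) (λ b x u → (b :⊕ u) :⊕ x :≈ b :⊕ (x :⊕ u)) refl)
          (stays (forever p out j) λ e → out (∈▹⁺ (subst (_∈ Q)
            (trans (group (b ∷ j ×ᵍ x ∷ []) (λ b u → :⊝ u :≈ b :⊖ (b :⊕ u)) refl) (cong (b ⊖_) e))
            (⊝-closed Q≤ (multiple j)))))

        1<Q : 1 < card Q
        1<Q = ∃≢⇒1<card (subst (_∈ Q) (group (x ∷ []) (λ x → x :⊕ :𝟘 :≈ x) refl) (multiple 1)) (multiple 0) x≢𝟘

        Q-few : card (Q ⊞ B) < card Q + card B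
        Q-few = linarith (card (Q ⊞ B) ∷ card Q ∷ card B ∷ card (B ∖ (y ▹ Q)) ∷ card (B ∩ (y ▹ Q)) ∷ [])
          (λ qb q b d i → qb :≤ q :+ d ∷ i :+ d :≤ b ∷ con 1 :≤ i ∷ [] , con 1 :+ qb :≤ q :+ b)
          (subst (λ c → card (Q ⊞ B) ≤ c + card (B ∖ (y ▹ Q))) (card-▹ y Q) (card-⊆-∪ cover))
          (≤-reflexive (card-∩-∖ B (y ▹ Q)))
          (∈⇒0<card (∈∩⁺ (proj₁ (∈E⁻ (proj₂ exit))) (coset-refl Q≤)))
          where
          cover : Q ⊞ B ⊆ (y ▹ Q) ∪ (B ∖ (y ▹ Q))
          cover z p with q , b , q∈Q , b∈B , refl ← ∈⊞⁻ p with b ∈? y ▹ Q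
          ... | yes b∈ = ∈∪⁺ˡ (∈▹⁺ (subst (_∈ Q) (group (q ∷ b ∷ y ∷ []) (λ q b y → q :⊕ (b :⊖ y) :≈ (q :⊕ b) :⊖ y) refl)
                            (⊕-closed Q≤ q∈Q (∈▹⁻ b∈))))
          ... | no b∉ with j , refl ← multiple⁻ q q∈Q = ∈∪⁺ʳ (∈∖⁺
            (subst (_∈ B) (group (b ∷ j ×ᵍ x ∷ []) (λ b u → b :⊕ u :≈ u :⊕ b) refl) (forever b∈B b∉ j))
            λ r → b∉ (∈▹⁺ (subst (_∈ Q)
              (group (j ×ᵍ x ∷ b ∷ y ∷ []) (λ u b y → ((u :⊕ b) :⊖ y) :⊖ u :≈ b :⊖ y) refl)
              (⊖-closed Q≤ (∈▹⁻ r) q∈Q))))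

        B⊆Q : B ⊆ Q
        B⊆Q = dense-⊇ Q≤ 1<Q Q-few

        U⊆Q : U ⊆ Q
        U⊆Q z z∈U with card (Q ∩ U) <? card U
        ... | no ≮ = proj₁ (∈∩⁻ (⊆-card⇒⊇ (λ i p → proj₂ (∈∩⁻ p)) (≮⇒≥ ≮) z z∈U))
        ... | yes lt = ⊥-elim (generates (Q ∩ U) (record
            { has-𝟘    = ∈∩⁺ (has-𝟘 Q≤) (has-𝟘 U≤)
            ; ⊖-closed = λ p q → ∈∩⁺ (⊖-closed Q≤ (proj₁ (∈∩⁻ p)) (proj₁ (∈∩⁻ q)))
                                     (⊖-closed U≤ (proj₂ (∈∩⁻ p)) (proj₂ (∈∩⁻ q))) })
            (λ i p → ∈∩⁺ (B⊆Q i p) (B⊆U i p)) (λ i p → proj₂ (∈∩⁻ p)) lt)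

        path : ∀ j {b} → b ∈ B → b ⊕ (j ×ᵍ x) ≡ y →
          ∃ λ i → b ⊕ (i ×ᵍ x) ≡ y × ∀ i′ → i′ ≤ i → b ⊕ (i′ ×ᵍ x) ∈ B
        path zero {b} b∈B e = 0 , e , λ where
          zero _ → subst (_∈ B) (group (b ∷ []) (λ b → b :≈ b :⊕ :𝟘) refl) b∈B
        path (suc j) {b} b∈B e with b ≟ᶠ y
        ... | yes refl = 0 , group (b ∷ []) (λ b → b :⊕ :𝟘 :≈ b) refl , λ where
          zero _ → subst (_∈ B) (group (b ∷ []) (λ b → b :≈ b :⊕ :𝟘) refl) b∈B
        ... | no b≢y with i , e′ , inB ← path j (stays b∈B b≢y)
                (trans (group (b ∷ x ∷ j ×ᵍ x ∷ []) (λ b x u → (b :⊕ x) :⊕ u :≈ b :⊕ (x :⊕ u)) refl) e) =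
          suc i , trans (group (b ∷ x ∷ i ×ᵍ x ∷ []) (λ b x u → b :⊕ (x :⊕ u) :≈ (b :⊕ x) :⊕ u) refl) e′ , λ where
            zero _ → subst (_∈ B) (group (b ∷ []) (λ b → b :≈ b :⊕ :𝟘) refl) b∈B
            (suc i′) (s≤s i′≤i) → subst (_∈ B)
              (group (b ∷ x ∷ i′ ×ᵍ x ∷ []) (λ b x u → (b :⊕ x) :⊕ u :≈ b :⊕ (x :⊕ u)) refl) (inB i′ i′≤i)

        -- The points y, y - x, ..., y - (i - 1)x, starting from the empty set in the form B ∖ B.
        Seg : ℕ → FSet N
        Seg zero    = B ∖ B
        Seg (suc i) = Seg i ∪ ⁅ y ⊖ (i ×ᵍ x) ⁆

        card-Seg : ∀ i → card (Seg i) ≤ i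
        card-Seg zero    = ≤-reflexive (card-∅ (B ∖ B) λ i p → proj₂ (∈∖⁻ p) (proj₁ (∈∖⁻ p)))
        card-Seg (suc i) = ≤-trans (card-⊆-∪ λ _ p → p)
          (≤-trans (+-mono-≤ (card-Seg i) (≤-reflexive (card-⁅⁆ _))) (≤-reflexive (+-comm i 1)))

        ∈Seg : ∀ {i j} → j < i → y ⊖ (j ×ᵍ x) ∈ Seg i
        ∈Seg {suc i} {j} (s≤s j≤i) with m≤n⇒m<n∨m≡n j≤i
        ... | inj₁ lt   = ∈∪⁺ˡ (∈Seg lt)
        ... | inj₂ refl = ∈∪⁺ʳ (∈⁅⁆⁺ refl)

        split-path : ∀ {i i′ b} → i ≤ i′ → b ⊕ (i′ ×ᵍ x) ≡ y → b ⊕ ((i′ ∸ i) ×ᵍ x) ≡ y ⊖ (i ×ᵍ x)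
        split-path {i} {i′} {b} i≤i′ e = begin
          b ⊕ ((i′ ∸ i) ×ᵍ x)                               ≡⟨ group (b ∷ (i′ ∸ i) ×ᵍ x ∷ i ×ᵍ x ∷ []) (λ b u v → b :⊕ u :≈ (b :⊕ (u :⊕ v)) :⊖ v) refl ⟩
          (b ⊕ (((i′ ∸ i) ×ᵍ x) ⊕ (i ×ᵍ x))) ⊖ (i ×ᵍ x)     ≡⟨ cong (λ u → (b ⊕ u) ⊖ (i ×ᵍ x)) (×ᵍ-+ (i′ ∸ i) i x) ⟨
          (b ⊕ ((i′ ∸ i + i) ×ᵍ x)) ⊖ (i ×ᵍ x)              ≡⟨ cong (λ u → (b ⊕ (u ×ᵍ x)) ⊖ (i ×ᵍ x)) (m∸n+n≡m i≤i′) ⟩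
          (b ⊕ (i′ ×ᵍ x)) ⊖ (i ×ᵍ x)                        ≡⟨ cong (_⊖ (i ×ᵍ x)) e ⟩
          y ⊖ (i ×ᵍ x)                                      ∎
          where open ≡-Reasoning

        segment : ∀ i → i ≤ m → y ⊖ (i ×ᵍ x) ∈ B
        segment i i≤m =
          -- As |Seg i| ≤ i ≤ m < |B|, some b in B lies outside it. Its path to y has at least i
          -- steps and so passes through y - ix.
          let b , b∈B , b∉Seg = card<⇒∃ {X = Seg i} {B} (subst (card (Seg i) <_) (sym card-B) (s≤s (≤-trans (card-Seg i) i≤m)))
              j , e = multiple⁻ (y ⊖ b) (⊖-closed Q≤ (B⊆Q y (proj₁ (∈E⁻ (proj₂ exit)))) (B⊆Q b b∈B))
              i′ , e′ , inB = path j b∈B (trans (cong (b ⊕_) (sym e)) (group (b ∷ y ∷ []) (λ b y → b :⊕ (y :⊖ b) :≈ y) refl))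
          in reach b∉Seg e′ inB (i ≤? i′)
          where
          reach : ∀ {b i′} → b ∉ Seg i → b ⊕ (i′ ×ᵍ x) ≡ y → (∀ i″ → i″ ≤ i′ → b ⊕ (i″ ×ᵍ x) ∈ B) →
            Dec (i ≤ i′) → y ⊖ (i ×ᵍ x) ∈ B
          reach {b} {i′} b∉Seg e′ inB (no i≰i′) = ⊥-elim (b∉Seg (subst (_∈ Seg i)
            (trans (cong (_⊖ (i′ ×ᵍ x)) (sym e′)) (group (b ∷ i′ ×ᵍ x ∷ []) (λ b u → (b :⊕ u) :⊖ u :≈ b) refl))
            (∈Seg (≰⇒> i≰i′))))
          reach {b} {i′} b∉Seg e′ inB (yes i≤i′) =
            subst (_∈ B) (split-path {i} {i′} {b} i≤i′ e′) (inB (i′ ∸ i) (m∸n≤m i′ i))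

  -- Irreducible sum-free sets and their possible shapes

  iter-translate : ∀ a {A B} → (∀ b → b ∈ A → b ⊕ a ∈ B) → ∀ j z → z ∈ iter j A → z ⊕ (j ×ᵍ a) ∈ iter j B
  iter-translate a {A} {B} A→B zero    z p = ∈⁅⁆⁺ (trans (cong (_⊕ 𝟘) (∈⁅⁆⁻ p)) (group [] (:𝟘 :⊕ :𝟘 :≈ :𝟘) refl))
  iter-translate a {A} {B} A→B (suc j) z p with s , b , s∈ , b∈ , refl ← ∈⊞⁻ p = subst (_∈ iter (suc j) B)
    (group (s ∷ b ∷ a ∷ j ×ᵍ a ∷ []) (λ s b a u → (s :⊕ u) :⊕ (b :⊕ a) :≈ (s :⊕ b) :⊕ (a :⊕ u)) refl)
    (∈⊞⁺ (iter-translate a A→B j s s∈) (A→B b b∈))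

  chain⁻ : ∀ {l B} j {z} → z ∈ chain l B j → ∃₂ λ w v → w ∈ iter j B × v ∈ iter l B × z ≡ w ⊖ v
  chain⁻ zero {z} p = 𝟘 , ⊝ z , ∈⁅⁆⁺ refl , ∈⊟⁻ p , group (z ∷ []) (λ z → z :≈ :𝟘 :⊖ :⊝ z) refl
  chain⁻ (suc j) p with s , b , s∈ , b∈ , refl ← ∈⊞⁻ p with w , v , w∈ , v∈ , refl ← chain⁻ j s∈ =
    w ⊕ b , v , ∈⊞⁺ w∈ b∈ , v∈ , group (w ∷ v ∷ b ∷ []) (λ w v b → (w :⊖ v) :⊕ b :≈ (w :⊕ b) :⊖ v) refl

  iter-progression : ∀ {A a x m} → (∀ i → i ≤ m → a ⊖ (i ×ᵍ x) ∈ A) →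
    ∀ j i → i ≤ j * m → (j ×ᵍ a) ⊖ (i ×ᵍ x) ∈ iter j A
  iter-progression inA zero zero i≤ = ∈⁅⁆⁺ (group [] (:𝟘 :⊖ :𝟘 :≈ :𝟘) refl)
  iter-progression {A} {a} {x} {m} inA (suc j) i i≤ with i ≤? j * m
  ... | yes le = subst (_∈ iter (suc j) A)
          (group (j ×ᵍ a ∷ i ×ᵍ x ∷ a ∷ []) (λ u v a → (u :⊖ v) :⊕ (a :⊖ :𝟘) :≈ (a :⊕ u) :⊖ v) refl)
          (∈⊞⁺ (iter-progression inA j i le) (inA 0 z≤n))
  ... | no gt = subst (_∈ iter (suc j) A) (begin
          ((j ×ᵍ a) ⊖ ((j * m) ×ᵍ x)) ⊕ (a ⊖ ((i ∸ j * m) ×ᵍ x))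
            ≡⟨ group (j ×ᵍ a ∷ (j * m) ×ᵍ x ∷ a ∷ (i ∸ j * m) ×ᵍ x ∷ []) (λ u v a w → (u :⊖ v) :⊕ (a :⊖ w) :≈ (a :⊕ u) :⊖ (w :⊕ v)) refl ⟩
          (a ⊕ (j ×ᵍ a)) ⊖ (((i ∸ j * m) ×ᵍ x) ⊕ ((j * m) ×ᵍ x))
            ≡⟨ cong ((a ⊕ (j ×ᵍ a)) ⊖_) (×ᵍ-+ (i ∸ j * m) (j * m) x) ⟨
          (a ⊕ (j ×ᵍ a)) ⊖ ((i ∸ j * m + j * m) ×ᵍ x)
            ≡⟨ cong (λ n → (a ⊕ (j ×ᵍ a)) ⊖ (n ×ᵍ x)) (m∸n+n≡m (<⇒≤ (≰⇒> gt))) ⟩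
          (suc j ×ᵍ a) ⊖ (i ×ᵍ x) ∎)
          (∈⊞⁺ (iter-progression inA j (j * m) ≤-refl) (inA (i ∸ j * m) (m≤n+o⇒m∸n≤o i (j * m) (≤-trans i≤ (≤-reflexive (+-comm m (j * m)))))))
    where open ≡-Reasoning

  periodic-× : ∀ {A x} → DifferencesPeriodic A x → ∀ j → DifferencesPeriodic A (j ×ᵍ x)
  periodic-× dp zero {b} {c} b∈ c∈ = b , c , b∈ , c∈ , group (b ∷ c ∷ []) (λ b c → b :⊖ c :≈ (b :⊖ c) :⊕ :𝟘) refl
  periodic-× {A} {x} dp (suc j) {b} {c} b∈ c∈
    with u , v , u∈ , v∈ , e ← periodic-× dp j b∈ c∈ with u′ , v′ , u′∈ , v′∈ , e′ ← dp u∈ v∈ =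
    u′ , v′ , u′∈ , v′∈ , trans e′ (trans (cong (_⊕ x) e)
      (group (b ∷ c ∷ j ×ᵍ x ∷ x ∷ []) (λ b c u x → ((b :⊖ c) :⊕ u) :⊕ x :≈ (b :⊖ c) :⊕ (x :⊕ u)) refl))

  proper-subgroup : ∀ {U} → Subgroup U → card U < N → card U + card U ≤ N
  proper-subgroup {U} U≤ lt with z , _ , z∉U ← card<⇒∃ {X = U} {full} (subst (card U <_) (sym (card-full N)) lt) =
    subst₂ (λ u n → card U + u ≤ n) (card-▹ z U) (card-full N)
      (card-disjoint {Z = full} (λ _ _ → ∈full) (λ _ _ → ∈full) λ i p q → z∉U (subst (_∈ U)
        (group (i ∷ z ∷ []) (λ i z → i :⊖ (i :⊖ z) :≈ z) refl) (⊖-closed U≤ p (∈▹⁻ q))))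

  SumFree′ : ℕ → ℕ → FSet N → Set
  SumFree′ k l A = ∀ z → z ∈ iter k A → z ∈ iter l A → ⊥

  -- The image of A modulo the subgroup generated by x is still (k, l)-sum-free.
  Reducible : ℕ → ℕ → FSet N → Fin N → Set
  Reducible k l A x = ∀ j {z w} → z ∈ iter k A → w ∈ iter l A → z ≢ w ⊕ (j ×ᵍ x)

  -- Writing c - b + jx = u - v turns s + b = t + c + jx into s + v = t + u, a forbidden equality.
  periodic⇒reducible : ∀ {A x k l} → DifferencesPeriodic A x → 1 ≤ k → 1 ≤ l → SumFree′ k l A → Reducible k l A x
  periodic⇒reducible {A} {x} {suc k} {suc l} dp _ _ sf j z∈ w∈ e
    with s , b , s∈ , b∈ , refl ← ∈⊞⁻ z∈ with t , c , t∈ , c∈ , refl ← ∈⊞⁻ w∈ = finish (periodic-× dp j c∈ b∈)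
    where
    open ≡-Reasoning
    finish : (∃₂ λ u v → u ∈ A × v ∈ A × u ⊖ v ≡ (c ⊖ b) ⊕ (j ×ᵍ x)) → ⊥
    finish (u , v , u∈ , v∈ , e′) = sf (s ⊕ v) (∈⊞⁺ s∈ v∈) (subst (_∈ iter (suc l) A) (begin
      t ⊕ u                              ≡⟨ group (t ∷ u ∷ v ∷ []) (λ t u v → t :⊕ u :≈ (t :⊕ (u :⊖ v)) :⊕ v) refl ⟩
      (t ⊕ (u ⊖ v)) ⊕ v                  ≡⟨ cong (λ y → (t ⊕ y) ⊕ v) e′ ⟩
      (t ⊕ ((c ⊖ b) ⊕ (j ×ᵍ x))) ⊕ v     ≡⟨ group (t ∷ c ∷ b ∷ j ×ᵍ x ∷ v ∷ []) (λ t c b u v → (t :⊕ ((c :⊖ b) :⊕ u)) :⊕ v :≈ (((t :⊕ c) :⊕ u) :⊖ b) :⊕ v) refl ⟩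
      (((t ⊕ c) ⊕ (j ×ᵍ x)) ⊖ b) ⊕ v     ≡⟨ cong (λ y → (y ⊖ b) ⊕ v) e ⟨
      ((s ⊕ b) ⊖ b) ⊕ v                  ≡⟨ group (s ∷ b ∷ v ∷ []) (λ s b v → ((s :⊕ b) :⊖ b) :⊕ v :≈ s :⊕ v) refl ⟩
      s ⊕ v                              ∎)
      (∈⊞⁺ t∈ u∈))

  module _ {k l : ℕ} (1≤k : 1 ≤ k) (1≤l : 1 ≤ l) {A : FSet N} (sum-free : SumFree′ k l A)
    (irreducible : ∀ x → x ≢ 𝟘 → ¬ Reducible k l A x)
    (cyclic : ∀ x → ∃ λ Q → Subgroup Q × Cyclic x Q)
    {a₀ : Fin N} (a₀∈A : a₀ ∈ A) {m : ℕ} (card-A : card A ≡ suc m) (1≤m : 1 ≤ m) where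

    private
      B : FSet N
      B = (⊝ a₀) ▹ A
      -- Translation by -a₀ turns 0 ∉ kA - lA into c ∉ kB - lB.
      c : Fin N
      c = (l ×ᵍ a₀) ⊖ (k ×ᵍ a₀)

      A→B : ∀ a → a ∈ A → a ⊕ (⊝ a₀) ∈ B
      A→B a = ∈▹⁺⊕
      B→A : ∀ b → b ∈ B → b ⊕ a₀ ∈ A
      B→A b p = subst (_∈ A) (group (b ∷ a₀ ∷ []) (λ b a → b :⊖ :⊝ a :≈ b :⊕ a) refl) (∈▹⁻ p)

      𝟘∈B : 𝟘 ∈ B
      𝟘∈B = subst (_∈ B) (group (a₀ ∷ []) (λ a → a :⊖ a :≈ :𝟘) refl) (A→B a₀ a₀∈A)

      card-B : card B ≡ suc m
      card-B = trans (card-▹ (⊝ a₀) A) card-A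

      ×ᵍ-⊝ : ∀ j x → j ×ᵍ (⊝ x) ≡ ⊝ (j ×ᵍ x)
      ×ᵍ-⊝ zero    x = group [] (:𝟘 :≈ :⊝ :𝟘) refl
      ×ᵍ-⊝ (suc j) x = trans (cong ((⊝ x) ⊕_) (×ᵍ-⊝ j x))
        (group (x ∷ j ×ᵍ x ∷ []) (λ x u → :⊝ x :⊕ :⊝ u :≈ :⊝ (x :⊕ u)) refl)

      c∉chain : c ∉ chain l B k
      c∉chain p with w , v , w∈ , v∈ , e ← chain⁻ {l} k p = sum-free (w ⊕ (k ×ᵍ a₀))
        (iter-translate a₀ B→A k w w∈)
        (subst (_∈ iter l A) (begin
          v ⊕ (l ×ᵍ a₀)                      ≡⟨ group (v ∷ l ×ᵍ a₀ ∷ k ×ᵍ a₀ ∷ []) (λ v l k → v :⊕ l :≈ (v :⊕ (l :⊖ k)) :⊕ k) refl ⟩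
          (v ⊕ c) ⊕ (k ×ᵍ a₀)                ≡⟨ cong (λ u → (v ⊕ u) ⊕ (k ×ᵍ a₀)) e ⟩
          (v ⊕ (w ⊖ v)) ⊕ (k ×ᵍ a₀)          ≡⟨ group (v ∷ w ∷ k ×ᵍ a₀ ∷ []) (λ v w k → (v :⊕ (w :⊖ v)) :⊕ k :≈ w :⊕ k) refl ⟩
          w ⊕ (k ×ᵍ a₀)                      ∎)
          (iter-translate a₀ B→A l v v∈))
        where open ≡-Reasoning

      aperiodic : Aperiodic B
      aperiodic x x≢𝟘 dp = irreducible x x≢𝟘 (periodic⇒reducible dpA 1≤k 1≤l sum-free)
        where
        dpA : DifferencesPeriodic A x
        dpA {b} {c} b∈ c∈ with u , v , u∈ , v∈ , e ← dp (A→B b b∈) (A→B c c∈) =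
          u ⊕ a₀ , v ⊕ a₀ , B→A u u∈ , B→A v v∈ ,
          trans (group (u ∷ v ∷ a₀ ∷ []) (λ u v a → (u :⊕ a) :⊖ (v :⊕ a) :≈ u :⊖ v) refl)
            (trans e (group (b ∷ c ∷ a₀ ∷ x ∷ []) (λ b c a x → ((b :⊖ a) :⊖ (c :⊖ a)) :⊕ x :≈ (b :⊖ c) :⊕ x) refl))

      -- kA and lA lie in ka₀ + U and la₀ + U. Were these cosets different, they would stay disjoint
      -- modulo any nonzero x in B ⊆ U, and A would be reducible.
      c∈ : ∀ {U} → Subgroup U → B ⊆ U → Generates B U → c ∈ U
      c∈ {U} U≤ B⊆U gen with c ∈? U
      ... | yes p = p
      ... | no c∉U with x , x∈B , x≢𝟘 ← 1<card⇒∃≢ (1<B 𝟘∈B card-B 1≤m aperiodic) 𝟘 =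
        ⊥-elim (irreducible x x≢𝟘 λ j {z} {w} z∈ w∈ e → c∉U (subst (_∈ U)
          (trans (cong (λ y → ((y ⊕ (k ×ᵍ (⊝ a₀))) ⊖ (w ⊕ (l ×ᵍ (⊝ a₀)))) ⊖ (j ×ᵍ x)) e)
            (trans (cong₂ (λ p q → (((w ⊕ (j ×ᵍ x)) ⊕ p) ⊖ (w ⊕ q)) ⊖ (j ×ᵍ x)) (×ᵍ-⊝ k a₀) (×ᵍ-⊝ l a₀))
              (group (w ∷ j ×ᵍ x ∷ k ×ᵍ a₀ ∷ l ×ᵍ a₀ ∷ []) (λ w x k l → (((w :⊕ x) :⊖ k) :⊖ (w :⊖ l)) :⊖ x :≈ l :⊖ k) refl)))
          (⊖-closed U≤ (⊖-closed U≤
            (iter-⊆ 𝟘∈B card-B 1≤m aperiodic U≤ B⊆U gen k _ (iter-translate (⊝ a₀) A→B k z z∈))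
            (iter-⊆ 𝟘∈B card-B 1≤m aperiodic U≤ B⊆U gen l _ (iter-translate (⊝ a₀) A→B l w w∈)))
            (multiples U≤ (B⊆U x x∈B) j))))
        where
        multiples : ∀ {U x} → Subgroup U → x ∈ U → ∀ j → j ×ᵍ x ∈ U
        multiples U≤ x∈U zero    = has-𝟘 U≤
        multiples U≤ x∈U (suc j) = ⊕-closed U≤ x∈U (multiples U≤ x∈U j)

    -- The bounds are lower bounds for |kA − lA| + 1 in the subgroup generated by A − a₀, which is proper in the first
    -- case; in the second, each of the k − 1 non-final steps from −lA to kA − lA gains one more element than m.
    data Outcome : Set where
      proper-bound : ∀ {u : ℕ} → k * m + l * m + 2 ≤ u → u + u ≤ N → Outcome
      strict       : k * m + l * m + suc k ≤ N → Outcome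
      progression′ : ∀ {x a} → (∀ z → ∃ λ j → z ≡ j ×ᵍ x) → (∀ i → i ≤ m → a ⊖ (i ×ᵍ x) ∈ A) → Outcome

    generated : ∀ {U Q x} → ¬ card U < N → Cyclic x Q →
      (U ⊆ Q × ∃ λ y → ∀ i → i ≤ m → y ⊖ (i ×ᵍ x) ∈ (⊝ a₀) ▹ A) → Outcome
    generated {U} {Q} {x} ≮ cyc (U⊆Q , y , seg) = progression′ {x} {y ⊕ a₀}
      (λ z → proj₂ cyc z (U⊆Q z (⊆-card⇒⊇ {Y = full} (λ _ _ → ∈full) (≤-trans (≤-reflexive (card-full N)) (≮⇒≥ ≮)) z ∈full)))
      λ i i≤m → subst (_∈ A) (group (y ∷ i ×ᵍ x ∷ a₀ ∷ []) (λ y u a → (y :⊖ u) :⊕ a :≈ (y :⊕ a) :⊖ u) refl)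
        (B→A _ (seg i i≤m))

    outcome : (Outcome → ⊥) → ⊥
    outcome impossible = generated-subgroup N full
      (record { has-𝟘 = ∈full ; ⊖-closed = λ _ _ → ∈full }) (λ _ _ → ∈full) (card≤ full) conclude
      where
      conclude : ∀ U → Subgroup U → B ⊆ U → Generates B U → ⊥
      conclude U U≤ B⊆U gen = by-size (card U <? N)
        where
        c∈U : c ∈ U
        c∈U = c∈ U≤ B⊆U gen
        by-near : ¬ card U < N → NearlyPeriodic U B → ⊥
        by-near ≮ near = let Q , Q≤ , cyc = cyclic (proj₁ near) in
          impossible (generated ≮ cyc (progression 𝟘∈B card-B 1≤m aperiodic U≤ B⊆U gen near Q≤ cyc))
        by-size : Dec (card U < N) → ⊥
        by-size (yes lt) = impossible (proper-bound
          (kneser-bound 𝟘∈B card-B 1≤m aperiodic U≤ B⊆U gen k l c∈U c∉chain 1≤l) (proper-subgroup U≤ lt))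
        by-size (no ≮) = [ (λ le → impossible (strict (≤-trans le (card≤ U)))) , by-near ≮ ]′
          (strict-bound 𝟘∈B card-B 1≤m aperiodic U≤ B⊆U gen k l c∈U c∉chain 1≤l 1≤k)

-- The size formula

ceilDiv-≤ : ∀ {a m} s .{{_ : NonZero s}} → a ≤ s * m → ceilDiv a s ≤ m
ceilDiv-≤ {a} {m} s@(suc s′) a≤ = <⇒≤pred (m<n*o⇒m/o<n {n = suc m} {o = s} (begin-strict
  a + s′       ≤⟨ +-monoˡ-≤ s′ a≤ ⟩
  s * m + s′   <⟨ n<1+n _ ⟩
  suc (s * m + s′) ≡⟨ lemma s′ m ⟩
  suc m * s    ∎))
  where
  open ≤-Reasoning
  lemma : ∀ s m → suc (suc s * m + s) ≡ suc m * suc s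
  lemma = solve-∀

ceilDiv-> : ∀ {a m} s .{{_ : NonZero s}} → s * m < a → m < ceilDiv a s
ceilDiv-> {a} {m} s@(suc s′) <a = begin
  suc m               ≡⟨ m*n/n≡m (suc m) s ⟨
  suc m * s / s       ≤⟨ /-monoˡ-≤ s (linarith (a ∷ s * m ∷ suc m * s ∷ s′ ∷ [])
                           (λ a x y s → con 1 :+ x :≤ a ∷ y :≤ con 1 :+ s :+ x ∷ [] , y :≤ a :+ s)
                           <a (≤-reflexive (lemma s′ m))) ⟩
  (a + s′) / s        ∎
  where
  open ≤-Reasoning
  lemma : ∀ s m → suc m * suc s ≡ suc s + suc s * m
  lemma = solve-∀

<-ceilDiv : ∀ {a m} s .{{_ : NonZero s}} → m < ceilDiv a s → s * m < a
<-ceilDiv {a} {m} s lt = ≰⇒> λ a≤ → <⇒≱ lt (ceilDiv-≤ s a≤)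

ceilDiv-* : ∀ e d .{{_ : NonZero d}} → ceilDiv (e * d) d ≡ e
ceilDiv-* e d@(suc d′) = ≤-antisym (ceilDiv-≤ d (≤-reflexive (*-comm e d)))
  (subst (_≤ ceilDiv (e * d) d) (m*n/n≡m e d) (/-monoˡ-≤ d (m≤m+n (e * d) d′)))

-- The first factor of `term`, with δ as a parameter. For δ = gcd(d, k - l) it is the largest size
-- of a sum-free progression of difference 1 in ℤ_d, by `gap⇒size` and `size⇒gap`.
progressionSize : (k l d δ : ℕ) → ℕ
progressionSize k l d δ = ceilDiv (d ∸ (δ ∸ modN (l * ceilDiv (d ∸ δ) (k + l)) δ)) (k + l)

∸-lemma : ∀ {d δ r} → r < δ → δ ≤ d → (d ∸ (δ ∸ r)) + δ ≡ d + r
∸-lemma {d} {δ} {r} r<δ δ≤d = begin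
  (d ∸ (δ ∸ r)) + δ             ≡⟨ cong ((d ∸ (δ ∸ r)) +_) (m∸n+n≡m (<⇒≤ r<δ)) ⟨
  (d ∸ (δ ∸ r)) + ((δ ∸ r) + r) ≡⟨ +-assoc _ (δ ∸ r) r ⟨
  (d ∸ (δ ∸ r)) + (δ ∸ r) + r   ≡⟨ cong (_+ r) (m∸n+n≡m (≤-trans (m∸n≤m δ r) δ≤d)) ⟩
  d + r                         ∎
  where open ≡-Reasoning

modN≡% : ∀ a δ .{{_ : NonZero δ}} → modN a δ ≡ a % δ
modN≡% a (suc _) = refl

module _ {k l d δ : ℕ} .{{_ : NonZero δ}} .{{_ : NonZero (k + l)}} (δ≤d : δ ≤ d) (δ≤k : δ ≤ k) where

  private
    next : ∀ a → a + δ ≡ suc (a / δ) * δ + a % δ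
    next a = trans (cong (_+ δ) (m≡m%n+[m/n]*n a δ)) (lemma (a % δ) (a / δ * δ) δ)
      where
      lemma : ∀ r q δ → r + q + δ ≡ (δ + q) + r
      lemma = solve-∀

    -- When m is the first value for which (k + l)m + δ reaches d, the ceiling inside r is exactly
    -- m. Only in this range does the value of r matter.
    ceil-tight : ∀ m → d ≤ (k + l) * m + δ → (∀ {p} → m ≡ suc p → (k + l) * p + δ < d) →
      progressionSize k l d δ ≡ ceilDiv (d ∸ (δ ∸ (l * m) % δ)) (k + l)
    ceil-tight m upper lower = cong (λ r → ceilDiv (d ∸ (δ ∸ r)) (k + l))
      (trans (modN≡% (l * ceilDiv (d ∸ δ) (k + l)) δ) (cong (λ c → (l * c) % δ) (≤-antisym ≤m (≥m m lower))))
      where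
      ≤m : ceilDiv (d ∸ δ) (k + l) ≤ m
      ≤m = ceilDiv-≤ (k + l) (m≤n+o⇒m∸n≤o d δ (≤-trans upper (≤-reflexive (+-comm _ δ))))
      ≥m : ∀ m → (∀ {p} → m ≡ suc p → (k + l) * p + δ < d) → m ≤ ceilDiv (d ∸ δ) (k + l)
      ≥m zero    _ = z≤n
      ≥m (suc p) f = ceilDiv-> (k + l) (m+n≤o⇒m≤o∸n (suc ((k + l) * p)) (f refl))

    s-split : ∀ m → (k + l) * m ≡ k * m + l * m
    s-split m = *-distribʳ-+ m k l

    s-suc : ∀ p → (k + l) * suc p ≡ (k + l) + (k + l) * p
    s-suc p = *-suc (k + l) p

    remainder : ∀ m → (d ∸ (δ ∸ (l * m) % δ)) + δ ≡ d + (l * m) % δ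
    remainder m = ∸-lemma (m%n<n (l * m) δ) δ≤d

  -- Already d - δ, the numerator for r = 0, exceeds (k + l)m.
  room⇒size : ∀ {m} → (k + l) * m + δ < d → m < progressionSize k l d δ
  room⇒size {m} room = ceilDiv-> (k + l)
    (linarith ((k + l) * m ∷ δ ∷ d ∷ d ∸ (δ ∸ r) ∷ r ∷ [])
      (λ s δ d x r → con 1 :+ (s :+ δ) :≤ d ∷ d :+ r :≤ x :+ δ ∷ [] , con 1 :+ s :≤ x)
      room (≤-reflexive (sym (∸-lemma r<δ δ≤d))))
    where
    r = modN (l * ceilDiv (d ∸ δ) (k + l)) δ
    r<δ : r < δ
    r<δ = subst (_< δ) (sym (modN≡% (l * ceilDiv (d ∸ δ) (k + l)) δ)) (m%n<n _ δ)

  -- For A = {a, …, a + m} modulo d, kA − lA is the interval from y′ − l m to y′ + k m, where y′ = (k − l) a can be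
  -- congruent to any multiple y of δ.
  gap⇒size : ∀ {m y} → δ ∣ y → l * m < y → y + k * m < d → m < progressionSize k l d δ
  gap⇒size {m} (divides t refl) <y y< with (k + l) * m + δ <? d
  ... | yes room = room⇒size room
  -- A multiple of δ above lm is at least (⌊lm/δ⌋ + 1)δ = lm + δ - r, so y + km < d gives (k + l)m <
  -- d - (δ - r).
  ... | no ≮ = subst (m <_) (sym (ceil-tight m (≮⇒≥ ≮) below)) (ceilDiv-> (k + l)
          (linarith ((k + l) * m ∷ k * m ∷ l * m ∷ δ ∷ d ∷ d ∸ (δ ∸ r) ∷ r ∷ t * δ ∷ suc (l * m / δ) * δ ∷ [])
            (λ s km lm δ d x r y z → s :≤ km :+ lm ∷ con 1 :+ (y :+ km) :≤ d ∷ d :+ r :≤ x :+ δ ∷ lm :+ δ :≤ z :+ r ∷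
              z :≤ y ∷ [] , con 1 :+ s :≤ x)
            (≤-reflexive (s-split m)) y< (≤-reflexive (sym (remainder m))) (≤-reflexive (next (l * m)))
            (*-monoˡ-≤ δ (m<n*o⇒m/o<n {n = t} {o = δ} <y))))
    where
    r = (l * m) % δ
    below : ∀ {p} → m ≡ suc p → (k + l) * p + δ < d
    below {p} refl = linarith ((k + l) * suc p ∷ (k + l) * p ∷ k * suc p ∷ l * suc p ∷ k ∷ l ∷ δ ∷ d ∷ t * δ ∷ [])
      (λ s sp km lm k l δ d y → s :≤ km :+ lm ∷ k :+ l :+ sp :≤ s ∷ con 1 :+ lm :≤ y ∷ con 1 :+ (y :+ km) :≤ d ∷ δ :≤ k ∷ [] ,
        con 1 :+ (sp :+ δ) :≤ d)
      (≤-reflexive (s-split (suc p))) (≤-reflexive (sym (s-suc p))) <y y< δ≤k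

  size⇒gap : ∀ {m} → m < progressionSize k l d δ → ∃ λ y → δ ∣ y × l * m < y × y + k * m < d
  size⇒gap {m} fits = y , divides (suc (l * m / δ)) refl ,
    linarith (l * m ∷ δ ∷ y ∷ r ∷ []) (λ lm δ y r → lm :+ δ :≤ y :+ r ∷ con 1 :+ r :≤ δ ∷ [] , con 1 :+ lm :≤ y)
      (≤-reflexive (next (l * m))) (m%n<n (l * m) δ) ,
    upper
    where
    r y : ℕ
    r = (l * m) % δ
    -- The least multiple of δ above lm, equal to lm + δ - r.
    y = suc (l * m / δ) * δ
    upper : y + k * m < d
    upper with (k + l) * m + δ <? d
    ... | yes room = linarith ((k + l) * m ∷ k * m ∷ l * m ∷ δ ∷ d ∷ y ∷ r ∷ [])
          (λ s km lm δ d y r → km :+ lm :≤ s ∷ con 1 :+ (s :+ δ) :≤ d ∷ y :+ r :≤ lm :+ δ ∷ [] , con 1 :+ (y :+ km) :≤ d)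
          (≤-reflexive (sym (s-split m))) room (≤-reflexive (sym (next (l * m))))
    ... | no ≮ = linarith ((k + l) * m ∷ k * m ∷ l * m ∷ δ ∷ d ∷ y ∷ r ∷ d ∸ (δ ∸ r) ∷ [])
          (λ s km lm δ d y r x → km :+ lm :≤ s ∷ con 1 :+ s :≤ x ∷ x :+ δ :≤ d :+ r ∷ y :+ r :≤ lm :+ δ ∷ [] , con 1 :+ (y :+ km) :≤ d)
          (≤-reflexive (sym (s-split m)))
          (<-ceilDiv (k + l) (subst (m <_) (ceil-tight m (≮⇒≥ ≮) below) fits))
          (≤-reflexive (remainder m)) (≤-reflexive (sym (next (l * m))))
      where
      r₀ = modN (l * ceilDiv (d ∸ δ) (k + l)) δ
      r₀<δ : r₀ < δ
      r₀<δ = subst (_< δ) (sym (modN≡% (l * ceilDiv (d ∸ δ) (k + l)) δ)) (m%n<n _ δ)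
      below : ∀ {p} → m ≡ suc p → (k + l) * p + δ < d
      below {p} refl = linarith ((k + l) * suc p ∷ (k + l) * p ∷ k ∷ l ∷ δ ∷ d ∷ r₀ ∷ d ∸ (δ ∸ r₀) ∷ [])
        (λ s sp k l δ d r x → k :+ l :+ sp :≤ s ∷ con 1 :+ s :≤ x ∷ x :+ δ :≤ d :+ r ∷ con 1 :+ r :≤ δ ∷ δ :≤ k ∷ [] ,
          con 1 :+ (sp :+ δ) :≤ d)
        (≤-reflexive (sym (s-suc p))) (<-ceilDiv (k + l) fits) (≤-reflexive (∸-lemma r₀<δ δ≤d)) r₀<δ δ≤k

-- The maximum over divisors

StepSpec : ℕ → (ℕ → ℕ) → ℕ → ℕ → ℕ → Set
StepSpec n f d acc v = (d ∣ n × v ≡ f d ⊔ acc) ⊎ (¬ d ∣ n × v ≡ acc)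

mutual
  -- The step function of maxOverDivisors is local to its definition; unification recovers it.
  divisor-step : ∀ n f .{{_ : NonZero n}} → ∃ λ g → maxOverDivisors n f ≡ foldr g 0 (applyUpTo suc n) ×
    (∀ d acc → StepSpec n f d acc (g d acc))
  -- Deciding 0 ∣ n lets the fold compute past d = 0, leaving the list 1, ..., n.
  divisor-step n f with 0 ∣? n
  ... | yes 0∣n = ⊥-elim (≢-nonZero⁻¹ n (0∣⇒≡0 0∣n))
  ... | no _    = _ , refl , divisor-step-spec n f

  divisor-step-spec : ∀ n f d acc → StepSpec n f d acc _
  divisor-step-spec n f d acc with d ∣? n
  ... | yes p = inj₁ (p , refl)
  ... | no ¬p = inj₂ (¬p , refl)

private
  foldr-upper : ∀ {n f g} → (∀ d acc → StepSpec n f d acc (g d acc)) →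
    ∀ xs {d} → d ∈ᴸ xs → d ∣ n → f d ≤ foldr g 0 xs
  foldr-upper {f = f} spec (x ∷ xs) (here refl) d∣n with spec x (foldr _ 0 xs)
  ... | inj₁ (_ , e) = ≤-trans (m≤m⊔n (f x) _) (≤-reflexive (sym e))
  ... | inj₂ (¬p , _) = ⊥-elim (¬p d∣n)
  foldr-upper {f = f} spec (x ∷ xs) (there d∈) d∣n with spec x (foldr _ 0 xs)
  ... | inj₁ (_ , e) = ≤-trans (foldr-upper spec xs d∈ d∣n) (≤-trans (m≤n⊔m (f x) _) (≤-reflexive (sym e)))
  ... | inj₂ (_ , e) = ≤-trans (foldr-upper spec xs d∈ d∣n) (≤-reflexive (sym e))

  foldr-attained : ∀ {n f g} → (∀ d acc → StepSpec n f d acc (g d acc)) →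
    ∀ xs → foldr g 0 xs ≡ 0 ⊎ ∃ λ d → d ∣ n × foldr g 0 xs ≡ f d
  foldr-attained spec [] = inj₁ refl
  foldr-attained {f = f} spec (x ∷ xs) with spec x (foldr _ 0 xs) | foldr-attained spec xs
  ... | inj₂ (_ , e) | inj₁ z = inj₁ (trans e z)
  ... | inj₂ (_ , e) | inj₂ (d , d∣n , e′) = inj₂ (d , d∣n , trans e e′)
  ... | inj₁ (x∣n , e) | rest with ⊔-sel (f x) (foldr _ 0 xs) | rest
  ...   | inj₁ s | _ = inj₂ (x , x∣n , trans e s)
  ...   | inj₂ s | inj₁ z = inj₁ (trans e (trans s z))
  ...   | inj₂ s | inj₂ (d , d∣n , e′) = inj₂ (d , d∣n , trans e (trans s e′))

≤-maxOverDivisors : ∀ {n d} f .{{_ : NonZero n}} → d ∣ n → f d ≤ maxOverDivisors n f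
≤-maxOverDivisors {n} {zero} f d∣n = ⊥-elim (≢-nonZero⁻¹ n (0∣⇒≡0 d∣n))
≤-maxOverDivisors {n} {suc d} f d∣n = let g , e , spec = divisor-step n f in
  subst (f (suc d) ≤_) (sym e) (foldr-upper spec (applyUpTo suc n) (∈-applyUpTo⁺ suc (∣⇒≤ d∣n)) d∣n)

maxOverDivisors-attained : ∀ n f .{{_ : NonZero n}} →
  maxOverDivisors n f ≡ 0 ⊎ ∃ λ d → d ∣ n × maxOverDivisors n f ≡ f d
maxOverDivisors-attained n f = let g , e , spec = divisor-step n f in
  subst (λ m → m ≡ 0 ⊎ ∃ λ d → d ∣ n × m ≡ f d) (sym e) (foldr-attained spec (applyUpTo suc n))

-- Cyclic groups

module ℤmod (d : ℕ) .{{_ : NonZero d}} where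

  opaque
    [_] : ℕ → Fin d
    [ a ] = a mod d

    toℕ-[] : ∀ a → toℕ [ a ] ≡ a % d
    toℕ-[] a = toℕ-fromℕ< (m%n<n a d)

  []-toℕ : ∀ x → [ toℕ x ] ≡ x
  []-toℕ x = toℕ-injective (trans (toℕ-[] (toℕ x)) (m<n⇒m%n≡m (toℕ<n x)))

  []-cong : ∀ {a b} → a % d ≡ b % d → [ a ] ≡ [ b ]
  []-cong {a} {b} e = toℕ-injective (trans (toℕ-[] a) (trans e (sym (toℕ-[] b))))

  []-injective : ∀ {a b} → [ a ] ≡ [ b ] → a % d ≡ b % d
  []-injective {a} {b} e = trans (sym (toℕ-[] a)) (trans (cong toℕ e) (toℕ-[] b))

  infixl 6 _⊕_
  _⊕_ : Op₂ (Fin d)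
  x ⊕ y = [ toℕ x + toℕ y ]

  ⊝_ : Op₁ (Fin d)
  -- The reduction matters at x = 0, where the difference is d.
  ⊝ x = [ d ∸ toℕ x ]

  []-+ : ∀ a b → [ a ] ⊕ [ b ] ≡ [ a + b ]
  []-+ a b = []-cong (trans (cong₂ (λ x y → (x + y) % d) (toℕ-[] a) (toℕ-[] b)) (sym (%-distribˡ-+ a b d)))

  ∣⇒[]≡𝟘 : ∀ {a} → d ∣ a → [ a ] ≡ [ 0 ]
  ∣⇒[]≡𝟘 {a} d∣a = []-cong (trans (n∣m⇒m%n≡0 a d d∣a) (sym (n∣m⇒m%n≡0 0 d (d ∣0))))

  private
    ⊕-assoc : ∀ x y z → (x ⊕ y) ⊕ z ≡ x ⊕ (y ⊕ z)
    ⊕-assoc x y z = begin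
      (x ⊕ y) ⊕ z                       ≡⟨ cong ((x ⊕ y) ⊕_) ([]-toℕ z) ⟨
      [ toℕ x + toℕ y ] ⊕ [ toℕ z ]     ≡⟨ []-+ _ _ ⟩
      [ (toℕ x + toℕ y) + toℕ z ]       ≡⟨ cong [_] (+-assoc (toℕ x) _ _) ⟩
      [ toℕ x + (toℕ y + toℕ z) ]       ≡⟨ []-+ _ _ ⟨
      [ toℕ x ] ⊕ (y ⊕ z)               ≡⟨ cong (_⊕ (y ⊕ z)) ([]-toℕ x) ⟩
      x ⊕ (y ⊕ z)                       ∎
      where open ≡-Reasoning

    ⊕-comm : ∀ x y → x ⊕ y ≡ y ⊕ x
    ⊕-comm x y = cong [_] (+-comm (toℕ x) (toℕ y))

    ⊕-identityˡ : ∀ x → [ 0 ] ⊕ x ≡ x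
    ⊕-identityˡ x = trans (cong ([ 0 ] ⊕_) (sym ([]-toℕ x))) (trans ([]-+ 0 (toℕ x)) ([]-toℕ x))

    ⊝-inverseˡ : ∀ x → (⊝ x) ⊕ x ≡ [ 0 ]
    ⊝-inverseˡ x = begin
      (⊝ x) ⊕ x                     ≡⟨ cong ((⊝ x) ⊕_) ([]-toℕ x) ⟨
      [ d ∸ toℕ x ] ⊕ [ toℕ x ]     ≡⟨ []-+ _ _ ⟩
      [ d ∸ toℕ x + toℕ x ]         ≡⟨ cong [_] (m∸n+n≡m (<⇒≤ (toℕ<n x))) ⟩
      [ d ]                         ≡⟨ ∣⇒[]≡𝟘 ∣-refl ⟩
      [ 0 ]                         ∎
      where open ≡-Reasoning

  isAbelianGroup : IsAbelianGroup _≡_ _⊕_ [ 0 ] ⊝_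
  isAbelianGroup = record
    { isGroup = record
      { isMonoid = record
        { isSemigroup = record { isMagma = isMagma _⊕_ ; assoc = ⊕-assoc }
        ; identity = ⊕-identityˡ , λ x → trans (⊕-comm x [ 0 ]) (⊕-identityˡ x) }
      ; inverse = ⊝-inverseˡ , λ x → trans (⊕-comm x (⊝ x)) (⊝-inverseˡ x)
      ; ⁻¹-cong = cong ⊝_ }
    ; comm = ⊕-comm }

  open Additive isAbelianGroup public

  ×ᵍ-[] : ∀ j a → j ×ᵍ [ a ] ≡ [ j * a ]
  ×ᵍ-[] zero    a = refl
  ×ᵍ-[] (suc j) a = trans (cong ([ a ] ⊕_) (×ᵍ-[] j a)) ([]-+ a (j * a))

  ×ᵍ-% : ∀ j x → (j % d) ×ᵍ x ≡ j ×ᵍ x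
  ×ᵍ-% j x = begin
    (j % d) ×ᵍ x             ≡⟨ cong ((j % d) ×ᵍ_) ([]-toℕ x) ⟨
    (j % d) ×ᵍ [ toℕ x ]     ≡⟨ ×ᵍ-[] (j % d) (toℕ x) ⟩
    [ j % d * toℕ x ]        ≡⟨ []-cong (begin
      (j % d * toℕ x) % d              ≡⟨ %-distribˡ-* (j % d) (toℕ x) d ⟩
      (j % d % d * (toℕ x % d)) % d    ≡⟨ cong (λ i → (i * (toℕ x % d)) % d) (m%n%n≡m%n j d) ⟩
      (j % d * (toℕ x % d)) % d        ≡⟨ %-distribˡ-* j (toℕ x) d ⟨
      (j * toℕ x) % d                  ∎) ⟩
    [ j * toℕ x ]            ≡⟨ ×ᵍ-[] j (toℕ x) ⟨
    j ×ᵍ [ toℕ x ]           ≡⟨ cong (j ×ᵍ_) ([]-toℕ x) ⟩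
    j ×ᵍ x                   ∎
    where open ≡-Reasoning

  ×ᵍ-* : ∀ i j x → (i * j) ×ᵍ x ≡ i ×ᵍ (j ×ᵍ x)
  ×ᵍ-* zero    j x = refl
  ×ᵍ-* (suc i) j x = trans (×ᵍ-+ j (i * j) x) (cong ((j ×ᵍ x) ⊕_) (×ᵍ-* i j x))

  ∣⇒×ᵍ≡𝟘 : ∀ {j} → d ∣ j → ∀ x → j ×ᵍ x ≡ [ 0 ]
  ∣⇒×ᵍ≡𝟘 {j} d∣j x = trans (sym (×ᵍ-% j x)) (cong (_×ᵍ x) (n∣m⇒m%n≡0 j d d∣j))

  bézout : ∀ a → ∃ λ j → j ×ᵍ [ a ] ≡ [ gcd a d ]
  bézout a with Bézout.identity (gcd-GCD a d)
  ... | Bézout.+- x y e = x , (begin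
      x ×ᵍ [ a ]                   ≡⟨ ×ᵍ-[] x a ⟩
      [ x * a ]                    ≡⟨ cong [_] e ⟨
      [ gcd a d + y * d ]          ≡⟨ []-cong ([m+kn]%n≡m%n (gcd a d) y d) ⟩
      [ gcd a d ]                  ∎)
    where open ≡-Reasoning
  -- The wanted coefficient is -x, written as x(d - 1).
  ... | Bézout.-+ x y e = x * (d ∸ 1) , ⊕-cancelʳ [ x * a ] (begin
      ((x * (d ∸ 1)) ×ᵍ [ a ]) ⊕ [ x * a ]   ≡⟨ cong (_⊕ [ x * a ]) (×ᵍ-[] (x * (d ∸ 1)) a) ⟩
      [ x * (d ∸ 1) * a ] ⊕ [ x * a ]        ≡⟨ []-+ _ _ ⟩
      [ x * (d ∸ 1) * a + x * a ]            ≡⟨ cong [_] (lemma x (d ∸ 1) a) ⟩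
      [ x * a * suc (d ∸ 1) ]                ≡⟨ ∣⇒[]≡𝟘 (∣n⇒∣m*n (x * a) (∣-reflexive (sym suc-pred-d))) ⟩
      [ 0 ]                                  ≡⟨ ∣⇒[]≡𝟘 (∣n⇒∣m*n y ∣-refl) ⟨
      [ y * d ]                              ≡⟨ cong [_] e ⟨
      [ gcd a d + x * a ]                    ≡⟨ []-+ _ _ ⟨
      [ gcd a d ] ⊕ [ x * a ]                ∎)
    where
    open ≡-Reasoning
    lemma : ∀ x e a → x * e * a + x * a ≡ x * a * suc e
    lemma = solve-∀
    suc-pred-d : suc (d ∸ 1) ≡ d
    suc-pred-d = m+[n∸m]≡n (n≢0⇒n>0 (≢-nonZero⁻¹ d))

  multiple-of-gcd : ∀ a {z} → gcd a d ∣ z → ∃ λ j → [ z ] ≡ j ×ᵍ [ a ]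
  multiple-of-gcd a {z} (divides q refl) with j , e ← bézout a = q * j , sym (begin
    (q * j) ×ᵍ [ a ]        ≡⟨ ×ᵍ-* q j [ a ] ⟩
    q ×ᵍ (j ×ᵍ [ a ])       ≡⟨ cong (q ×ᵍ_) e ⟩
    q ×ᵍ [ gcd a d ]        ≡⟨ ×ᵍ-[] q (gcd a d) ⟩
    [ q * gcd a d ]         ∎)
    where open ≡-Reasoning

  gcd∣⇒multiple : ∀ x {z} → gcd (toℕ x) d ∣ toℕ z → ∃ λ j → z ≡ j ×ᵍ x
  gcd∣⇒multiple x {z} g∣z with j , e ← multiple-of-gcd (toℕ x) g∣z =
    j , trans (sym ([]-toℕ z)) (trans e (cong (j ×ᵍ_) ([]-toℕ x)))

  ∣toℕ-[] : ∀ {q a} → q ∣ d → q ∣ a → q ∣ toℕ [ a ]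
  ∣toℕ-[] {q} {a} q∣d q∣a = subst (q ∣_) (sym (toℕ-[] a)) (%-presˡ-∣ q∣a q∣d)

  cyclic : ∀ x → ∃ λ Q → Subgroup Q × Cyclic x Q
  cyclic x = Q , record
    { has-𝟘    = ∈⟪⟫⁺ (∣toℕ-[] (gcd[m,n]∣n (toℕ x) d) (_ ∣0))
    ; ⊖-closed = λ {y} {z} p q → ∈⟪⟫⁺ (∣toℕ-[] g∣d (∣m∣n⇒∣m+n (∈⟪⟫⁻ p) (∣toℕ-[] g∣d
        (∣m+n∣m⇒∣n (subst (g ∣_) (sym (m+[n∸m]≡n (<⇒≤ (toℕ<n z)))) g∣d) (∈⟪⟫⁻ q)))))
    } , (λ j → ∈⟪⟫⁺ (multiple j)) , λ z p → gcd∣⇒multiple x (∈⟪⟫⁻ p)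
    where
    g : ℕ
    g = gcd (toℕ x) d
    g∣d : g ∣ d
    g∣d = gcd[m,n]∣n (toℕ x) d
    Q : FSet d
    Q = ⟪ (λ z → g ∣? toℕ z) ⟫
    multiple : ∀ j → g ∣ toℕ (j ×ᵍ x)
    multiple zero    = ∣toℕ-[] g∣d (g ∣0)
    multiple (suc j) = ∣toℕ-[] g∣d (∣m∣n⇒∣m+n (gcd[m,n]∣m (toℕ x) d) (multiple j))

  -- The bound for irreducible sum-free sets in ℤ_d

  module _ {k l : ℕ} (0<l : 0 < l) (l<k : l < k) {A : FSet d} (sum-free : SumFree′ k l A)
    (irreducible : ∀ x → x ≢ [ 0 ] → ¬ Reducible k l A x) where

    private
      δ : ℕ
      δ = gcd d (k ∸ l)
      δ∣d : δ ∣ d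
      δ∣d = gcd[m,n]∣m d (k ∸ l)
      instance
        δ≢0 : NonZero δ
        δ≢0 = ≢-nonZero λ e → m>n⇒m∸n≢0 l<k (gcd[m,n]≡0⇒n≡0 d e)
        k∸l≢0 : NonZero (k ∸ l)
        k∸l≢0 = ≢-nonZero (m>n⇒m∸n≢0 l<k)
        s≢0 : NonZero (k + l)
        s≢0 = >-nonZero (≤-trans 0<l (m≤n+m l k))
      δ≤d : δ ≤ d
      δ≤d = ∣⇒≤ δ∣d
      δ≤k : δ ≤ k
      δ≤k = ≤-trans (∣⇒≤ (gcd[m,n]∣n d (k ∸ l))) (m∸n≤m k l)

      k×-split : ∀ a → k ×ᵍ a ≡ ((k ∸ l) ×ᵍ a) ⊕ (l ×ᵍ a)
      k×-split a = trans (cong (_×ᵍ a) (sym (m∸n+n≡m (<⇒≤ l<k)))) (×ᵍ-+ (k ∸ l) l a)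

      multiple∈ : ∀ {a} → a ∈ A → ∀ j → j ×ᵍ a ∈ iter j A
      multiple∈ {a} a∈A j = subst (_∈ iter j A) (group (j ×ᵍ a ∷ []) (λ u → u :⊖ :𝟘 :≈ u) refl)
        (iter-progression {A} {a} {a} {0} (λ where zero _ → subst (_∈ A) (group (a ∷ []) (λ a → a :≈ a :⊖ :𝟘) refl) a∈A) j 0 z≤n)

      -- δ divides d, and δ = d would give d ∣ k - l and hence ka = la.
      2δ≤d : ∀ {a} → a ∈ A → δ + δ ≤ d
      2δ≤d {a} a∈A with δ∣d
      ... | divides 0 e = ⊥-elim (≢-nonZero⁻¹ d e)
      ... | divides 1 e = ⊥-elim (sum-free (k ×ᵍ a) (multiple∈ a∈A k) (subst (_∈ iter l A) (sym (begin
            k ×ᵍ a                           ≡⟨ k×-split a ⟩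
            ((k ∸ l) ×ᵍ a) ⊕ (l ×ᵍ a)        ≡⟨ cong (_⊕ (l ×ᵍ a)) (∣⇒×ᵍ≡𝟘 d∣k-l a) ⟩
            [ 0 ] ⊕ (l ×ᵍ a)                 ≡⟨ group (l ×ᵍ a ∷ []) (λ u → :𝟘 :⊕ u :≈ u) refl ⟩
            l ×ᵍ a                           ∎)) (multiple∈ a∈A l)))
            where
            open ≡-Reasoning
            d∣k-l : d ∣ k ∸ l
            d∣k-l = subst (_∣ k ∸ l) (sym (trans e (*-identityˡ δ))) (gcd[m,n]∣n d (k ∸ l))
      ... | divides (suc (suc t)) e = begin
            δ + δ                ≤⟨ +-monoʳ-≤ δ (m≤m+n δ (t * δ)) ⟩
            δ + (δ + t * δ)      ≡⟨ e ⟨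
            d                    ∎
            where open ≤-Reasoning

      room : ∀ {m} → k * m + l * m + δ < d → m < progressionSize k l d δ
      room {m} lt = room⇒size δ≤d δ≤k (subst (λ s → s + δ < d) (sym (*-distribʳ-+ m k l)) lt)

      -- With a = ux and y the residue of (k - l)u, the set kA - lA contains (y - i + j)x for all i
      -- ≤ km and j ≤ lm. Missing 0 means km < y and lm < d - y. As the progression runs downwards
      -- from a, the gap is witnessed by d - y.
      from-progression : ∀ {m x a} → (∀ z → ∃ λ j → z ≡ j ×ᵍ x) → (∀ i → i ≤ m → a ⊖ (i ×ᵍ x) ∈ A) →
        m < progressionSize k l d δ
      from-progression {m} {x} {a} generator inA with u , a≡ ← generator a =
        gap⇒size δ≤d δ≤k {m} {d ∸ y}
          (∣m+n∣m⇒∣n (subst (δ ∣_) (sym (m+[n∸m]≡n (<⇒≤ y<d))) δ∣d) δ∣y)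
          (m+n≤o⇒m≤o∸n (suc (l * m)) (≰⇒> λ le → distinct {0} {d ∸ y} z≤n
            (m≤n+o⇒m∸n≤o d y (subst (d ≤_) (+-comm (l * m) y) le)) (begin
              (y ×ᵍ x) ⊕ ((d ∸ y) ×ᵍ x)     ≡⟨ ×ᵍ-+ y (d ∸ y) x ⟨
              (y + (d ∸ y)) ×ᵍ x            ≡⟨ cong (_×ᵍ x) (m+[n∸m]≡n (<⇒≤ y<d)) ⟩
              d ×ᵍ x                        ≡⟨ ∣⇒×ᵍ≡𝟘 ∣-refl x ⟩
              [ 0 ]                         ∎)))
          (linarith (d ∷ y ∷ d ∸ y ∷ k * m ∷ [])
            (λ d y e km → con 1 :+ km :≤ y ∷ y :+ e :≤ d ∷ [] , con 1 :+ (e :+ km) :≤ d)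
            (≰⇒> λ le → distinct {y} {0} le z≤n (group (y ×ᵍ x ∷ []) (λ u → u :⊕ :𝟘 :≈ u) refl))
            (≤-reflexive (m+[n∸m]≡n (<⇒≤ y<d))))
        where
        open ≡-Reasoning
        y : ℕ
        y = ((k ∸ l) * u) % d
        y<d : y < d
        y<d = m%n<n ((k ∸ l) * u) d
        δ∣y : δ ∣ y
        δ∣y = %-presˡ-∣ (∣m⇒∣m*n u (gcd[m,n]∣n d (k ∸ l))) δ∣d
        distinct : ∀ {i j} → i ≤ k * m → j ≤ l * m → (y ×ᵍ x) ⊕ (j ×ᵍ x) ≢ i ×ᵍ x
        distinct {i} {j} i≤ j≤ e = sum-free ((k ×ᵍ a) ⊖ (i ×ᵍ x)) (iter-progression inA k i i≤)
          (subst (_∈ iter l A) (sym (begin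
            (k ×ᵍ a) ⊖ (i ×ᵍ x)
              ≡⟨ cong₂ _⊖_ (k×-split a) (sym e) ⟩
            (((k ∸ l) ×ᵍ a) ⊕ (l ×ᵍ a)) ⊖ ((y ×ᵍ x) ⊕ (j ×ᵍ x))
              ≡⟨ cong (λ v → (v ⊕ (l ×ᵍ a)) ⊖ ((y ×ᵍ x) ⊕ (j ×ᵍ x))) (begin
                (k ∸ l) ×ᵍ a            ≡⟨ cong ((k ∸ l) ×ᵍ_) a≡ ⟩
                (k ∸ l) ×ᵍ (u ×ᵍ x)     ≡⟨ ×ᵍ-* (k ∸ l) u x ⟨
                ((k ∸ l) * u) ×ᵍ x      ≡⟨ ×ᵍ-% ((k ∸ l) * u) x ⟨
                y ×ᵍ x                  ∎) ⟩
            ((y ×ᵍ x) ⊕ (l ×ᵍ a)) ⊖ ((y ×ᵍ x) ⊕ (j ×ᵍ x))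
              ≡⟨ group (y ×ᵍ x ∷ l ×ᵍ a ∷ j ×ᵍ x ∷ []) (λ y l j → (y :⊕ l) :⊖ (y :⊕ j) :≈ l :⊖ j) refl ⟩
            (l ×ᵍ a) ⊖ (j ×ᵍ x) ∎))
          (iter-progression inA l j j≤))

    irreducible-bound : card A ≤ progressionSize k l d δ
    irreducible-bound = by-contradiction (card A) refl
      where
      by-contradiction : ∀ c → card A ≡ c → card A ≤ progressionSize k l d δ
      by-contradiction zero    e = ≤-trans (≤-reflexive e) z≤n
      by-contradiction (suc m) e with card A ≤? progressionSize k l d δ
      ... | yes le = le
      ... | no ≰ with a , a∈A ← 0<card⇒∃ {X = A} (subst (0 <_) (sym e) (s≤s z≤n)) = ⊥-elim (refute m (λ lt → ≰ (subst (_≤ progressionSize k l d δ) (sym e) lt)) e)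
        where
        refute : ∀ m → ¬ (m < progressionSize k l d δ) → card A ≡ suc m → ⊥
        refute zero    ≮ _ = ≮ (room (linarith (δ ∷ d ∷ k * 0 ∷ l * 0 ∷ [])
          (λ δ d p q → δ :+ δ :≤ d ∷ con 1 :≤ δ ∷ p :≤ con 0 ∷ q :≤ con 0 ∷ [] , con 1 :+ (p :+ q :+ δ) :≤ d)
          (2δ≤d a∈A) (n≢0⇒n>0 (≢-nonZero⁻¹ δ)) (≤-reflexive (*-zeroʳ k)) (≤-reflexive (*-zeroʳ l))))
        refute (suc m′) ≮ e = outcome (≤-trans 0<l (<⇒≤ l<k)) 0<l sum-free irreducible cyclic a∈A e (s≤s z≤n) λ where
          -- Both (k + l)m + 2 and δ are at most d/2.
          (proper-bound {u} km+lm 2u≤d) → ≮ (room (≰⇒> λ d≤ → <⇒≱ {0} {1} (s≤s z≤n)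
            (linarith (δ ∷ d ∷ k * suc m′ ∷ l * suc m′ ∷ u ∷ [])
              (λ δ d p q u → p :+ q :+ con 2 :≤ u ∷ p :+ q :+ con 2 :≤ u ∷ u :+ u :≤ d ∷ δ :+ δ :≤ d ∷ d :≤ p :+ q :+ δ ∷
                d :≤ p :+ q :+ δ ∷ [] , con 1 :≤ con 0)
              km+lm km+lm 2u≤d (2δ≤d a∈A) d≤ d≤)))
          (strict km+lm+k) → ≮ (room (linarith (δ ∷ d ∷ k * suc m′ ∷ l * suc m′ ∷ k ∷ [])
            (λ δ d p q k → p :+ q :+ (con 1 :+ k) :≤ d ∷ δ :≤ k ∷ [] , con 1 :+ (p :+ q :+ δ) :≤ d)
            km+lm+k δ≤k))
          (progression′ {x} {a} generator inA) → ≮ (from-progression {suc m′} {x} {a} generator inA)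

-- Counting in cyclic groups and passing to quotients

opaque
  unfolding card

  card-+ : ∀ a b (P : ℕ → Bool) →
    card {a + b} (P ∘ toℕ) ≡ card {a} (P ∘ toℕ) + card {b} (λ i → P (a + toℕ i))
  card-+ zero    b P = refl
  card-+ (suc a) b P = trans (cong (ind (P 0) +_) (card-+ a b (P ∘ suc))) (sym (+-assoc (ind (P 0)) _ _))

  card-lookup : ∀ {n} (A : Subset n) → card (lookup A) ≡ ∣ A ∣
  card-lookup []          = refl
  card-lookup (true ∷ A)  = cong suc (card-lookup A)
  card-lookup (false ∷ A) = card-lookup A

card-initial : ∀ a {d} → a ≤ d → card {d} ⟪ (λ z → toℕ z <? a) ⟫ ≡ a
card-initial a {d} a≤d with b , refl ← m≤n⇒∃[o]m+o≡n a≤d = begin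
  card {a + b} ⟪ (λ z → toℕ z <? a) ⟫
    ≡⟨ card-cong (⊆-antisym (λ i p → mem (dec-true (toℕ i <? a) (∈⟪⟫⁻ p))) (λ i (mem p) → ∈⟪⟫⁺ (does⁻ (toℕ i <? a) p))) ⟩
  card {a + b} (P ∘ toℕ)
    ≡⟨ card-+ a b P ⟩
  card {a} (P ∘ toℕ) + card {b} (λ i → P (a + toℕ i))
    ≡⟨ cong₂ _+_
         (trans (card-cong (⊆-antisym {Y = full} (λ _ _ → ∈full) λ i _ → mem (dec-true (toℕ i <? a) (toℕ<n i)))) (card-full a))
         (card-∅ _ λ i (mem p) → <⇒≱ (does⁻ (a + toℕ i <? a) p) (m≤m+n a (toℕ i))) ⟩
  a + 0
    ≡⟨ +-identityʳ a ⟩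
  a ∎
  where
  open ≡-Reasoning
  P : ℕ → Bool
  P i = does (i <? a)

module _ (q : ℕ) .{{_ : NonZero q}} where
  private module Q = ℤmod q

  card-periodic : ∀ e {d} (X : FSet q) → d ≡ e * q → card {d} (λ i → X Q.[ toℕ i ]) ≡ e * card X
  card-periodic zero    X refl = card-∅ {0} _ λ ()
  card-periodic (suc e) X refl = begin
    card {q + e * q} (λ i → X Q.[ toℕ i ])
      ≡⟨ card-+ q (e * q) (λ i → X Q.[ i ]) ⟩
    card {q} (λ i → X Q.[ toℕ i ]) + card {e * q} (λ i → X Q.[ q + toℕ i ])
      ≡⟨ cong₂ _+_ (card-cong {q} λ i → cong X (Q.[]-toℕ i))
           (trans (card-cong {e * q} λ i → cong X (Q.[]-cong (trans (cong (_% q) (+-comm q (toℕ i))) ([m+n]%n≡m%n (toℕ i) q))))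
             (card-periodic e X refl)) ⟩
    card X + e * card X ∎
    where open ≡-Reasoning

module Quotient (d q : ℕ) .{{_ : NonZero d}} .{{_ : NonZero q}} (q∣d : q ∣ d) where
  private
    module D = ℤmod d
    module Q = ℤmod q

  π : Fin d → Fin q
  π z = Q.[ toℕ z ]

  π-[] : ∀ a → π D.[ a ] ≡ Q.[ a ]
  π-[] a = Q.[]-cong (trans (cong (_% q) (D.toℕ-[] a)) (m∣n⇒o%n%m≡o%m q d a q∣d))

  π-⊕ : ∀ x y → π (x D.⊕ y) ≡ π x Q.⊕ π y
  π-⊕ x y = trans (π-[] (toℕ x + toℕ y)) (sym (Q.[]-+ (toℕ x) (toℕ y)))

  image : FSet d → FSet q
  image A = ⟪ (λ w → any? λ z → (z ∈? A) ×-dec (π z ≟ᶠ w)) ⟫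

  iter-lift : ∀ {A} j {w} → w ∈ Q.iter j (image A) → ∃ λ z → z ∈ D.iter j A × π z ≡ w
  iter-lift zero p = D.[ 0 ] , ∈⁅⁆⁺ refl , trans (π-[] 0) (sym (∈⁅⁆⁻ p))
  iter-lift {A} (suc j) p with s , b , s∈ , b∈ , refl ← Q.∈⊞⁻ p
    with z , z∈ , refl ← iter-lift {A} j s∈ with c , c∈ , refl ← ∈⟪⟫⁻ b∈ = z D.⊕ c , D.∈⊞⁺ z∈ c∈ , π-⊕ z c

  -- The kernel of reduction modulo gcd(x, d) consists of the multiples of x in ℤ_d.
  π-kernel : ∀ {x z w} → gcd (toℕ x) d ≡ q → π z ≡ π w → ∃ λ j → z ≡ w D.⊕ (j D.×ᵍ x)
  π-kernel {x} {z} {w} refl e = 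
    let j , e′ = D.gcd∣⇒multiple x {z D.⊖ w} (m%n≡0⇒n∣m _ q (trans (sym (Q.toℕ-[] (toℕ (z D.⊖ w)))) (trans (cong toℕ kernel) (trans (Q.toℕ-[] 0) (n∣m⇒m%n≡0 0 q (q ∣0))))))
    in j , trans (D.group (z ∷ w ∷ []) (λ z w → z :≈ w :⊕ (z :⊖ w)) refl) (cong (w D.⊕_) e′)
    where
    kernel : π (z D.⊖ w) ≡ Q.[ 0 ]
    kernel = Q.⊕-cancelʳ (π w) (begin
      π (z D.⊖ w) Q.⊕ π w       ≡⟨ π-⊕ (z D.⊖ w) w ⟨
      π ((z D.⊖ w) D.⊕ w)       ≡⟨ cong π (D.group (z ∷ w ∷ []) (λ z w → (z :⊖ w) :⊕ w :≈ z) refl) ⟩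
      π z                       ≡⟨ e ⟩
      π w                       ≡⟨ Q.group (π w ∷ []) (λ w → w :≈ :𝟘 :⊕ w) refl ⟩
      Q.[ 0 ] Q.⊕ π w           ∎)
      where open ≡-Reasoning

  image-sum-free : ∀ {k l A x} → gcd (toℕ x) d ≡ q → D.Reducible k l A x → Q.SumFree′ k l (image A)
  image-sum-free {k} {l} {A} {x} g≡q red w p p′ =
    let z , z∈ , e = iter-lift {A} k p
        z′ , z′∈ , e′ = iter-lift {A} l p′
        j , eq = π-kernel {x} g≡q (trans e (sym e′))
    in red j z∈ z′∈ eq

  card-image : ∀ {e} A → d ≡ e * q → card A ≤ e * card (image A)
  card-image {e} A d≡ = ≤-trans
    (card-mono {d} {A} {λ i → image A (π i)} λ i p → mem (holds (∈⟪⟫⁺ {P? = λ w → any? λ z → (z ∈? A) ×-dec (π z ≟ᶠ w)} {i = π i} (i , p , refl))))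
    (≤-reflexive (card-periodic q e (image A) d≡))

-- The upper bound

module _ {n k l : ℕ} .{{_ : NonZero n}} (0<l : 0 < l) (l<k : l < k) where

  -- Induction on d; the factor e = n/d compensates for |A| ≤ (d/q)|image A| when passing to ℤ_q. If
  -- the bound fails, no nonzero x is reducible, since the induction hypothesis for the quotient
  -- would prove the bound.
  sum-free-bound : ∀ f d .{{_ : NonZero d}} e (A : FSet d) → d ≤ f → n ≡ e * d → ℤmod.SumFree′ d k l A →
    e * card A ≤ rhs n k l
  sum-free-bound zero d e A d≤0 _ _ = ⊥-elim (≢-nonZero⁻¹ d (n≤0⇒n≡0 d≤0))
  sum-free-bound (suc f) d e A d≤f n≡ sf with e * card A ≤? rhs n k l
  ... | yes le = le
  ... | no ≰ = ⊥-elim (≰ (begin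
      e * card A                              ≤⟨ *-monoʳ-≤ e (D.irreducible-bound 0<l l<k sf irreducible) ⟩
      e * progressionSize k l d (gcd d (k ∸ l))  ≡⟨ *-comm e _ ⟩
      progressionSize k l d (gcd d (k ∸ l)) * e  ≡⟨ cong (progressionSize k l d (gcd d (k ∸ l)) *_) (trans (cong (λ n → ceilDiv n d) n≡) (ceilDiv-* e d)) ⟨
      term n k l d                            ≤⟨ ≤-maxOverDivisors (term n k l) (divides e n≡) ⟩
      rhs n k l                               ∎))
    where
    open ≤-Reasoning
    module D = ℤmod d
    irreducible : ∀ x → x ≢ D.[ 0 ] → ¬ D.Reducible k l A x
    irreducible x x≢𝟘 red = reduce (gcd (toℕ x) d) refl
      where
      reduce : ∀ q → gcd (toℕ x) d ≡ q → ⊥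
      reduce zero    g≡ = ≢-nonZero⁻¹ d (gcd[m,n]≡0⇒n≡0 (toℕ x) g≡)
      reduce q@(suc _) g≡ with q∣d@(divides e′ d≡) ← subst (_∣ d) g≡ (gcd[m,n]∣n (toℕ x) d) = ≰ (begin
          e * card A                   ≤⟨ *-monoʳ-≤ e (card-image {e′} A d≡) ⟩
          e * (e′ * card (image A))    ≡⟨ *-assoc e e′ _ ⟨
          e * e′ * card (image A)      ≤⟨ sum-free-bound f q (e * e′) (image A) (≤-pred (≤-trans q<d d≤f))
                                            (trans n≡ (trans (cong (e *_) d≡) (sym (*-assoc e e′ q)))) (image-sum-free {k} {l} {A} {x} g≡ red) ⟩
          rhs n k l                    ∎)
        where
        open Quotient d q q∣d
        x≢0 : toℕ x ≢ 0
        x≢0 e = x≢𝟘 (trans (sym (D.[]-toℕ x)) (cong D.[_] e))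
        q<d : q < d
        q<d = ≤-<-trans (∣⇒≤ {{≢-nonZero x≢0}} (subst (_∣ toℕ x) g≡ (gcd[m,n]∣m (toℕ x) d))) (toℕ<n x)

-- The lower bound: preimages of intervals

module _ {n d e k l m y : ℕ} .{{_ : NonZero n}} .{{_ : NonZero d}} (n≡ : n ≡ e * d) (0<l : 0 < l) (l<k : l < k)
  (δ∣y : gcd d (k ∸ l) ∣ y) (<y : l * m < y) (y< : y + k * m < d) where

  private
    module D = ℤmod d

    y≤d : y ≤ d
    y≤d = ≤-trans (m≤m+n y (k * m)) (<⇒≤ y<)

    gcd∣ : gcd (k ∸ l) d ∣ d ∸ y
    gcd∣ = subst (_∣ d ∸ y) (gcd-comm d (k ∸ l))
      (∣m+n∣m⇒∣n (subst (gcd d (k ∸ l) ∣_) (sym (m+[n∸m]≡n y≤d)) (gcd[m,n]∣m d (k ∸ l))) δ∣y)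

    -- Chosen with (k - l) · shift ≡ -y modulo d, which is possible because gcd(d, k - l) divides y.
    shift : ℕ
    shift = proj₁ (D.multiple-of-gcd (k ∸ l) gcd∣)

    shift-gap : D.[ d ∸ y ] ≡ shift D.×ᵍ D.[ k ∸ l ]
    shift-gap = proj₂ (D.multiple-of-gcd (k ∸ l) gcd∣)

    I : FSet d
    I = ⟪ (λ z → toℕ z <? suc m) ⟫

  -- The preimage in ℤ_n of the residues -shift, ..., -shift + m modulo d.
  interval : FSet n
  interval i = (D.⊝ D.[ shift ] D.▹ I) D.[ toℕ i ]

  card-interval : card interval ≡ suc m * e
  card-interval = begin
    card interval                            ≡⟨ card-periodic d e (D.⊝ D.[ shift ] D.▹ I) n≡ ⟩
    e * card (D.⊝ D.[ shift ] D.▹ I)         ≡⟨ cong (e *_) (trans (D.card-▹ (D.⊝ D.[ shift ]) I) (card-initial (suc m) m<d)) ⟩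
    e * suc m                                ≡⟨ *-comm e (suc m) ⟩
    suc m * e                                ∎
    where
    open ≡-Reasoning
    m<d : m < d
    m<d = ≤-<-trans (≤-trans (m≤n*m m k {{>-nonZero (≤-trans 0<l (<⇒≤ l<k))}}) (m≤n+m (k * m) y)) y<

  interval⁻ : ∀ {i} → i ∈ interval → ∃ λ s → s ≤ m × D.[ toℕ i ] D.⊕ D.[ shift ] ≡ D.[ s ]
  interval⁻ {i} (mem p) = toℕ z , ≤-pred (∈⟪⟫⁻ (D.∈▹⁻ (mem p))) ,
    trans (D.group (D.[ toℕ i ] ∷ D.[ shift ] ∷ []) (λ x a → x :⊕ a :≈ x :⊖ :⊝ a) refl) (sym (D.[]-toℕ z))
    where
    z : Fin d
    z = D.[ toℕ i ] D.⊖ (D.⊝ D.[ shift ])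

  interval-sum : ∀ j (a : Fin j → Fin n) → (∀ i → a i ∈ interval) →
    ∃ λ s → s ≤ j * m × D.[ sumF (λ i → toℕ (a i)) ] D.⊕ (j D.×ᵍ D.[ shift ]) ≡ D.[ s ]
  interval-sum zero    a a∈ = 0 , z≤n , D.group (D.[ 0 ] ∷ []) (λ x → :𝟘 :⊕ :𝟘 :≈ :𝟘) refl
  interval-sum (suc j) a a∈ =
    let s , s≤ , e  = interval⁻ (a∈ zero)
        t , t≤ , e′ = interval-sum j (a ∘ suc) (a∈ ∘ suc)
        x = toℕ (a zero)
        Σa = sumF (λ i → toℕ (a (suc i)))
    in s + t , +-mono-≤ s≤ t≤ , (begin
      D.[ x + Σa ] D.⊕ (D.[ shift ] D.⊕ (j D.×ᵍ D.[ shift ]))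
        ≡⟨ cong (D._⊕ (D.[ shift ] D.⊕ (j D.×ᵍ D.[ shift ]))) (D.[]-+ x Σa) ⟨
      (D.[ x ] D.⊕ D.[ Σa ]) D.⊕ (D.[ shift ] D.⊕ (j D.×ᵍ D.[ shift ]))
        ≡⟨ D.⊕-interchange D.[ x ] D.[ Σa ] D.[ shift ] (j D.×ᵍ D.[ shift ]) ⟩
      (D.[ x ] D.⊕ D.[ shift ]) D.⊕ (D.[ Σa ] D.⊕ (j D.×ᵍ D.[ shift ]))
        ≡⟨ cong₂ D._⊕_ e e′ ⟩
      D.[ s ] D.⊕ D.[ t ]
        ≡⟨ D.[]-+ s t ⟩
      D.[ s + t ] ∎)
    where open ≡-Reasoning

  -- Equal sums would give s + y ≡ t modulo d with s ≤ km and t ≤ lm, although t ≤ lm < y ≤ s + y <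
  -- d.
  interval-sum-free : ∀ (a : Fin k → Fin n) (b : Fin l → Fin n) → (∀ i → a i ∈ interval) → (∀ j → b j ∈ interval) →
    sumF (λ i → toℕ (a i)) % n ≢ sumF (λ j → toℕ (b j)) % n
  interval-sum-free a b a∈ b∈ eq =
    let s , s≤ , e  = interval-sum k a a∈
        t , t≤ , e′ = interval-sum l b b∈
    in separate s≤ t≤ (begin
      D.[ s + y ]
        ≡⟨ D.[]-+ s y ⟨
      D.[ s ] D.⊕ D.[ y ]
        ≡⟨ cong (D._⊕ D.[ y ]) e ⟨
      (D.[ Σa ] D.⊕ (k D.×ᵍ D.[ shift ])) D.⊕ D.[ y ]
        ≡⟨ cong₂ (λ u v → (u D.⊕ v) D.⊕ D.[ y ]) same k×shift ⟩
      (D.[ Σb ] D.⊕ (D.[ d ∸ y ] D.⊕ (l D.×ᵍ D.[ shift ]))) D.⊕ D.[ y ]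
        ≡⟨ D.group (D.[ Σb ] ∷ D.[ d ∸ y ] ∷ (l D.×ᵍ D.[ shift ]) ∷ D.[ y ] ∷ [])
             (λ b g u y → (b :⊕ (g :⊕ u)) :⊕ y :≈ (b :⊕ u) :⊕ (g :⊕ y)) refl ⟩
      (D.[ Σb ] D.⊕ (l D.×ᵍ D.[ shift ])) D.⊕ (D.[ d ∸ y ] D.⊕ D.[ y ])
        ≡⟨ cong₂ D._⊕_ e′ (trans (D.[]-+ (d ∸ y) y) (trans (cong D.[_] (m∸n+n≡m y≤d)) (D.∣⇒[]≡𝟘 ∣-refl))) ⟩
      D.[ t ] D.⊕ D.[ 0 ]
        ≡⟨ D.group (D.[ t ] ∷ []) (λ t → t :⊕ :𝟘 :≈ t) refl ⟩
      D.[ t ] ∎)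
    where
    open ≡-Reasoning
    Σa Σb : ℕ
    Σa = sumF (λ i → toℕ (a i))
    Σb = sumF (λ j → toℕ (b j))
    same : D.[ Σa ] ≡ D.[ Σb ]
    same = D.[]-cong (trans (sym (m∣n⇒o%n%m≡o%m d n Σa d∣n)) (trans (cong (_% d) eq) (m∣n⇒o%n%m≡o%m d n Σb d∣n)))
      where
      d∣n : d ∣ n
      d∣n = divides e n≡
    k×shift : k D.×ᵍ D.[ shift ] ≡ D.[ d ∸ y ] D.⊕ (l D.×ᵍ D.[ shift ])
    k×shift = begin
      k D.×ᵍ D.[ shift ]
        ≡⟨ cong (D._×ᵍ D.[ shift ]) (m∸n+n≡m (<⇒≤ l<k)) ⟨
      (k ∸ l + l) D.×ᵍ D.[ shift ]
        ≡⟨ D.×ᵍ-+ (k ∸ l) l D.[ shift ] ⟩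
      ((k ∸ l) D.×ᵍ D.[ shift ]) D.⊕ (l D.×ᵍ D.[ shift ])
        ≡⟨ cong (D._⊕ (l D.×ᵍ D.[ shift ])) (begin
             (k ∸ l) D.×ᵍ D.[ shift ]    ≡⟨ D.×ᵍ-[] (k ∸ l) shift ⟩
             D.[ (k ∸ l) * shift ]       ≡⟨ cong D.[_] (*-comm (k ∸ l) shift) ⟩
             D.[ shift * (k ∸ l) ]       ≡⟨ D.×ᵍ-[] shift (k ∸ l) ⟨
             shift D.×ᵍ D.[ k ∸ l ]      ≡⟨ shift-gap ⟨
             D.[ d ∸ y ]                 ∎) ⟩
      D.[ d ∸ y ] D.⊕ (l D.×ᵍ D.[ shift ]) ∎
    separate : ∀ {s t} → s ≤ k * m → t ≤ l * m → D.[ s + y ] ≢ D.[ t ]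
    separate {s} {t} s≤ t≤ p = <⇒≢ t<s+y (sym (begin
      s + y        ≡⟨ m<n⇒m%n≡m s+y<d ⟨
      (s + y) % d  ≡⟨ D.[]-injective p ⟩
      t % d        ≡⟨ m<n⇒m%n≡m (<-trans t<s+y s+y<d) ⟩
      t            ∎))
      where
      t<s+y : t < s + y
      t<s+y = ≤-trans (s≤s t≤) (≤-trans <y (m≤n+m y s))
      s+y<d : s + y < d
      s+y<d = ≤-trans (s≤s (≤-trans (+-monoˡ-≤ y s≤) (≤-reflexive (+-comm (k * m) y)))) y<

-- Comparison with the given notion of sum-free sets

module _ (n : ℕ) .{{_ : NonZero n}} (k l : ℕ) where
  private module R = ℤmod n

  iter⇒sum : ∀ {X} j {z} → z ∈ R.iter j X → ∃ λ (a : Fin j → Fin n) → (∀ i → a i ∈ X) × R.[ sumF (λ i → toℕ (a i)) ] ≡ z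
  iter⇒sum zero p = (λ ()) , (λ ()) , sym (∈⁅⁆⁻ p)
  iter⇒sum {X} (suc j) p with s , b , s∈ , b∈ , refl ← R.∈⊞⁻ p with a , a∈ , refl ← iter⇒sum {X} j s∈ =
    (λ where zero → b ; (suc i) → a i) , (λ where zero → b∈ ; (suc i) → a∈ i) , (begin
      R.[ toℕ b + sumF (λ i → toℕ (a i)) ]              ≡⟨ R.[]-+ (toℕ b) _ ⟨
      R.[ toℕ b ] R.⊕ R.[ sumF (λ i → toℕ (a i)) ]      ≡⟨ cong (R._⊕ R.[ sumF (λ i → toℕ (a i)) ]) (R.[]-toℕ b) ⟩
      b R.⊕ R.[ sumF (λ i → toℕ (a i)) ]                ≡⟨ R.group (b ∷ R.[ sumF (λ i → toℕ (a i)) ] ∷ []) (λ b s → b :⊕ s :≈ s :⊕ b) refl ⟩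
      R.[ sumF (λ i → toℕ (a i)) ] R.⊕ b                ∎)
    where open ≡-Reasoning

  SumFree⇒ : ∀ {A} → SumFree n k l A → R.SumFree′ k l (lookup A)
  SumFree⇒ {A} sf z p q =
    let a , a∈ , e  = iter⇒sum {lookup A} k p
        b , b∈ , e′ = iter⇒sum {lookup A} l q
    in sf (a , b , (λ i → lookup⇒[]= (a i) A (holds (a∈ i))) , (λ j → lookup⇒[]= (b j) A (holds (b∈ j))) ,
           R.[]-injective (trans e (sym e′)))

realize : ∀ {n} (X : FSet n) → ∣ tabulate X ∣ ≡ card X
realize X = trans (sym (card-lookup (tabulate X))) (card-cong (lookup∘tabulate X))

∈-tabulate : ∀ {n} {X : FSet n} {i} → i ∈ˢ tabulate X → i ∈ X
∈-tabulate {X = X} {i} p = mem (trans (sym (lookup∘tabulate X i)) ([]=⇒lookup p))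

attained : (n k l : ℕ) .{{_ : NonZero n}} → 0 < l → l < k →
  ∀ d → d ∣ n → Σ (Subset n) λ A → SumFree n k l A × ∣ A ∣ ≡ term n k l d
attained n k l 0<l l<k d (divides e n≡) = construct (progressionSize k l d δ) refl
  where
  δ : ℕ
  δ = gcd d (k ∸ l)
  instance
    d≢0 : NonZero d
    d≢0 = ≢-nonZero λ where refl → ≢-nonZero⁻¹ n (trans n≡ (*-zeroʳ e))
    δ≢0 : NonZero δ
    δ≢0 = ≢-nonZero λ e → m>n⇒m∸n≢0 l<k (gcd[m,n]≡0⇒n≡0 d e)
    k∸l≢0 : NonZero (k ∸ l)
    k∸l≢0 = ≢-nonZero (m>n⇒m∸n≢0 l<k)
    s≢0 : NonZero (k + l)
    s≢0 = >-nonZero (≤-trans 0<l (m≤n+m l k))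
  size : ∀ {c} → progressionSize k l d δ ≡ c → c * e ≡ term n k l d
  size refl = cong (progressionSize k l d δ *_) (trans (sym (ceilDiv-* e d)) (cong (λ n → ceilDiv n d) (sym n≡)))
  construct : ∀ c → progressionSize k l d δ ≡ c → Σ (Subset n) λ A → SumFree n k l A × ∣ A ∣ ≡ term n k l d
  construct zero eq = tabulate (λ _ → false) ,
    (λ (a , _ , a∈ , _) → empty (>-nonZero (≤-trans 0<l (<⇒≤ l<k))) a a∈) ,
    trans (realize {n} (λ _ → false)) (trans (card-∅ {n} (λ _ → false) λ i ()) (size eq))
    where
    empty : ∀ {j} → NonZero j → (a : Fin j → Fin n) → ¬ (∀ i → a i ∈ˢ tabulate (λ _ → false))
    empty {suc j} _ a a∈ with mem () ← ∈-tabulate {X = λ _ → false} (a∈ zero)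
  construct (suc m) eq =
    let y , δ∣y , <y , y< = size⇒gap {k} {l} {d} {δ} (∣⇒≤ (gcd[m,n]∣m d (k ∸ l)))
          (≤-trans (∣⇒≤ (gcd[m,n]∣n d (k ∸ l))) (m∸n≤m k l)) {m} (≤-reflexive (sym eq))
    in tabulate (interval {e = e} n≡ 0<l l<k δ∣y <y y<) ,
       (λ (a , b , a∈ , b∈ , eq′) → interval-sum-free {e = e} n≡ 0<l l<k δ∣y <y y< a b (∈-tabulate ∘ a∈) (∈-tabulate ∘ b∈) eq′) ,
       trans (realize (interval {e = e} n≡ 0<l l<k δ∣y <y y<)) (trans (card-interval {e = e} n≡ 0<l l<k δ∣y <y y<) (size eq))

theorem6 : (n k l : ℕ) .{{_ : NonZero n}} → 0 < l → l < k →
    IsMu n k l (rhs n k l)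
theorem6 n k l 0<l l<k = witness , λ A sf →
  subst (_≤ rhs n k l) (trans (*-identityˡ _) (card-lookup A))
    (sum-free-bound {n} {k} {l} 0<l l<k n n 1 (lookup A) ≤-refl (sym (*-identityˡ n)) (SumFree⇒ n k l sf))
  where
  witness : Σ (Subset n) λ A → SumFree n k l A × ∣ A ∣ ≡ rhs n k l
  witness with maxOverDivisors-attained n (term n k l)
  ... | inj₂ (d , d∣n , e) = let A , sf , size = attained n k l 0<l l<k d d∣n in A , sf , trans size (sym e)
  -- The fold may return its initial value 0. Then the term of d = 1 is 0 as well, and its set
  -- serves as witness.
  ... | inj₁ zero-max = let A , sf , size = attained n k l 0<l l<k 1 (1∣ n) in
        A , sf , trans size (≤-antisym (≤-maxOverDivisors (term n k l) (1∣ n)) (subst (_≤ term n k l 1) (sym zero-max) z≤n))
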